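{- Let $\ell$ be an odd prime, $n$ a positive integer, $t$ an integer, and $\Phi(x)=T_\ell^n(x)-t$. Let $p\neq\ell$ be an odd prime such that $t\equiv\varepsilon\pmod{p^2}$ for some $\varepsilon\in\{2,-2\}$, and write $$\Phi(x)\equiv (x-\varepsilon)\,\phi_1(x)^2\cdots\phi_r(x)^2\pmod p,$$ where $\phi_1,\dots,\phi_r\in\mathbb{Z}[x]$ are monic and their reductions modulo $p$ are irreducible. Let $V=\nu_p(t^2-4)$. Then for each $i$ there exists a monic polynomial $\hat\phi_i\in\mathbb{Z}[x]$ with $\hat\phi_i\equiv\phi_i\pmod p$ such that the principal $\hat\phi_i$-Newton polygon of $\Phi$ (with respect to $p$) consists of the single side with vertices $(0,V)$ and $(2,0)$; in particular $$\operatorname{ind}_{\hat\phi_i}(\Phi)=\left\lfloor\frac{V}{2}\right\rfloor\deg(\hat\phi_i).$$ Moreover, $\operatorname{ind}_{x-\varepsilon}(\Phi)=0$.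
   Context: $T_d(x)$ is the Chebyshev polynomial of the first kind of degree $d$ (the unique monic polynomial with $T_d(z+z^{ -1})=z^d+z^{ -d}$), and $T_\ell^n$ denotes the $n$-fold composition of $T_\ell$. For a monic $\phi\in\mathbb{Z}[x]$ irreducible modulo $p$, every $f\in\mathbb{Z}[x]$ has a unique $\phi$-adic development $f=\sum_{j\ge0}a_j(x)\phi(x)^j$ with $a_j\in\mathbb{Z}[x]$, $\deg a_j<\deg\phi$; put $u_j=\nu_p(a_j)$, the minimum of the $p$-adic valuations of the coefficients of $a_j$ ($\infty$ if $a_j=0$). The principal $\phi$-Newton polygon $N_\phi(f)$ is the union of the sides of negative slope of the lower convex hull of the points $(j,u_j)$ with $u_j<\infty$. The $\phi$-index $\operatorname{ind}_\phi(f)$ is $\deg\phi$ times the number of points with integer coordinates lying on or below $N_\phi(f)$, strictly above the horizontal axis and strictly to the right of the vertical axis. -}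

module Defs where

open import Data.Nat as ℕ using (ℕ; zero; suc; _∸_; _≤_)
open import Data.Integer as ℤ using (ℤ; +_; -_)
open import Data.Integer.Divisibility as ℤD using ()
open import Data.Rational as ℚ using (ℚ; 0ℚ; 1ℚ)
open import Data.Fin using (Fin; zero; suc)
open import Data.List using (List; []; _∷_; map; reverse; dropWhile; length; foldr)
open import Data.List.Relation.Unary.All using (All)
open import Data.List.Relation.Unary.Unique.Propositional using (Unique)
open import Data.List.Membership.Propositional using (_∈_)
open import Data.Product using (Σ; _×_; _,_; ∃)
open import Data.Sum using (_⊎_)
open import Relation.Nullary using (¬_)
open import Relation.Binary.PropositionalEquality using (_≡_)

-- Polynomials in ℤ[x] as coefficient lists, lowest degree first.
-- Trailing zeros are allowed; equality of polynomials is coefficientwise.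

Poly : Set
Poly = List ℤ

coeff : Poly → ℕ → ℤ
coeff []       _       = + 0
coeff (a ∷ f)  zero    = a
coeff (a ∷ f)  (suc k) = coeff f k

_≈ₚ_ : Poly → Poly → Set
f ≈ₚ g = ∀ k → coeff f k ≡ coeff g k

_≡ₚ_[mod_] : Poly → Poly → ℕ → Set
f ≡ₚ g [mod p ] = ∀ k → (+ p) ℤD.∣ (coeff f k ℤ.- coeff g k)

constP : ℤ → Poly
constP c = c ∷ []

X : Poly
X = + 0 ∷ + 1 ∷ []

infixl 6 _+ₚ_ _-ₚ_
infixl 7 _*ₚ_
infixr 8 _^ₚ_

_+ₚ_ : Poly → Poly → Poly
[]      +ₚ g       = g
(a ∷ f) +ₚ []      = a ∷ f
(a ∷ f) +ₚ (b ∷ g) = (a ℤ.+ b) ∷ (f +ₚ g)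

scaleₚ : ℤ → Poly → Poly
scaleₚ c f = map (c ℤ.*_) f

-ₚ_ : Poly → Poly
-ₚ f = map -_ f

_-ₚ_ : Poly → Poly → Poly
f -ₚ g = f +ₚ (-ₚ g)

_*ₚ_ : Poly → Poly → Poly
[]      *ₚ g = []
(a ∷ f) *ₚ g = scaleₚ a g +ₚ (+ 0 ∷ (f *ₚ g))

_^ₚ_ : Poly → ℕ → Poly
f ^ₚ zero  = constP (+ 1)
f ^ₚ suc k = f *ₚ (f ^ₚ k)

_∘ₚ_ : Poly → Poly → Poly
[]      ∘ₚ g = []
(a ∷ f) ∘ₚ g = constP a +ₚ (g *ₚ (f ∘ₚ g))

iterₚ : ℕ → Poly → Poly
iterₚ zero    T = X
iterₚ (suc n) T = T ∘ₚ iterₚ n T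

strip : Poly → Poly
strip f = reverse (dropWhile (λ a → a ℤ.≟ + 0) (reverse f))

lead : Poly → ℤ
lead f with dropWhile (λ a → a ℤ.≟ + 0) (reverse f)
... | []    = + 0
... | c ∷ _ = c

-- degree (the zero polynomial gets degree 0; never used on it)
deg : Poly → ℕ
deg f = length (strip f) ∸ 1

Monic : Poly → Set
Monic f = lead f ≡ + 1

prodFin : (r : ℕ) → (Fin r → Poly) → Poly
prodFin zero    φ = constP (+ 1)
prodFin (suc r) φ = φ zero *ₚ prodFin r (λ i → φ (suc i))

-- Irreducibility modulo p: the reduction of f in 𝔽_p[x] is a nonzero
-- non-unit all of whose factorizations have a unit factor.
-- (Units of 𝔽_p[x] are the nonzero constants; "constant mod p" below.)

ConstModP : ℕ → Poly → Set
ConstModP p g = ∀ k → (+ p) ℤD.∣ coeff g (suc k)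

IrredModP : ℕ → Poly → Set
IrredModP p f = (¬ ConstModP p f)
              × (∀ g h → f ≡ₚ (g *ₚ h) [mod p ] → ConstModP p g ⊎ ConstModP p h)

-- Chebyshev polynomials: T is the monic polynomial with
-- T(z + z⁻¹) = z^d + z^{-d}.  With m = length T (≥ deg T + 1) the identity
-- multiplied by z^(m+d) is the polynomial identity in z
--   z^d · Σ_k c_k (1+z²)^k z^(m-k) = z^(m+2d) + z^m .

chebHom : Poly → Poly
chebHom T = go T 0
  where
  m = length T
  go : Poly → ℕ → Poly
  go []       k = []
  go (c ∷ cs) k = scaleₚ c (((constP (+ 1) +ₚ (X *ₚ X)) ^ₚ k) *ₚ (X ^ₚ (m ∸ k)))
                  +ₚ go cs (suc k)

IsChebyshev : ℕ → Poly → Set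
IsChebyshev d T = Monic T
  × ((X ^ₚ d) *ₚ chebHom T) ≈ₚ ((X ^ₚ (length T ℕ.+ 2 ℕ.* d)) +ₚ (X ^ₚ length T))

-- ν_p(a) = v for an integer a (only for a ≠ 0; no v exists for a = 0)
IntVal : ℕ → ℤ → ℕ → Set
IntVal p a v = (+ (p ℕ.^ v)) ℤD.∣ a × ¬ ((+ (p ℕ.^ suc v)) ℤD.∣ a)

-- ν_p(a) = v for a polynomial: minimum of the valuations of its coefficients
-- (no v exists for the zero polynomial, i.e. ν_p(0) = ∞)
PolyVal : ℕ → Poly → ℕ → Set
PolyVal p a v = (∀ k → (+ (p ℕ.^ v)) ℤD.∣ coeff a k)
              × ¬ (∀ k → (+ (p ℕ.^ suc v)) ℤD.∣ coeff a k)

devSum : Poly → List Poly → Poly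
devSum φ as = foldr (λ a acc → a +ₚ (φ *ₚ acc)) [] as

IsDevelopment : Poly → Poly → List Poly → Set
IsDevelopment φ f as = All (λ a → length (strip a) ≤ deg φ) as × f ≈ₚ devSum φ as

nth : List Poly → ℕ → Poly
nth []       _       = []
nth (a ∷ as) zero    = a
nth (a ∷ as) (suc j) = nth as j

Pts : ℕ → List Poly → ℕ → ℕ → Set
Pts p as j u = PolyVal p (nth as j) u

ℕ→ℚ : ℕ → ℚ
ℕ→ℚ n = + n ℚ./ 1

sumℚ : List ℚ → ℚ
sumℚ = foldr ℚ._+_ 0ℚ

Cloud : Set₁
Cloud = ℕ → ℕ → Set

InHull : Cloud → ℚ → ℚ → Set
InHull P x y = Σ (List (ℕ × ℕ × ℚ)) λ L →
    All (λ { (j , u , w) → P j u × 0ℚ ℚ.≤ w }) L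
  × sumℚ (map (λ { (j , u , w) → w }) L) ≡ 1ℚ
  × sumℚ (map (λ { (j , u , w) → w ℚ.* ℕ→ℚ j }) L) ≡ x
  × sumℚ (map (λ { (j , u , w) → w ℚ.* ℕ→ℚ u }) L) ≡ y

OnLowerHull : Cloud → ℚ → ℚ → Set
OnLowerHull P x y = InHull P x y × (∀ y' → InHull P x y' → y ℚ.≤ y')

-- (x,y) lies on a side of negative slope of the lower convex hull:
-- the lower hull is affine of some slope s < 0 on an interval [x₁,x₂]
-- with x₁ < x₂ containing x.
OnPrincipal : Cloud → ℚ → ℚ → Set
OnPrincipal P x y = OnLowerHull P x y
  × Σ ℚ λ x₁ → Σ ℚ λ x₂ → Σ ℚ λ s →
      x₁ ℚ.< x₂ × x₁ ℚ.≤ x × x ℚ.≤ x₂ × s ℚ.< 0ℚ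
    × (∀ z → x₁ ℚ.≤ z → z ℚ.≤ x₂ → OnLowerHull P z (y ℚ.+ s ℚ.* (z ℚ.- x)))

HasCard : (ℕ × ℕ → Set) → ℕ → Set
HasCard Q c = Σ (List (ℕ × ℕ)) λ L →
  Unique L × length L ≡ c × (∀ q → q ∈ L → Q q) × (∀ q → Q q → q ∈ L)

BelowPrincipal : Cloud → ℕ × ℕ → Set
BelowPrincipal P (i , k) = 1 ≤ i × 1 ≤ k
  × Σ ℚ λ y → OnPrincipal P (ℕ→ℚ i) y × ℕ→ℚ k ℚ.≤ y

-- ind_φ(f) = m, where the cloud is that of the φ-adic development
IsIndex : Poly → Cloud → ℕ → Set
IsIndex φ P m = Σ ℕ λ c → HasCard (BelowPrincipal P) c × m ≡ deg φ ℕ.* c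

{-# OPTIONS --safe #-}
module Submission where

-- For N = ℓ^n the Chebyshev polynomial C_N = T_ℓ^n satisfies
-- C_N - ε = (x - ε) A², and A + 2 (x - ε) A' = N B where C_N + ε = (x + ε) B².  Hence
-- 2 ε N² = (x + ε)(A + 2 (x - ε) A')² - N² (x - ε) A² is a unit modulo p, so modulo p the
-- polynomial A is squarefree and prime to x - ε, and each φᵢ is a simple factor of A.
-- By Hensel's lemma A ≡ φ̂ g modulo p^(V+1) with φ̂ ≡ φᵢ modulo p, so that
-- Φ ≡ (x - ε) φ̂² g² + (ε - t) modulo p^(V+1): the φ̂-adic digits satisfy ν(a₀) = V,
-- ν(a₁) > V and ν(a₂) = 0.  At x - ε the digit a₁ is a unit, so there is no side
-- of negative slope past abscissa 1.

-- A given `φᵢ` need not serve as it stands. If A = φᵢ g + p h, then squaring leaves 2 p φᵢ g h and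
-- p² h², and the first two digits may drop below the side as soon as V > 2; hence the lift to
-- precision V + 1 before any digit is read. All identities hold in ℤ[x] and come from X = z + 1/z.
-- With w² = z, N = ℓ^n and ε = 2 η, the polynomial A is (w^N - η w^(-N)) / (w - η w^(-1)), B is the
-- same with -η, and the derivative of C_N is N A B. An explicit identity with constant 2 ε N² = ±4
-- N² replaces root counting in an extension of the field with p elements, and its prime divisors 2
-- and ℓ are the primes that p has to avoid. From φᵢ² ∣ (x - ε) A² it is not immediate that φᵢ
-- divides A, since x - ε might absorb a factor. The derivative A (A + 2 (x - ε) A') of (x - ε) A²
-- settles this.

open import Defs
open import Algebra.Bundles using (CommutativeRing)
open import Algebra.Structures using (IsCommutativeRing)
import Algebra.Solver.Ring as RingSolver
import Algebra.Solver.Ring.AlmostCommutativeRing as ACR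
open import Data.Empty using (⊥; ⊥-elim)
open import Data.Fin using (Fin; zero; suc)
open import Data.Integer as ℤ using (ℤ; +_; -_)
open import Data.Integer.Divisibility as ℤD using ()
import Data.Integer.Divisibility.Signed as ℤS
import Data.Integer.Properties as ℤP
open import Data.Integer.Solver renaming (module +-*-Solver to ℤ-Solver)
open import Data.List using (List; []; _∷_; map; _++_; _∷ʳ_; length; reverse; dropWhile; takeWhile; drop; upTo)
open import Data.List.Membership.Propositional using (_∈_)
import Data.List.Membership.Propositional.Properties as MemP
import Data.List.Properties as ListP
open import Data.List.Relation.Unary.All as All using (All; []; _∷_)
import Data.List.Relation.Unary.All.Properties as AllP
open import Data.List.Relation.Unary.AllPairs using ([])
import Data.List.Relation.Unary.Any.Properties as AnyP
import Data.List.Relation.Unary.Unique.Propositional.Properties as UniqueP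
open import Data.Maybe using (nothing; just)
open import Data.Nat as ℕ using (ℕ; zero; suc; pred; _∸_; _≤_; _<_; _/_; z≤n; s≤s)
open import Data.Nat.Coprimality as Coprimality using (Coprime; coprime-Bézout; 1-coprimeTo)
open import Data.Nat.Divisibility as ℕD using ()
import Data.Nat.DivMod as DivMod
open import Data.Nat.GCD using (module Bézout)
open import Data.Nat.Induction using (<-rec)
open import Data.Nat.Primality using (Prime; prime⇒irreducible; prime[2]; prime⇒nonTrivial; prime⇒nonZero; euclidsLemma)
import Data.Nat.Properties as ℕP
open import Data.Product using (Σ; _×_; _,_; proj₁; proj₂)
open import Data.Rational as ℚ using (ℚ; 0ℚ; 1ℚ; ½)
import Data.Rational.Properties as ℚP
open import Data.Rational.Solver renaming (module +-*-Solver to ℚ-Solver)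
open import Data.Sum using (_⊎_; inj₁; inj₂; [_,_]′)
open import Level using (0ℓ)
open import Relation.Binary.Definitions using (WeaklyDecidable)
open import Relation.Binary.PropositionalEquality using (_≡_; _≢_; refl; sym; trans; cong; cong₂; subst; subst₂; module ≡-Reasoning)
import Relation.Binary.Reasoning.Setoid as SetoidReasoning
open import Relation.Nullary using (¬_; yes; no)

-- Coefficients

coeff-+ : ∀ f g k → coeff (f +ₚ g) k ≡ coeff f k ℤ.+ coeff g k
coeff-+ []      g       k       = sym (ℤP.+-identityˡ _)
coeff-+ (a ∷ f) []      k       = sym (ℤP.+-identityʳ _)
coeff-+ (a ∷ f) (b ∷ g) zero    = refl
coeff-+ (a ∷ f) (b ∷ g) (suc k) = coeff-+ f g k

coeff-scale : ∀ c f k → coeff (scaleₚ c f) k ≡ c ℤ.* coeff f k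
coeff-scale c []      k       = sym (ℤP.*-zeroʳ c)
coeff-scale c (a ∷ f) zero    = refl
coeff-scale c (a ∷ f) (suc k) = coeff-scale c f k

coeff-neg : ∀ f k → coeff (-ₚ f) k ≡ - coeff f k
coeff-neg []      k       = refl
coeff-neg (a ∷ f) zero    = refl
coeff-neg (a ∷ f) (suc k) = coeff-neg f k

coeff-suc-* : ∀ a f g k → coeff ((a ∷ f) *ₚ g) k ≡ a ℤ.* coeff g k ℤ.+ coeff (+ 0 ∷ f *ₚ g) k
coeff-suc-* a f g k = trans (coeff-+ (scaleₚ a g) _ k) (cong (ℤ._+ _) (coeff-scale a g k))

shift-cong : ∀ {f g} → f ≈ₚ g → (+ 0 ∷ f) ≈ₚ (+ 0 ∷ g)
shift-cong e zero    = refl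
shift-cong e (suc k) = e k

shift-+ : ∀ f g k → coeff (+ 0 ∷ (f +ₚ g)) k ≡ coeff (+ 0 ∷ f) k ℤ.+ coeff (+ 0 ∷ g) k
shift-+ f g zero    = refl
shift-+ f g (suc k) = coeff-+ f g k

shift-scale : ∀ c f k → coeff (+ 0 ∷ scaleₚ c f) k ≡ c ℤ.* coeff (+ 0 ∷ f) k
shift-scale c f zero    = sym (ℤP.*-zeroʳ c)
shift-scale c f (suc k) = coeff-scale c f k

*ₚ-zeroʳ : ∀ f → (f *ₚ []) ≈ₚ []
*ₚ-zeroʳ []      k       = refl
*ₚ-zeroʳ (a ∷ f) zero    = refl
*ₚ-zeroʳ (a ∷ f) (suc k) = *ₚ-zeroʳ f k

*ₚ-consʳ : ∀ f b g → (f *ₚ (b ∷ g)) ≈ₚ (scaleₚ b f +ₚ (+ 0 ∷ f *ₚ g))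
*ₚ-consʳ []      b g zero    = refl
*ₚ-consʳ []      b g (suc k) = refl
*ₚ-consʳ (a ∷ f) b g zero    = cong (ℤ._+ + 0) (ℤP.*-comm a b)
*ₚ-consʳ (a ∷ f) b g (suc k) = begin
  coeff (scaleₚ a g +ₚ f *ₚ (b ∷ g)) k
    ≡⟨ coeff-+ (scaleₚ a g) _ k ⟩
  coeff (scaleₚ a g) k ℤ.+ coeff (f *ₚ (b ∷ g)) k
    ≡⟨ cong (λ z → coeff (scaleₚ a g) k ℤ.+ z) (trans (*ₚ-consʳ f b g k) (coeff-+ (scaleₚ b f) _ k)) ⟩
  coeff (scaleₚ a g) k ℤ.+ (coeff (scaleₚ b f) k ℤ.+ coeff (+ 0 ∷ f *ₚ g) k)
    ≡⟨ solve 3 (λ u v w → u :+ (v :+ w) := v :+ (u :+ w)) refl (coeff (scaleₚ a g) k) (coeff (scaleₚ b f) k) _ ⟩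
  coeff (scaleₚ b f) k ℤ.+ (coeff (scaleₚ a g) k ℤ.+ coeff (+ 0 ∷ f *ₚ g) k)
    ≡⟨ cong (λ z → coeff (scaleₚ b f) k ℤ.+ z) (coeff-+ (scaleₚ a g) _ k) ⟨
  coeff (scaleₚ b f) k ℤ.+ coeff ((a ∷ f) *ₚ g) k
    ≡⟨ coeff-+ (scaleₚ b f) _ k ⟨
  coeff (scaleₚ b f +ₚ (a ∷ f) *ₚ g) k ∎
  where open ≡-Reasoning
        open ℤ-Solver

*ₚ-comm : ∀ f g → (f *ₚ g) ≈ₚ (g *ₚ f)
*ₚ-comm []      g k = sym (*ₚ-zeroʳ g k)
*ₚ-comm (a ∷ f) g k = begin
  coeff (scaleₚ a g +ₚ (+ 0 ∷ f *ₚ g)) k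
    ≡⟨ coeff-+ (scaleₚ a g) _ k ⟩
  coeff (scaleₚ a g) k ℤ.+ coeff (+ 0 ∷ f *ₚ g) k
    ≡⟨ cong (λ z → coeff (scaleₚ a g) k ℤ.+ z) (shift-cong {f *ₚ g} {g *ₚ f} (*ₚ-comm f g) k) ⟩
  coeff (scaleₚ a g) k ℤ.+ coeff (+ 0 ∷ g *ₚ f) k
    ≡⟨ coeff-+ (scaleₚ a g) _ k ⟨
  coeff (scaleₚ a g +ₚ (+ 0 ∷ g *ₚ f)) k
    ≡⟨ *ₚ-consʳ g a f k ⟨
  coeff (g *ₚ (a ∷ f)) k ∎
  where open ≡-Reasoning

*ₚ-distribʳ : ∀ h f g → ((f +ₚ g) *ₚ h) ≈ₚ (f *ₚ h +ₚ g *ₚ h)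
*ₚ-distribʳ h []      g       k = refl
*ₚ-distribʳ h (a ∷ f) []      k = sym (trans (coeff-+ ((a ∷ f) *ₚ h) [] k) (ℤP.+-identityʳ _))
*ₚ-distribʳ h (a ∷ f) (b ∷ g) k = begin
  coeff ((a ℤ.+ b ∷ f +ₚ g) *ₚ h) k
    ≡⟨ coeff-suc-* (a ℤ.+ b) (f +ₚ g) h k ⟩
  (a ℤ.+ b) ℤ.* coeff h k ℤ.+ coeff (+ 0 ∷ (f +ₚ g) *ₚ h) k
    ≡⟨ cong (λ z → (a ℤ.+ b) ℤ.* coeff h k ℤ.+ z)
         (trans (shift-cong {(f +ₚ g) *ₚ h} {f *ₚ h +ₚ g *ₚ h} (*ₚ-distribʳ h f g) k) (shift-+ (f *ₚ h) (g *ₚ h) k)) ⟩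
  (a ℤ.+ b) ℤ.* coeff h k ℤ.+ (coeff (+ 0 ∷ f *ₚ h) k ℤ.+ coeff (+ 0 ∷ g *ₚ h) k)
    ≡⟨ solve 5 (λ a b c u v → (a :+ b) :* c :+ (u :+ v) := (a :* c :+ u) :+ (b :* c :+ v)) refl a b (coeff h k) _ _ ⟩
  (a ℤ.* coeff h k ℤ.+ coeff (+ 0 ∷ f *ₚ h) k) ℤ.+ (b ℤ.* coeff h k ℤ.+ coeff (+ 0 ∷ g *ₚ h) k)
    ≡⟨ cong₂ ℤ._+_ (coeff-suc-* a f h k) (coeff-suc-* b g h k) ⟨
  coeff ((a ∷ f) *ₚ h) k ℤ.+ coeff ((b ∷ g) *ₚ h) k
    ≡⟨ coeff-+ ((a ∷ f) *ₚ h) _ k ⟨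
  coeff ((a ∷ f) *ₚ h +ₚ (b ∷ g) *ₚ h) k ∎
  where open ≡-Reasoning
        open ℤ-Solver

scale-* : ∀ c f g → (scaleₚ c f *ₚ g) ≈ₚ scaleₚ c (f *ₚ g)
scale-* c []      g k = refl
scale-* c (a ∷ f) g k = begin
  coeff ((c ℤ.* a ∷ scaleₚ c f) *ₚ g) k
    ≡⟨ coeff-suc-* (c ℤ.* a) (scaleₚ c f) g k ⟩
  c ℤ.* a ℤ.* coeff g k ℤ.+ coeff (+ 0 ∷ scaleₚ c f *ₚ g) k
    ≡⟨ cong₂ ℤ._+_ (ℤP.*-assoc c a _) (trans (shift-cong {scaleₚ c f *ₚ g} {scaleₚ c (f *ₚ g)} (scale-* c f g) k) (shift-scale c (f *ₚ g) k)) ⟩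
  c ℤ.* (a ℤ.* coeff g k) ℤ.+ c ℤ.* coeff (+ 0 ∷ f *ₚ g) k
    ≡⟨ ℤP.*-distribˡ-+ c _ _ ⟨
  c ℤ.* (a ℤ.* coeff g k ℤ.+ coeff (+ 0 ∷ f *ₚ g) k)
    ≡⟨ cong (c ℤ.*_) (coeff-suc-* a f g k) ⟨
  c ℤ.* coeff ((a ∷ f) *ₚ g) k
    ≡⟨ coeff-scale c ((a ∷ f) *ₚ g) k ⟨
  coeff (scaleₚ c ((a ∷ f) *ₚ g)) k ∎
  where open ≡-Reasoning

shift-* : ∀ f g → ((+ 0 ∷ f) *ₚ g) ≈ₚ (+ 0 ∷ f *ₚ g)
shift-* f g k = trans (coeff-suc-* (+ 0) f g k) (ℤP.+-identityˡ _)

*ₚ-assoc : ∀ f g h → ((f *ₚ g) *ₚ h) ≈ₚ (f *ₚ (g *ₚ h))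
*ₚ-assoc []      g h k = refl
*ₚ-assoc (a ∷ f) g h k = begin
  coeff ((scaleₚ a g +ₚ (+ 0 ∷ f *ₚ g)) *ₚ h) k
    ≡⟨ *ₚ-distribʳ h (scaleₚ a g) (+ 0 ∷ f *ₚ g) k ⟩
  coeff (scaleₚ a g *ₚ h +ₚ (+ 0 ∷ f *ₚ g) *ₚ h) k
    ≡⟨ coeff-+ (scaleₚ a g *ₚ h) _ k ⟩
  coeff (scaleₚ a g *ₚ h) k ℤ.+ coeff ((+ 0 ∷ f *ₚ g) *ₚ h) k
    ≡⟨ cong₂ ℤ._+_ (scale-* a g h k) (trans (shift-* (f *ₚ g) h k) (shift-cong {(f *ₚ g) *ₚ h} {f *ₚ (g *ₚ h)} (*ₚ-assoc f g h) k)) ⟩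
  coeff (scaleₚ a (g *ₚ h)) k ℤ.+ coeff (+ 0 ∷ f *ₚ (g *ₚ h)) k
    ≡⟨ coeff-+ (scaleₚ a (g *ₚ h)) _ k ⟨
  coeff ((a ∷ f) *ₚ (g *ₚ h)) k ∎
  where open ≡-Reasoning

constP-* : ∀ c f → (constP c *ₚ f) ≈ₚ scaleₚ c f
constP-* c f k = trans (coeff-suc-* c [] f k) (trans (cong (λ z → c ℤ.* coeff f k ℤ.+ z) (zeros k)) (trans (ℤP.+-identityʳ _) (sym (coeff-scale c f k))))
  where
  zeros : ∀ k → coeff (+ 0 ∷ []) k ≡ + 0
  zeros zero    = refl
  zeros (suc k) = refl

X-* : ∀ f → (X *ₚ f) ≈ₚ (+ 0 ∷ f)
X-* f k = trans (shift-* (constP (+ 1)) f k) (shift-cong {constP (+ 1) *ₚ f} {f} (λ j → trans (constP-* (+ 1) f j) (trans (coeff-scale (+ 1) f j) (ℤP.*-identityˡ _))) k)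

-- ℤ[x]/(q) as a commutative ring; the case q = 0 is ℤ[x] itself.

infix 4 _≈[_]_

-- A record instead of the bare family of divisibilities: `f ≡ₚ g [mod q ]` unfolds to a function
-- type from which `f`, `q` and `g` cannot be recovered, whereas the reasoning below has to infer
-- them.
record _≈[_]_ (f : Poly) (q : ℕ) (g : Poly) : Set where
  constructor mod
  field coeffs : f ≡ₚ g [mod q ]

open _≈[_]_ public

∣-resp : ∀ {q a b} → a ≡ b → (+ q) ℤD.∣ a → (+ q) ℤD.∣ b
∣-resp refl d = d

∣-+ : ∀ {q a b} → (+ q) ℤD.∣ a → (+ q) ℤD.∣ b → (+ q) ℤD.∣ (a ℤ.+ b)
∣-+ {q} {a} {b} d e = ℤS.∣⇒∣ᵤ (ℤS.∣m∣n⇒∣m+n (ℤS.∣ᵤ⇒∣ {+ q} {a} d) (ℤS.∣ᵤ⇒∣ {+ q} {b} e))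

∣-neg : ∀ {q a} → (+ q) ℤD.∣ a → (+ q) ℤD.∣ (- a)
∣-neg {q} {a} d = subst (q ℕD.∣_) (sym (ℤP.∣-i∣≡∣i∣ a)) d

∣-*ˡ : ∀ {q a} c → (+ q) ℤD.∣ a → (+ q) ℤD.∣ (c ℤ.* a)
∣-*ˡ {q} {a} c d = subst (q ℕD.∣_) (sym (ℤP.abs-* c a)) (ℕD.∣n⇒∣m*n ℤ.∣ c ∣ d)

≈ₚ⇒≈ : ∀ {q f g} → f ≈ₚ g → f ≈[ q ] g
≈ₚ⇒≈ {q} {f} {g} e = mod λ k → ∣-resp (sym (trans (cong (ℤ._- coeff g k) (e k)) (ℤP.+-inverseʳ (coeff g k)))) (q ℕD.∣0)

≈⇒≈ₚ : ∀ {f g} → f ≈[ 0 ] g → f ≈ₚ g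
≈⇒≈ₚ {f} {g} (mod e) k = ℤP.i-j≡0⇒i≡j (coeff f k) (coeff g k) (ℤP.∣i∣≡0⇒i≡0 (ℕD.0∣⇒≡0 (e k)))

≈[]⇒∣ : ∀ {q f} → f ≈[ q ] [] → ∀ k → (+ q) ℤD.∣ coeff f k
≈[]⇒∣ {q} {f} (mod e) k = ∣-resp (ℤP.+-identityʳ (coeff f k)) (e k)

∣⇒≈[] : ∀ {q f} → (∀ k → (+ q) ℤD.∣ coeff f k) → f ≈[ q ] []
∣⇒≈[] {q} {f} d = mod λ k → ∣-resp (sym (ℤP.+-identityʳ (coeff f k))) (d k)

weaken : ∀ {q q' f g} → q' ℕD.∣ q → f ≈[ q ] g → f ≈[ q' ] g
weaken d (mod e) = mod λ k → ℕD.∣-trans d (e k)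

module ModRing (q : ℕ) where

  infix 4 _≈_
  _≈_ : Poly → Poly → Set
  f ≈ g = f ≈[ q ] g

  ≈-refl : ∀ {f} → f ≈ f
  ≈-refl = ≈ₚ⇒≈ λ k → refl

  ≈-sym : ∀ {f g} → f ≈ g → g ≈ f
  ≈-sym {f} {g} (mod e) = mod λ k →
    ∣-resp (solve 2 (λ a b → :- (a :- b) := b :- a) refl (coeff f k) (coeff g k))
           (∣-neg {q} {coeff f k ℤ.- coeff g k} (e k))
    where open ℤ-Solver

  ≈-trans : ∀ {f g h} → f ≈ g → g ≈ h → f ≈ h
  ≈-trans {f} {g} {h} (mod d) (mod e) = mod λ k →
    ∣-resp (solve 3 (λ a b c → (a :- b) :+ (b :- c) := a :- c) refl (coeff f k) (coeff g k) (coeff h k))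
           (∣-+ {q} {coeff f k ℤ.- coeff g k} {coeff g k ℤ.- coeff h k} (d k) (e k))
    where open ℤ-Solver

  +-cong : ∀ {f f' g g'} → f ≈ f' → g ≈ g' → f +ₚ g ≈ f' +ₚ g'
  +-cong {f} {f'} {g} {g'} (mod d) (mod e) = mod λ k →
    ∣-resp (trans (solve 4 (λ a b c d → (a :- b) :+ (c :- d) := (a :+ c) :- (b :+ d)) refl (coeff f k) (coeff f' k) (coeff g k) (coeff g' k))
                  (cong₂ ℤ._-_ (sym (coeff-+ f g k)) (sym (coeff-+ f' g' k))))
           (∣-+ {q} {coeff f k ℤ.- coeff f' k} {coeff g k ℤ.- coeff g' k} (d k) (e k))
    where open ℤ-Solver

  scale-cong : ∀ c {f g} → f ≈ g → scaleₚ c f ≈ scaleₚ c g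
  scale-cong c {f} {g} (mod d) = mod λ k →
    ∣-resp (trans (solve 3 (λ c a b → c :* (a :- b) := c :* a :- c :* b) refl c (coeff f k) (coeff g k))
                  (cong₂ ℤ._-_ (sym (coeff-scale c f k)) (sym (coeff-scale c g k))))
           (∣-*ˡ {q} {coeff f k ℤ.- coeff g k} c (d k))
    where open ℤ-Solver

  neg-cong : ∀ {f g} → f ≈ g → -ₚ f ≈ -ₚ g
  neg-cong {f} {g} (mod d) = mod λ k →
    ∣-resp (trans (solve 2 (λ a b → :- (a :- b) := (:- a) :- (:- b)) refl (coeff f k) (coeff g k))
                  (cong₂ ℤ._-_ (sym (coeff-neg f k)) (sym (coeff-neg g k))))
           (∣-neg {q} {coeff f k ℤ.- coeff g k} (d k))
    where open ℤ-Solver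

  ∷-cong : ∀ a {f g} → f ≈ g → (a ∷ f) ≈ (a ∷ g)
  ∷-cong a {f} {g} (mod d) = mod λ where
    zero    → ∣-resp (sym (ℤP.+-inverseʳ a)) (q ℕD.∣0)
    (suc k) → d k

  private
    *-congˡ : ∀ f {g g'} → g ≈ g' → f *ₚ g ≈ f *ₚ g'
    *-congˡ []      e = ≈-refl
    *-congˡ (a ∷ f) e = +-cong (scale-cong a e) (∷-cong (+ 0) (*-congˡ f e))

  *-comm : ∀ f g → f *ₚ g ≈ g *ₚ f
  *-comm f g = ≈ₚ⇒≈ (*ₚ-comm f g)

  *-cong : ∀ {f f' g g'} → f ≈ f' → g ≈ g' → f *ₚ g ≈ f' *ₚ g'
  *-cong {f} {f'} {g} {g'} d e =
    ≈-trans (*-congˡ f e) (≈-trans (*-comm f g') (≈-trans (*-congˡ g' d) (*-comm g' f')))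

  isCommutativeRing : IsCommutativeRing _≈_ _+ₚ_ _*ₚ_ -ₚ_ [] (constP (+ 1))
  isCommutativeRing = record
    { isRing = record
      { +-isAbelianGroup = record
        { isGroup = record
          { isMonoid = record
            { isSemigroup = record
              { isMagma = record
                { isEquivalence = record { refl = ≈-refl ; sym = ≈-sym ; trans = ≈-trans }
                ; ∙-cong = +-cong }
              ; assoc = λ f g h → ≈ₚ⇒≈ λ k → trans (coeff-+ (f +ₚ g) h k) (trans (cong (ℤ._+ coeff h k) (coeff-+ f g k)) (trans (ℤP.+-assoc (coeff f k) (coeff g k) (coeff h k)) (sym (trans (coeff-+ f (g +ₚ h) k) (cong (λ z → coeff f k ℤ.+ z) (coeff-+ g h k)))))) }
            ; identity = (λ f → ≈-refl)
                       , (λ f → ≈ₚ⇒≈ λ k → trans (coeff-+ f [] k) (ℤP.+-identityʳ _)) }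
          ; inverse = (λ f → ≈ₚ⇒≈ λ k → trans (coeff-+ (-ₚ f) f k) (trans (cong (ℤ._+ coeff f k) (coeff-neg f k)) (ℤP.+-inverseˡ (coeff f k))))
                    , (λ f → ≈ₚ⇒≈ λ k → trans (coeff-+ f (-ₚ f) k) (trans (cong (λ z → coeff f k ℤ.+ z) (coeff-neg f k)) (ℤP.+-inverseʳ (coeff f k))))
          ; ⁻¹-cong = neg-cong }
        ; comm = λ f g → ≈ₚ⇒≈ λ k → trans (coeff-+ f g k) (trans (ℤP.+-comm (coeff f k) (coeff g k)) (sym (coeff-+ g f k))) }
      ; *-cong = *-cong
      ; *-assoc = λ f g h → ≈ₚ⇒≈ (*ₚ-assoc f g h)
      ; *-identity = *-identityˡ
                   , (λ f → ≈-trans (*-comm f (constP (+ 1))) (*-identityˡ f))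
      ; distrib = (λ f g h → ≈-trans (*-comm f (g +ₚ h)) (≈-trans (≈ₚ⇒≈ (*ₚ-distribʳ f g h)) (+-cong (*-comm g f) (*-comm h f))))
                , (λ f g h → ≈ₚ⇒≈ (*ₚ-distribʳ f g h)) }
    ; *-comm = *-comm }
    where
    *-identityˡ : ∀ f → constP (+ 1) *ₚ f ≈ f
    *-identityˡ f = ≈ₚ⇒≈ λ k → trans (constP-* (+ 1) f k) (trans (coeff-scale (+ 1) f k) (ℤP.*-identityˡ _))

  commutativeRing : CommutativeRing 0ℓ 0ℓ
  commutativeRing = record { isCommutativeRing = isCommutativeRing }

  open CommutativeRing commutativeRing public using (setoid)

  X*≈∷ : ∀ f → X *ₚ f ≈ (+ 0 ∷ f)
  X*≈∷ f = ≈ₚ⇒≈ (X-* f)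

  *-zeroʳ : ∀ f → f *ₚ [] ≈ []
  *-zeroʳ f = ≈ₚ⇒≈ (*ₚ-zeroʳ f)

  private
    constants : ACR._-Raw-AlmostCommutative⟶_ (CommutativeRing.rawRing ℤP.+-*-commutativeRing) (ACR.fromCommutativeRing commutativeRing)
    constants = record
      { ⟦_⟧    = constP
      ; +-homo = λ a b → ≈-refl
      ; *-homo = λ a b → ≈ₚ⇒≈ λ where
          zero          → sym (ℤP.+-identityʳ (a ℤ.* b))
          (suc zero)    → refl
          (suc (suc k)) → refl
      ; -‿homo = λ a → ≈-refl
      ; 0-homo = ≈ₚ⇒≈ λ where
          zero    → refl
          (suc k) → refl
      ; 1-homo = ≈-refl
      }

    _≟ᶜ_ : WeaklyDecidable (λ a b → constP a ≈ constP b)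
    a ≟ᶜ b with a ℤ.≟ b
    ... | yes refl = just ≈-refl
    ... | no  _    = nothing

  module Solver = RingSolver (CommutativeRing.rawRing ℤP.+-*-commutativeRing) (ACR.fromCommutativeRing commutativeRing) constants _≟ᶜ_

-- Degrees

-- Monicity on coefficients, without `strip` or `lead`: it ignores trailing zeros and visibly
-- survives the addition of a polynomial of smaller degree, as happens in Hensel lifting.
record MonicDeg (d : ℕ) (f : Poly) : Set where
  constructor monicDeg
  field
    top   : coeff f d ≡ + 1
    above : ∀ k → d < k → coeff f k ≡ + 0

open MonicDeg public

DegLt : ℕ → Poly → Set
DegLt d f = ∀ k → d ≤ k → coeff f k ≡ + 0

coeff-++ˡ : ∀ f g k → k < length f → coeff (f ++ g) k ≡ coeff f k
coeff-++ˡ (a ∷ f) g zero    l       = refl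
coeff-++ˡ (a ∷ f) g (suc k) (s≤s l) = coeff-++ˡ f g k l

coeff-++-zeros : ∀ f {z} → All (_≡ + 0) z → ∀ k → length f ≤ k → coeff (f ++ z) k ≡ + 0
coeff-++-zeros []      []       k       l       = refl
coeff-++-zeros []      (e ∷ es) zero    l       = e
coeff-++-zeros []      (e ∷ es) (suc k) l       = coeff-++-zeros [] es k z≤n
coeff-++-zeros (a ∷ f) es       (suc k) (s≤s l) = coeff-++-zeros f es k l

coeff-∷ʳ : ∀ f c → coeff (f ∷ʳ c) (length f) ≡ c
coeff-∷ʳ []      c = refl
coeff-∷ʳ (a ∷ f) c = coeff-∷ʳ f c

private
  isZero? = λ a → a ℤ.≟ + 0

  strip-split : ∀ f → f ≡ strip f ++ reverse (takeWhile isZero? (reverse f))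
  strip-split f = begin
    f                                       ≡⟨ ListP.reverse-involutive f ⟨
    reverse (reverse f)                     ≡⟨ cong reverse (ListP.takeWhile++dropWhile isZero? (reverse f)) ⟨
    reverse (takeWhile isZero? (reverse f) ++ dropWhile isZero? (reverse f))
                                            ≡⟨ ListP.reverse-++ (takeWhile isZero? (reverse f)) _ ⟩
    strip f ++ reverse (takeWhile isZero? (reverse f)) ∎
    where open ≡-Reasoning

  stripped-zeros : ∀ f → All (_≡ + 0) (reverse (takeWhile isZero? (reverse f)))
  stripped-zeros f = All.tabulate λ ∈rev → All.lookup (AllP.all-takeWhile isZero? (reverse f)) (AnyP.reverse⁻ ∈rev)

strip-degLt : ∀ f d → length (strip f) ≤ d → DegLt d f
strip-degLt f d l k d≤k =
  trans (cong (λ g → coeff g k) (strip-split f))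
        (coeff-++-zeros (strip f) (stripped-zeros f) k (ℕP.≤-trans l d≤k))

strip-coeff : ∀ f k → k < length (strip f) → coeff f k ≡ coeff (strip f) k
strip-coeff f k l =
  trans (cong (λ g → coeff g k) (strip-split f)) (coeff-++ˡ (strip f) _ k l)

private
  dropWhile-head≢0 : ∀ f {c w} → dropWhile isZero? f ≡ c ∷ w → c ≢ + 0
  dropWhile-head≢0 (a ∷ f) eq with isZero? a
  ... | yes _ = dropWhile-head≢0 f eq
  dropWhile-head≢0 (a ∷ f) refl | no a≢0 = a≢0

  lead-deg : ∀ f → lead f ≢ + 0 → coeff f (deg f) ≡ lead f × length (strip f) ≡ suc (deg f)
  lead-deg f lead≢0 = lemma (dropWhile isZero? (reverse f)) refl
    where
    lead-∷ : ∀ {c w} → dropWhile isZero? (reverse f) ≡ c ∷ w → lead f ≡ c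
    lead-∷ eq with dropWhile isZero? (reverse f) | eq
    ... | _ | refl = refl
    lead-[] : dropWhile isZero? (reverse f) ≡ [] → lead f ≡ + 0
    lead-[] eq with dropWhile isZero? (reverse f) | eq
    ... | _ | refl = refl
    lemma : ∀ g → dropWhile isZero? (reverse f) ≡ g → coeff f (deg f) ≡ lead f × length (strip f) ≡ suc (deg f)
    lemma []      eq = ⊥-elim (lead≢0 (lead-[] eq))
    lemma (c ∷ w) eq = coeff-deg , trans len (cong suc (sym deg≡))
      where
      strip≡ : strip f ≡ reverse w ∷ʳ c
      strip≡ = trans (cong reverse eq) (ListP.unfold-reverse c w)
      len : length (strip f) ≡ suc (length (reverse w))
      len = trans (cong length strip≡) (trans (ListP.length-++ (reverse w)) (ℕP.+-comm _ 1))
      deg≡ : deg f ≡ length (reverse w)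
      deg≡ = cong (ℕ._∸ 1) len
      coeff-deg : coeff f (deg f) ≡ lead f
      coeff-deg = begin
        coeff f (deg f)                            ≡⟨ cong (coeff f) deg≡ ⟩
        coeff f (length (reverse w))               ≡⟨ strip-coeff f _ (ℕP.≤-reflexive (sym len)) ⟩
        coeff (strip f) (length (reverse w))       ≡⟨ cong (λ g → coeff g (length (reverse w))) strip≡ ⟩
        coeff (reverse w ∷ʳ c) (length (reverse w)) ≡⟨ coeff-∷ʳ (reverse w) c ⟩
        c                                          ≡⟨ lead-∷ eq ⟨
        lead f                                     ∎
        where open ≡-Reasoning

  lead≡0⇒≈[] : ∀ f → lead f ≡ + 0 → ∀ k → coeff f k ≡ + 0
  lead≡0⇒≈[] f lead≡0 k = strip-degLt f 0 (ℕP.≤-reflexive (lemma (dropWhile isZero? (reverse f)) refl)) k z≤n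
    where
    lemma : ∀ g → dropWhile isZero? (reverse f) ≡ g → length (strip f) ≡ 0
    lemma []      eq = cong (λ g → length (reverse g)) eq
    lemma (c ∷ w) eq with dropWhile isZero? (reverse f) in eq'
    lemma (c ∷ w) refl | _ = ⊥-elim (dropWhile-head≢0 (reverse f) eq' lead≡0)

monic⇒monicDeg : ∀ f → Monic f → MonicDeg (deg f) f
monic⇒monicDeg f m with lead-deg f (λ e → λ0≢1 (trans (sym e) m))
  where
  λ0≢1 : + 0 ≢ + 1
  λ0≢1 ()
... | c , l = monicDeg (trans c m) λ k d<k → strip-degLt f (suc (deg f)) (ℕP.≤-reflexive l) k d<k

monicDeg⇒monic : ∀ {d} f → MonicDeg d f → Monic f × deg f ≡ d
monicDeg⇒monic {d} f m = trans (sym c) (trans (cong (coeff f) deg≡d) (top m)) , deg≡d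
  where
  lead≢0 : lead f ≢ + 0
  lead≢0 e with trans (sym (top m)) (lead≡0⇒≈[] f e d)
  ... | ()
  c = proj₁ (lead-deg f lead≢0)
  l = proj₂ (lead-deg f lead≢0)
  d≤deg : d ≤ deg f
  d≤deg with d ℕ.≤? deg f
  ... | yes x = x
  ... | no  x with trans (sym (top m)) (strip-degLt f (suc (deg f)) (ℕP.≤-reflexive l) d (ℕP.≰⇒> x))
  ...   | ()
  deg≡d : deg f ≡ d
  deg≡d with deg f ℕ.≤? d
  ... | yes x = ℕP.≤-antisym x d≤deg
  ... | no  x = ⊥-elim (lead≢0 (trans (sym c) (above m (deg f) (ℕP.≰⇒> x))))

-- Division by monic polynomials

cons≈ : ∀ {q} a f → (a ∷ f) ≈[ q ] constP a +ₚ X *ₚ f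
cons≈ {q} a f = ≈ₚ⇒≈ λ k → sym (trans (coeff-+ (constP a) (X *ₚ f) k) (trans (cong (λ z → coeff (constP a) k ℤ.+ z) (X-* f k)) (lemma k)))
  where
  lemma : ∀ k → coeff (constP a) k ℤ.+ coeff (+ 0 ∷ f) k ≡ coeff (a ∷ f) k
  lemma zero    = ℤP.+-identityʳ a
  lemma (suc k) = ℤP.+-identityˡ _

-- Horner scheme: if f = φ g + r, then a + X f = φ X g + s with s = a + X r of degree at most d, and
-- subtracting c φ, with c the coefficient of s at d, brings the degree below d. As φ is monic,
-- everything stays in ℤ[x].
divMod : ∀ {d φ} → MonicDeg d φ → ∀ f → Σ Poly λ g → Σ Poly λ r → f ≈[ 0 ] φ *ₚ g +ₚ r × DegLt d r
divMod {φ = φ} m [] = [] , [] , ≈ₚ⇒≈ (λ k → sym (trans (coeff-+ (φ *ₚ []) [] k) (trans (ℤP.+-identityʳ _) (*ₚ-zeroʳ φ k)))) , λ k _ → refl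
divMod {d} {φ} m (a ∷ f) with divMod m f
... | g , r , e , r<d = X *ₚ g +ₚ constP c , s -ₚ constP c *ₚ φ , eq , s<d
  where
  open ModRing 0
  s = a ∷ r
  c = coeff s d
  eq : (a ∷ f) ≈ φ *ₚ (X *ₚ g +ₚ constP c) +ₚ (s -ₚ constP c *ₚ φ)
  eq = begin
    a ∷ f                                ≈⟨ cons≈ a f ⟩
    constP a +ₚ X *ₚ f                   ≈⟨ +-cong (≈-refl {constP a}) (*-cong (≈-refl {X}) e) ⟩
    constP a +ₚ X *ₚ (φ *ₚ g +ₚ r)       ≈⟨ solve 6 (λ A x φ g r c → A :+ x :* (φ :* g :+ r) := φ :* (x :* g :+ c) :+ ((A :+ x :* r) :- c :* φ)) ≈-refl (constP a) X φ g r (constP c) ⟩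
    φ *ₚ (X *ₚ g +ₚ constP c) +ₚ ((constP a +ₚ X *ₚ r) -ₚ constP c *ₚ φ)
                                         ≈⟨ +-cong (≈-refl {φ *ₚ (X *ₚ g +ₚ constP c)}) (+-cong (≈-sym (cons≈ a r)) (≈-refl { -ₚ (constP c *ₚ φ)})) ⟩
    φ *ₚ (X *ₚ g +ₚ constP c) +ₚ (s -ₚ constP c *ₚ φ) ∎
    where open SetoidReasoning setoid
          open Solver
  coeffs-s : ∀ k → coeff (s -ₚ constP c *ₚ φ) k ≡ coeff s k ℤ.- c ℤ.* coeff φ k
  coeffs-s k = trans (coeff-+ s (-ₚ (constP c *ₚ φ)) k) (cong (λ z → coeff s k ℤ.+ z) (trans (coeff-neg (constP c *ₚ φ) k) (cong -_ (trans (constP-* c φ k) (coeff-scale c φ k)))))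
  s<d : DegLt d (s -ₚ constP c *ₚ φ)
  s<d k d≤k with ℕP.m≤n⇒m<n∨m≡n d≤k
  ... | inj₂ refl = trans (coeffs-s d) (trans (cong (λ z → c ℤ.- c ℤ.* z) (top m)) (trans (cong (λ z → c ℤ.- z) (ℤP.*-identityʳ c)) (ℤP.+-inverseʳ c)))
  s<d (suc k) _ | inj₁ (s≤s d≤k) = trans (coeffs-s (suc k)) (trans (cong₂ (λ y z → y ℤ.- c ℤ.* z) (r<d k d≤k) (above m (suc k) (s≤s d≤k))) (cong (λ z → + 0 ℤ.- z) (ℤP.*-zeroʳ c)))

-- The solver's zero is the list `+ 0 ∷ []`, while the zero of the ring is the empty list; this
-- passes between the two.
constP-0 : ∀ {q} → constP (+ 0) ≈[ q ] []
constP-0 = ≈ₚ⇒≈ λ where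
  zero    → refl
  (suc k) → refl

module _ {q d : ℕ} {φ : Poly} (m : MonicDeg d φ) where
  open ModRing q

  -- A monic factor passes on the top coefficient, so zero divisors modulo q do not interfere. Above
  -- degree d the product of `b` and φ does not contribute, so the recursion kills `h` first; the
  -- coefficient at d is then `b` itself.
  high-zero⇒zero : ∀ h → (∀ k → d ≤ k → (+ q) ℤD.∣ coeff (φ *ₚ h) k) → h ≈ []
  high-zero⇒zero []      z = ≈-refl
  high-zero⇒zero (b ∷ h) z = ∣⇒≈[] λ where
      zero    → ∣-resp b≡ (∣-+ {q} {coeff (φ *ₚ (b ∷ h)) d} { - coeff (+ 0 ∷ φ *ₚ h) d}  (z d ℕP.≤-refl) (∣-neg {q} {coeff (+ 0 ∷ φ *ₚ h) d} (low d)))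
      (suc k) → ≈[]⇒∣ h≈0 k
    where
    step : ∀ k → coeff (φ *ₚ (b ∷ h)) k ≡ b ℤ.* coeff φ k ℤ.+ coeff (+ 0 ∷ φ *ₚ h) k
    step k = trans (*ₚ-consʳ φ b h k) (trans (coeff-+ (scaleₚ b φ) (+ 0 ∷ φ *ₚ h) k) (cong (ℤ._+ coeff (+ 0 ∷ φ *ₚ h) k) (coeff-scale b φ k)))
    h≈0 : h ≈ []
    h≈0 = high-zero⇒zero h λ k d≤k → ∣-resp (trans (step (suc k)) (trans (cong (λ y → b ℤ.* y ℤ.+ coeff (φ *ₚ h) k) (above m (suc k) (s≤s d≤k))) (trans (cong (ℤ._+ coeff (φ *ₚ h) k) (ℤP.*-zeroʳ b)) (ℤP.+-identityˡ (coeff (φ *ₚ h) k))))) (z (suc k) (ℕP.m≤n⇒m≤1+n d≤k))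
    φh≈0 : φ *ₚ h ≈ []
    φh≈0 = ≈-trans (*-cong (≈-refl {φ}) h≈0) (*-zeroʳ φ)
    low : ∀ k → (+ q) ℤD.∣ coeff (+ 0 ∷ φ *ₚ h) k
    low zero    = q ℕD.∣0
    low (suc k) = ≈[]⇒∣ φh≈0 k
    b≡ : coeff (φ *ₚ (b ∷ h)) d ℤ.+ (- coeff (+ 0 ∷ φ *ₚ h) d) ≡ b
    b≡ = trans (cong (ℤ._+ (- coeff (+ 0 ∷ φ *ₚ h) d)) (trans (step d) (cong (λ y → b ℤ.* y ℤ.+ coeff (+ 0 ∷ φ *ₚ h) d) (top m)))) (solve 2 (λ b u → (b :* con (+ 1) :+ u) :+ (:- u) := b) refl b (coeff (+ 0 ∷ φ *ₚ h) d))
      where open ℤ-Solver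

  -- Holds for every modulus, prime or not; this is what lets the digits of a development be read
  -- off modulo p^(V+1).
  remainder-unique : ∀ {c} h → DegLt d c → c +ₚ φ *ₚ h ≈ [] → c ≈ [] × h ≈ []
  remainder-unique {c} h c<d e = c≈0 , h≈0
    where
    h≈0 : h ≈ []
    h≈0 = high-zero⇒zero h λ k d≤k → ∣-resp (trans (coeff-+ c (φ *ₚ h) k) (trans (cong (ℤ._+ coeff (φ *ₚ h) k) (c<d k d≤k)) (ℤP.+-identityˡ (coeff (φ *ₚ h) k)))) (≈[]⇒∣ e k)
    c≈0 : c ≈ []
    c≈0 = begin
      c               ≈⟨ solve 2 (λ c φ → c := c :+ φ :* con (+ 0)) ≈-refl c φ ⟩
      c +ₚ φ *ₚ constP (+ 0)   ≈⟨ +-cong (≈-refl {c}) (*-cong (≈-refl {φ}) (≈-trans constP-0 (≈-sym h≈0))) ⟩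
      c +ₚ φ *ₚ h     ≈⟨ e ⟩
      []              ∎
      where open SetoidReasoning setoid
            open Solver

-- Divisibility modulo q

infix 4 _∣[_]_

record _∣[_]_ (φ : Poly) (q : ℕ) (f : Poly) : Set where
  constructor divides
  field
    cofactor : Poly
    equation : f ≈[ q ] φ *ₚ cofactor

-- As φ has positive degree, a constant is its own remainder modulo φ.
nonconstant∤unit : ∀ {q d φ c} → MonicDeg (suc d) φ → φ ∣[ q ] constP c → (+ q) ℤD.∣ c
nonconstant∤unit {q} {d} {φ} {c} m (divides h e) = ≈[]⇒∣ c≈0 0
  where
  open ModRing q
  e' : constP c +ₚ φ *ₚ (-ₚ h) ≈ []
  e' = begin
    constP c +ₚ φ *ₚ (-ₚ h)  ≈⟨ +-cong e (≈-refl {φ *ₚ (-ₚ h)}) ⟩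
    φ *ₚ h +ₚ φ *ₚ (-ₚ h)    ≈⟨ solve 2 (λ φ h → φ :* h :+ φ :* (:- h) := con (+ 0)) ≈-refl φ h ⟩
    constP (+ 0)             ≈⟨ constP-0 ⟩
    []                       ∎
    where open SetoidReasoning setoid
          open Solver
  c≈0 : constP c ≈ []
  c≈0 = proj₁ (remainder-unique m (-ₚ h) (λ { (suc k) _ → refl }) e')

≈₀⇒≈ : ∀ {q f g} → f ≈[ 0 ] g → f ≈[ q ] g
≈₀⇒≈ {q} = weaken (q ℕD.∣0)

quotient : ∀ {q} f → (∀ k → (+ q) ℤD.∣ coeff f k) → Σ Poly λ h → f ≈ₚ scaleₚ (+ q) h
quotient []      d = [] , λ k → refl
quotient {q} (a ∷ f) d with ℤS.∣ᵤ⇒∣ {+ q} {a} (d 0) | quotient f (λ k → d (suc k))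
... | ℤS.divides b e | h , es = b ∷ h , λ where
  zero    → trans e (ℤP.*-comm b (+ q))
  (suc k) → es k

constP-≈0 : ∀ {q} a → (+ q) ℤD.∣ a → constP a ≈[ q ] []
constP-≈0 {q} a d = ∣⇒≈[] λ where
  zero    → d
  (suc k) → q ℕD.∣0

constP-*-≈0 : ∀ {q} a b → (+ q) ℤD.∣ (a ℤ.* b) → constP a *ₚ constP b ≈[ q ] constP (+ 0)
constP-*-≈0 {q} a b d = ModRing.≈-trans q (∣⇒≈[] λ where
  zero          → ∣-resp (sym (ℤP.+-identityʳ (a ℤ.* b))) d
  (suc zero)    → q ℕD.∣0
  (suc (suc k)) → q ℕD.∣0) (ModRing.≈-sym q constP-0)

-- Turns the error of a congruence into an explicit polynomial, which the Hensel step then corrects.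
≈⇒+q* : ∀ {q f g} → f ≈[ q ] g → Σ Poly λ h → f ≈[ 0 ] g +ₚ constP (+ q) *ₚ h
≈⇒+q* {q} {f} {g} (mod d) with quotient (f -ₚ g) (λ k → ∣-resp (sym (trans (coeff-+ f (-ₚ g) k) (cong (λ z → coeff f k ℤ.+ z) (coeff-neg g k)))) (d k))
... | h , e = h , (begin
  f                          ≈⟨ solve 2 (λ f g → f := g :+ (f :- g)) ≈-refl f g ⟩
  g +ₚ (f -ₚ g)              ≈⟨ +-cong (≈-refl {g}) (≈ₚ⇒≈ (λ k → trans (e k) (sym (constP-* (+ q) h k)))) ⟩
  g +ₚ constP (+ q) *ₚ h     ∎)
  where
  open ModRing 0
  open SetoidReasoning setoid
  open Solver

-- Derivatives

deriv : Poly → Poly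
deriv []      = []
deriv (a ∷ f) = f +ₚ (+ 0 ∷ deriv f)

coeff-deriv : ∀ f k → coeff (deriv f) k ≡ + suc k ℤ.* coeff f (suc k)
coeff-deriv []      k       = sym (ℤP.*-zeroʳ (+ suc k))
coeff-deriv (a ∷ f) zero    = trans (coeff-+ f _ 0) (solve 1 (λ a → a :+ con (+ 0) := con (+ 1) :* a) refl (coeff f 0))
  where open ℤ-Solver
coeff-deriv (a ∷ f) (suc k) = begin
  coeff (f +ₚ (+ 0 ∷ deriv f)) (suc k)              ≡⟨ coeff-+ f _ (suc k) ⟩
  coeff f (suc k) ℤ.+ coeff (deriv f) k             ≡⟨ cong (λ z → coeff f (suc k) ℤ.+ z) (coeff-deriv f k) ⟩
  coeff f (suc k) ℤ.+ + suc k ℤ.* coeff f (suc k)   ≡⟨ solve 2 (λ k a → a :+ k :* a := (con (+ 1) :+ k) :* a) refl (+ suc k) (coeff f (suc k)) ⟩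
  + suc (suc k) ℤ.* coeff f (suc k)                 ∎
  where open ≡-Reasoning
        open ℤ-Solver

deriv-cong : ∀ {q f g} → f ≈[ q ] g → deriv f ≈[ q ] deriv g
deriv-cong {q} {f} {g} (mod d) = mod λ k →
  ∣-resp (trans (solve 3 (λ c a b → c :* (a :- b) := c :* a :- c :* b) refl (+ suc k) (coeff f (suc k)) (coeff g (suc k)))
                (cong₂ ℤ._-_ (sym (coeff-deriv f k)) (sym (coeff-deriv g k))))
         (∣-*ˡ {q} {coeff f (suc k) ℤ.- coeff g (suc k)} (+ suc k) (d (suc k)))
  where open ℤ-Solver

deriv-+ : ∀ {q} f g → deriv (f +ₚ g) ≈[ q ] deriv f +ₚ deriv g
deriv-+ f g = ≈ₚ⇒≈ λ k → begin
  coeff (deriv (f +ₚ g)) k                          ≡⟨ coeff-deriv (f +ₚ g) k ⟩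
  + suc k ℤ.* coeff (f +ₚ g) (suc k)                ≡⟨ cong (+ suc k ℤ.*_) (coeff-+ f g (suc k)) ⟩
  + suc k ℤ.* (coeff f (suc k) ℤ.+ coeff g (suc k)) ≡⟨ ℤP.*-distribˡ-+ (+ suc k) (coeff f (suc k)) _ ⟩
  + suc k ℤ.* coeff f (suc k) ℤ.+ + suc k ℤ.* coeff g (suc k)
                                                    ≡⟨ cong₂ ℤ._+_ (coeff-deriv f k) (coeff-deriv g k) ⟨
  coeff (deriv f) k ℤ.+ coeff (deriv g) k           ≡⟨ coeff-+ (deriv f) (deriv g) k ⟨
  coeff (deriv f +ₚ deriv g) k                      ∎
  where open ≡-Reasoning

deriv-neg : ∀ {q} f → deriv (-ₚ f) ≈[ q ] -ₚ deriv f
deriv-neg f = ≈ₚ⇒≈ λ k → begin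
  coeff (deriv (-ₚ f)) k                ≡⟨ coeff-deriv (-ₚ f) k ⟩
  + suc k ℤ.* coeff (-ₚ f) (suc k)      ≡⟨ cong (+ suc k ℤ.*_) (coeff-neg f (suc k)) ⟩
  + suc k ℤ.* (- coeff f (suc k))       ≡⟨ ℤP.neg-distribʳ-* (+ suc k) (coeff f (suc k)) ⟨
  - (+ suc k ℤ.* coeff f (suc k))       ≡⟨ cong -_ (coeff-deriv f k) ⟨
  - coeff (deriv f) k                   ≡⟨ coeff-neg (deriv f) k ⟨
  coeff (-ₚ deriv f) k                  ∎
  where open ≡-Reasoning

deriv-scale : ∀ {q} c f → deriv (scaleₚ c f) ≈[ q ] constP c *ₚ deriv f
deriv-scale c f = ≈ₚ⇒≈ λ k → begin
  coeff (deriv (scaleₚ c f)) k               ≡⟨ coeff-deriv (scaleₚ c f) k ⟩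
  + suc k ℤ.* coeff (scaleₚ c f) (suc k)     ≡⟨ cong (+ suc k ℤ.*_) (coeff-scale c f (suc k)) ⟩
  + suc k ℤ.* (c ℤ.* coeff f (suc k))        ≡⟨ solve 3 (λ n c a → n :* (c :* a) := c :* (n :* a)) refl (+ suc k) c (coeff f (suc k)) ⟩
  c ℤ.* (+ suc k ℤ.* coeff f (suc k))        ≡⟨ cong (c ℤ.*_) (coeff-deriv f k) ⟨
  c ℤ.* coeff (deriv f) k                    ≡⟨ coeff-scale c (deriv f) k ⟨
  coeff (scaleₚ c (deriv f)) k               ≡⟨ constP-* c (deriv f) k ⟨
  coeff (constP c *ₚ deriv f) k              ∎
  where open ≡-Reasoning
        open ℤ-Solver

deriv-* : ∀ {q} f g → deriv (f *ₚ g) ≈[ q ] deriv f *ₚ g +ₚ f *ₚ deriv g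
deriv-* {q} []      g = ModRing.≈-refl q
deriv-* {q} (a ∷ f) g = begin
  deriv (scaleₚ a g +ₚ (+ 0 ∷ f *ₚ g))
    ≈⟨ deriv-+ (scaleₚ a g) (+ 0 ∷ f *ₚ g) ⟩
  deriv (scaleₚ a g) +ₚ (f *ₚ g +ₚ (+ 0 ∷ deriv (f *ₚ g)))
    ≈⟨ +-cong (deriv-scale a g) (+-cong (≈-refl {f *ₚ g}) (≈-sym (X*≈∷ (deriv (f *ₚ g))))) ⟩
  constP a *ₚ deriv g +ₚ (f *ₚ g +ₚ X *ₚ deriv (f *ₚ g))
    ≈⟨ +-cong (≈-refl {constP a *ₚ deriv g}) (+-cong (≈-refl {f *ₚ g}) (*-cong (≈-refl {X}) (deriv-* f g))) ⟩
  constP a *ₚ deriv g +ₚ (f *ₚ g +ₚ X *ₚ (deriv f *ₚ g +ₚ f *ₚ deriv g))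
    ≈⟨ solve 6 (λ a x f g f' g' → a :* g' :+ (f :* g :+ x :* (f' :* g :+ f :* g')) := (f :+ x :* f') :* g :+ (a :+ x :* f) :* g')
         ≈-refl (constP a) X f g (deriv f) (deriv g) ⟩
  (f +ₚ X *ₚ deriv f) *ₚ g +ₚ (constP a +ₚ X *ₚ f) *ₚ deriv g
    ≈⟨ +-cong (*-cong (+-cong (≈-refl {f}) (X*≈∷ (deriv f))) (≈-refl {g})) (*-cong (≈-sym (cons≈ a f)) (≈-refl {deriv g})) ⟩
  deriv (a ∷ f) *ₚ g +ₚ (a ∷ f) *ₚ deriv g ∎
  where
  open ModRing q
  open SetoidReasoning setoid
  open Solver

-- Polynomials over the field with p elements

mono : ℕ → Poly
mono zero    = constP (+ 1)
mono (suc n) = + 0 ∷ mono n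

mono-monicDeg : ∀ n → MonicDeg n (mono n)
mono-monicDeg zero    = monicDeg refl λ { (suc k) _ → refl }
mono-monicDeg (suc n) = monicDeg (top (mono-monicDeg n)) λ { (suc k) (s≤s l) → above (mono-monicDeg n) k l }

prime∤1 : ∀ {p} → Prime p → ¬ (p ℕD.∣ 1)
prime∤1 pp d with ℕD.∣1⇒≡1 d | prime⇒nonTrivial pp
... | refl | ()

-- Bézout's identity lives in ℕ, so an inverse is found for `∣ c ∣` first and then given the sign of
-- `c`.
inverseModP : ∀ {p} → Prime p → ∀ c → ¬ ((+ p) ℤD.∣ c) → Σ ℤ λ e → (+ p) ℤD.∣ (e ℤ.* c ℤ.- + 1)
inverseModP {p} pp c p∤c with inv | ℤP.+∣i∣≡i⊎+∣i∣≡-i c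
  where
  coprime : Coprime p ℤ.∣ c ∣
  coprime (d∣p , d∣c) with prime⇒irreducible pp d∣p
  ... | inj₁ d≡1  = d≡1
  ... | inj₂ refl = ⊥-elim (p∤c d∣c)
  inv : Σ ℤ λ e → (+ p) ℤS.∣ (e ℤ.* + ℤ.∣ c ∣ ℤ.- + 1)
  inv with coprime-Bézout coprime
  ... | Bézout.+- x y eq = - (+ y) , ℤS.divides (- (+ x)) (trans
          (solve 2 (λ y c → (:- y) :* c :- con (+ 1) := :- (con (+ 1) :+ y :* c)) refl (+ y) (+ ℤ.∣ c ∣))
          (trans (cong -_ (trans (cong (λ z → + 1 ℤ.+ z) (sym (ℤP.pos-* y ℤ.∣ c ∣))) (trans (cong +_ eq) (ℤP.pos-* x p))))
                 (ℤP.neg-distribˡ-* (+ x) (+ p))))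
    where open ℤ-Solver
  ... | Bézout.-+ x y eq = + y , ℤS.divides (+ x) (trans
          (cong (ℤ._- + 1) (trans (sym (ℤP.pos-* y ℤ.∣ c ∣)) (trans (cong +_ (sym eq)) (cong (λ z → + 1 ℤ.+ z) (ℤP.pos-* x p)))))
          (solve 1 (λ z → (con (+ 1) :+ z) :- con (+ 1) := z) refl (+ x ℤ.* + p)))
    where open ℤ-Solver
... | e , d | inj₁ eq = e , ∣-resp (cong (λ z → e ℤ.* z ℤ.- + 1) eq) (ℤS.∣⇒∣ᵤ d)
... | e , d | inj₂ eq = - e , ∣-resp (trans (cong (λ z → e ℤ.* z ℤ.- + 1) eq) (cong (ℤ._- + 1) (solve 2 (λ e c → e :* (:- c) := (:- e) :* c) refl e c))) (ℤS.∣⇒∣ᵤ d)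
  where open ℤ-Solver

coeff-axpy : ∀ f c g k → coeff (f +ₚ constP c *ₚ g) k ≡ coeff f k ℤ.+ c ℤ.* coeff g k
coeff-axpy f c g k = trans (coeff-+ f (constP c *ₚ g) k) (cong (λ z → coeff f k ℤ.+ z) (trans (constP-* c g k) (coeff-scale c g k)))

-- The corrections solve φ v + g u ≡ h modulo P, so that the terms linear in Q add up to Q h. The
-- obvious solution v = h α, u = h β could spoil the degree of the monic factor; dividing h β by φ
-- keeps only the remainder u there and moves the quotient s into v = h α + g s. It is applied with
-- Q = p^(M+1) and P = p modulo p^(M+2), where Q P and Q Q vanish.
hensel-step : ∀ q' φ g Q P u h α β s w A → let open ModRing q' in
  h *ₚ β ≈ φ *ₚ s +ₚ u → α *ₚ φ +ₚ β *ₚ g ≈ constP (+ 1) +ₚ P *ₚ w → A ≈ φ *ₚ g +ₚ Q *ₚ h →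
  Q *ₚ P ≈ constP (+ 0) → Q *ₚ Q ≈ constP (+ 0) →
  A ≈ (φ +ₚ Q *ₚ u) *ₚ (g +ₚ Q *ₚ (h *ₚ α +ₚ g *ₚ s))
hensel-step q' φ g Q P u h α β s w A eqU eqB eqA QP QQ = ≈-sym (begin
  (φ +ₚ Q *ₚ u) *ₚ (g +ₚ Q *ₚ v)
    ≈⟨ solve 5 (λ φ g Q u v → (φ :+ Q :* u) :* (g :+ Q :* v) := φ :* g :+ Q :* (φ :* v :+ g :* u) :+ Q :* Q :* (u :* v)) ≈-refl φ g Q u v ⟩
  φ *ₚ g +ₚ Q *ₚ (φ *ₚ v +ₚ g *ₚ u) +ₚ Q *ₚ Q *ₚ (u *ₚ v)
    ≈⟨ +-cong (+-cong (≈-refl {φ *ₚ g}) (*-cong (≈-refl {Q}) inner)) (*-cong QQ (≈-refl {u *ₚ v})) ⟩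
  φ *ₚ g +ₚ Q *ₚ (h *ₚ (constP (+ 1) +ₚ P *ₚ w)) +ₚ constP (+ 0) *ₚ (u *ₚ v)
    ≈⟨ solve 6 (λ A Q h P w z → A :+ Q :* (h :* (con (+ 1) :+ P :* w)) :+ con (+ 0) :* z := A :+ Q :* h :+ Q :* P :* (h :* w)) ≈-refl (φ *ₚ g) Q h P w (u *ₚ v) ⟩
  φ *ₚ g +ₚ Q *ₚ h +ₚ Q *ₚ P *ₚ (h *ₚ w)
    ≈⟨ +-cong (≈-sym eqA) (*-cong QP (≈-refl {h *ₚ w})) ⟩
  A +ₚ constP (+ 0) *ₚ (h *ₚ w)
    ≈⟨ solve 2 (λ A z → A :+ con (+ 0) :* z := A) ≈-refl A (h *ₚ w) ⟩
  A ∎)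
  where
  open ModRing q'
  open SetoidReasoning setoid
  open Solver
  v = h *ₚ α +ₚ g *ₚ s
  inner : φ *ₚ v +ₚ g *ₚ u ≈ h *ₚ (constP (+ 1) +ₚ P *ₚ w)
  inner = begin
    φ *ₚ (h *ₚ α +ₚ g *ₚ s) +ₚ g *ₚ u
      ≈⟨ solve 6 (λ φ h α g s u → φ :* (h :* α :+ g :* s) :+ g :* u := φ :* (h :* α) :+ g :* (φ :* s :+ u)) ≈-refl φ h α g s u ⟩
    φ *ₚ (h *ₚ α) +ₚ g *ₚ (φ *ₚ s +ₚ u)
      ≈⟨ +-cong (≈-refl {φ *ₚ (h *ₚ α)}) (*-cong (≈-refl {g}) (≈-sym eqU)) ⟩
    φ *ₚ (h *ₚ α) +ₚ g *ₚ (h *ₚ β)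
      ≈⟨ solve 5 (λ φ h α g β → φ :* (h :* α) :+ g :* (h :* β) := h :* (α :* φ :+ β :* g)) ≈-refl φ h α g β ⟩
    h *ₚ (α *ₚ φ +ₚ β *ₚ g)
      ≈⟨ *-cong (≈-refl {h}) eqB ⟩
    h *ₚ (constP (+ 1) +ₚ P *ₚ w) ∎

module ModPrime {p : ℕ} (pp : Prime p) where
  open ModRing p

  -- `divMod` needs a divisor that is monic over ℤ, not merely one whose leading coefficient is a
  -- unit modulo p.
  NormalForm : ℕ → Poly → Set
  NormalForm n r = Σ ℕ λ m → Σ Poly λ r' → Σ ℤ λ e →
    m < n × MonicDeg m r' × r' ≈ constP e *ₚ r

  normalise : ∀ n r → DegLt n r → r ≈ [] ⊎ NormalForm n r
  normalise zero    r r<0 = inj₁ (≈ₚ⇒≈ λ k → r<0 k z≤n)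
  normalise (suc n) r r<n with p ℕD.∣? ℤ.∣ coeff r n ∣
  ... | yes p∣c = [ (λ r'≈0 → inj₁ (≈-trans (≈-sym r'≈r) r'≈0))
                  , (λ (m , r'' , e , m<n , md , eq) → inj₂ (m , r'' , e , ℕP.m≤n⇒m≤1+n m<n , md , ≈-trans eq (*-cong (≈-refl {constP e}) r'≈r))) ]′
                  (normalise n r' r'<n)
    where
    c = coeff r n
    r' = r +ₚ constP (- c) *ₚ mono n
    r'≈r : r' ≈ r
    r'≈r = begin
      r +ₚ constP (- c) *ₚ mono n  ≈⟨ +-cong (≈-refl {r}) (*-cong (≈-trans (constP-≈0 (- c) (∣-neg {p} {c} p∣c)) (≈-sym constP-0)) (≈-refl {mono n})) ⟩
      r +ₚ constP (+ 0) *ₚ mono n  ≈⟨ solve 2 (λ r m → r :+ con (+ 0) :* m := r) ≈-refl r (mono n) ⟩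
      r                            ∎
      where open SetoidReasoning setoid
            open Solver
    r'<n : DegLt n r'
    r'<n k n≤k with ℕP.m≤n⇒m<n∨m≡n n≤k
    ... | inj₂ refl = trans (coeff-axpy r (- c) (mono n) n) (trans (cong (λ z → c ℤ.+ - c ℤ.* z) (top (mono-monicDeg n))) (solve 1 (λ c → c :+ (:- c) :* con (+ 1) := con (+ 0)) refl c))
      where open ℤ-Solver
    ... | inj₁ n<k  = trans (coeff-axpy r (- c) (mono n) k) (trans (cong₂ (λ y z → y ℤ.+ - c ℤ.* z) (r<n k n<k) (above (mono-monicDeg n) k n<k)) (trans (ℤP.+-identityˡ _) (ℤP.*-zeroʳ (- c))))
  ... | no p∤c with inverseModP pp (coeff r n) p∤c
  ...   | e , ec≡1 = inj₂ (n , r' , e , ℕP.≤-refl , md , r'≈er)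
    where
    c = coeff r n
    -- Since e c is 1 only modulo p, the multiple b of p is added in degree n to make the leading
    -- coefficient exactly 1.
    b = + 1 ℤ.- e ℤ.* c
    p∣b : (+ p) ℤD.∣ b
    p∣b = ∣-resp (solve 2 (λ e c → :- (e :* c :- con (+ 1)) := con (+ 1) :- e :* c) refl e c) (∣-neg {p} {e ℤ.* c ℤ.- + 1} ec≡1)
      where open ℤ-Solver
    r' = constP e *ₚ r +ₚ constP b *ₚ mono n
    r'≈er : r' ≈ constP e *ₚ r
    r'≈er = begin
      constP e *ₚ r +ₚ constP b *ₚ mono n      ≈⟨ +-cong (≈-refl {constP e *ₚ r}) (*-cong (≈-trans (constP-≈0 b p∣b) (≈-sym constP-0)) (≈-refl {mono n})) ⟩
      constP e *ₚ r +ₚ constP (+ 0) *ₚ mono n  ≈⟨ solve 2 (λ r m → r :+ con (+ 0) :* m := r) ≈-refl (constP e *ₚ r) (mono n) ⟩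
      constP e *ₚ r                            ∎
      where open SetoidReasoning setoid
            open Solver
    coeffs-r' : ∀ k → coeff r' k ≡ e ℤ.* coeff r k ℤ.+ b ℤ.* coeff (mono n) k
    coeffs-r' k = trans (coeff-axpy (constP e *ₚ r) b (mono n) k) (cong (ℤ._+ b ℤ.* coeff (mono n) k) (trans (constP-* e r k) (coeff-scale e r k)))
    md : MonicDeg n r'
    md = monicDeg
      (trans (coeffs-r' n) (trans (cong (λ z → e ℤ.* c ℤ.+ b ℤ.* z) (top (mono-monicDeg n))) (solve 2 (λ e c → e :* c :+ (con (+ 1) :- e :* c) :* con (+ 1) := con (+ 1)) refl e c)))
      (λ k n<k → trans (coeffs-r' k) (trans (cong₂ (λ y z → e ℤ.* y ℤ.+ b ℤ.* z) (r<n k n<k) (above (mono-monicDeg n) k n<k)) (trans (cong₂ ℤ._+_ (ℤP.*-zeroʳ e) (ℤP.*-zeroʳ b)) refl)))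
      where open ℤ-Solver

  Coprimeₚ : Poly → Poly → Set
  Coprimeₚ f g = Σ Poly λ α → Σ Poly λ β → α *ₚ f +ₚ β *ₚ g ≈ constP (+ 1)

  module _ {n : ℕ} {φ : Poly} (φ-monic : MonicDeg n φ) (irr : IrredModP p φ) where

    private
      step : ∀ g q s e s' → φ *ₚ q +ₚ s ≈ g → s' ≈ constP e *ₚ s → Coprimeₚ φ s' → Coprimeₚ φ g
      step g q s e s' eq s'≈ (α , β , bez) = (α -ₚ β *ₚ constP e *ₚ q) , β *ₚ constP e , (begin
        (α -ₚ β *ₚ constP e *ₚ q) *ₚ φ +ₚ β *ₚ constP e *ₚ g
          ≈⟨ +-cong (≈-refl {(α -ₚ β *ₚ constP e *ₚ q) *ₚ φ}) (*-cong (≈-refl {β *ₚ constP e}) (≈-sym eq)) ⟩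
        (α -ₚ β *ₚ constP e *ₚ q) *ₚ φ +ₚ β *ₚ constP e *ₚ (φ *ₚ q +ₚ s)
          ≈⟨ solve 6 (λ α β e q φ s → (α :- β :* e :* q) :* φ :+ β :* e :* (φ :* q :+ s) := α :* φ :+ β :* (e :* s)) ≈-refl α β (constP e) q φ s ⟩
        α *ₚ φ +ₚ β *ₚ (constP e *ₚ s)
          ≈⟨ +-cong (≈-refl {α *ₚ φ}) (*-cong (≈-refl {β}) (≈-sym s'≈)) ⟩
        α *ₚ φ +ₚ β *ₚ s'
          ≈⟨ bez ⟩
        constP (+ 1) ∎)
        where open SetoidReasoning setoid
              open Solver

    -- A Euclidean algorithm in which φ stays the dividend: from φ = r q + s, a Bézout relation
    -- between φ and s gives one between φ and r, because s = φ - r q. The degree of the divisor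
    -- drops each time, and a vanishing remainder would split φ into r and q, both nonconstant
    -- modulo p.
    coprime-of-smaller-degree : ∀ m r → MonicDeg m r → m < n → Coprimeₚ φ r
    coprime-of-smaller-degree = <-rec _ go
      where
      go : ∀ m → (∀ {k} → k < m → ∀ r → MonicDeg k r → k < n → Coprimeₚ φ r) → ∀ r → MonicDeg m r → m < n → Coprimeₚ φ r
      go zero rec r md _ = [] , constP (+ 1) , ≈-trans
          (solve 1 (λ r → con (+ 1) :* r := r) ≈-refl r)
          (≈ₚ⇒≈ λ { zero → top md ; (suc k) → above md (suc k) (s≤s z≤n) })
        where open Solver
      go m@(suc _) rec r md m<n with divMod md φ
      ... | q , s , e , s<m with normalise m s s<m
      ...   | inj₁ s≈0 = ⊥-elim ([ r-const , q-const ]′ (proj₂ irr r q (coeffs φ≈rq)))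
        where
        φ≈rq : φ ≈ r *ₚ q
        φ≈rq = ≈-trans (≈₀⇒≈ e) (≈-trans (+-cong (≈-refl {r *ₚ q}) (≈-trans s≈0 (≈-sym constP-0))) (solve 1 (λ z → z :+ con (+ 0) := z) ≈-refl (r *ₚ q)))
          where open Solver
        r-const : ConstModP p r → ⊥
        r-const c = prime∤1 pp (∣-resp (top md) (c _))
        -- A constant q would make φ a constant multiple of r modulo p, of degree m < n, against the
        -- leading coefficient 1 at n.
        q-const : ConstModP p q → ⊥
        q-const c = prime∤1 pp (∣-resp eq (coeffs φ≈ n))
          where
          q≈ : q ≈ constP (coeff q 0)
          q≈ = mod λ where
            zero    → ∣-resp (sym (ℤP.+-inverseʳ (coeff q 0))) (p ℕD.∣0)
            (suc k) → ∣-resp (sym (ℤP.+-identityʳ (coeff q (suc k)))) (c k)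
          φ≈ : φ ≈ constP (coeff q 0) *ₚ r
          φ≈ = ≈-trans φ≈rq (≈-trans (*-comm r q) (*-cong q≈ (≈-refl {r})))
          eq : coeff φ n ℤ.- coeff (constP (coeff q 0) *ₚ r) n ≡ + 1
          eq = cong₂ ℤ._-_ (top φ-monic) (trans (constP-* (coeff q 0) r n) (trans (coeff-scale (coeff q 0) r n) (trans (cong (coeff q 0 ℤ.*_) (above md n m<n)) (ℤP.*-zeroʳ (coeff q 0)))))
      ...   | inj₂ (k , s' , c , k<m , md' , s'≈) with rec k<m s' md' (ℕP.<-trans k<m m<n)
      ...     | α , β , bez = (α +ₚ β *ₚ constP c) , -ₚ (β *ₚ constP c *ₚ q) , (begin
          (α +ₚ β *ₚ constP c) *ₚ φ +ₚ (-ₚ (β *ₚ constP c *ₚ q)) *ₚ r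
            ≈⟨ solve 6 (λ α β c q φ r → (α :+ β :* c) :* φ :+ (:- (β :* c :* q)) :* r := α :* φ :+ β :* (c :* (φ :- r :* q))) ≈-refl α β (constP c) q φ r ⟩
          α *ₚ φ +ₚ β *ₚ (constP c *ₚ (φ -ₚ r *ₚ q))
            ≈⟨ +-cong (≈-refl {α *ₚ φ}) (*-cong (≈-refl {β}) (*-cong (≈-refl {constP c}) (+-cong (≈₀⇒≈ e) (≈-refl { -ₚ (r *ₚ q)})))) ⟩
          α *ₚ φ +ₚ β *ₚ (constP c *ₚ (r *ₚ q +ₚ s -ₚ r *ₚ q))
            ≈⟨ solve 5 (λ u β c w s → u :+ β :* (c :* (w :+ s :- w)) := u :+ β :* (c :* s)) ≈-refl (α *ₚ φ) β (constP c) (r *ₚ q) s ⟩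
          α *ₚ φ +ₚ β *ₚ (constP c *ₚ s)
            ≈⟨ +-cong (≈-refl {α *ₚ φ}) (*-cong (≈-refl {β}) (≈-sym s'≈)) ⟩
          α *ₚ φ +ₚ β *ₚ s'
            ≈⟨ bez ⟩
          constP (+ 1) ∎)
        where open SetoidReasoning setoid
              open Solver

    divides-or-coprime : ∀ g → φ ∣[ p ] g ⊎ Coprimeₚ φ g
    divides-or-coprime g with divMod φ-monic g
    ... | q , s , e , s<n with normalise n s s<n
    ...   | inj₁ s≈0 = inj₁ (divides q (≈-trans (≈₀⇒≈ e) (≈-trans (+-cong (≈-refl {φ *ₚ q}) (≈-trans s≈0 (≈-sym constP-0))) (solve 1 (λ z → z :+ con (+ 0) := z) ≈-refl (φ *ₚ q)))))
        where open Solver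
    ...   | inj₂ (m , s' , c , m<n , md , s'≈) = inj₂ (step g q s c s' (≈-sym (≈₀⇒≈ e)) s'≈ (coprime-of-smaller-degree m s' md m<n))

  coprime-divisor : ∀ {φ f} g → Coprimeₚ φ f → φ ∣[ p ] f *ₚ g → φ ∣[ p ] g
  coprime-divisor {φ} {f} g (α , β , bez) (divides h e) = divides (α *ₚ g +ₚ β *ₚ h) (begin
    g                                    ≈⟨ solve 1 (λ g → g := con (+ 1) :* g) ≈-refl g ⟩
    constP (+ 1) *ₚ g                    ≈⟨ *-cong (≈-sym bez) (≈-refl {g}) ⟩
    (α *ₚ φ +ₚ β *ₚ f) *ₚ g              ≈⟨ solve 5 (λ α β φ f g → (α :* φ :+ β :* f) :* g := φ :* (α :* g) :+ β :* (f :* g)) ≈-refl α β φ f g ⟩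
    φ *ₚ (α *ₚ g) +ₚ β *ₚ (f *ₚ g)       ≈⟨ +-cong (≈-refl {φ *ₚ (α *ₚ g)}) (*-cong (≈-refl {β}) e) ⟩
    φ *ₚ (α *ₚ g) +ₚ β *ₚ (φ *ₚ h)       ≈⟨ solve 4 (λ φ u β h → φ :* u :+ β :* (φ :* h) := φ :* (u :+ β :* h)) ≈-refl φ (α *ₚ g) β h ⟩
    φ *ₚ (α *ₚ g +ₚ β *ₚ h)              ∎)
    where open SetoidReasoning setoid
          open Solver

  -- Lifting is linear rather than quadratic: an error p w in the Bézout relation is multiplied by
  -- p^(M+1) and disappears, so the relation modulo p, with the same α and β, serves at every level.
  lift-factorisation : ∀ {d φ A g} α β → MonicDeg d φ → ∀ M → A ≈[ p ℕ.^ suc M ] φ *ₚ g →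
    α *ₚ φ +ₚ β *ₚ g ≈ constP (+ 1) →
    Σ Poly λ φ̂ → Σ Poly λ ĝ → MonicDeg d φ̂ × φ̂ ≈ φ × ĝ ≈ g × A ≈[ p ℕ.^ suc (suc M) ] φ̂ *ₚ ĝ
  lift-factorisation {d} {φ} {A} {g} α β md M A≈φg bez = φ̂ , ĝ , md̂ , absorb φ u , absorb g v , A≈φ̂ĝ
    where
    q = p ℕ.^ suc M
    P = constP (+ p)
    Q = constP (+ q)
    h = proj₁ (≈⇒+q* A≈φg)
    w = proj₁ (≈⇒+q* bez)
    s = proj₁ (divMod md (h *ₚ β))
    u = proj₁ (proj₂ (divMod md (h *ₚ β)))
    u<d : DegLt d u
    u<d = proj₂ (proj₂ (proj₂ (divMod md (h *ₚ β))))
    v = h *ₚ α +ₚ g *ₚ s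
    φ̂ = φ +ₚ Q *ₚ u
    ĝ = g +ₚ Q *ₚ v
    absorb : ∀ f h → f +ₚ Q *ₚ h ≈ f
    absorb f h = ≈-trans (+-cong (≈-refl {f}) (*-cong (≈-trans (constP-≈0 (+ q) (ℕD.m∣m*n (p ℕ.^ M))) (≈-sym constP-0)) (≈-refl {h}))) (solve 2 (λ f h → f :+ con (+ 0) :* h := f) ≈-refl f h)
      where open Solver
    md̂ : MonicDeg d φ̂
    md̂ = monicDeg
      (trans (coeff-axpy φ (+ q) u d) (trans (cong₂ (λ y z → y ℤ.+ + q ℤ.* z) (top md) (u<d d ℕP.≤-refl)) (cong (λ z → + 1 ℤ.+ z) (ℤP.*-zeroʳ (+ q)))))
      (λ k d<k → trans (coeff-axpy φ (+ q) u k) (trans (cong₂ (λ y z → y ℤ.+ + q ℤ.* z) (above md k d<k) (u<d k (ℕP.<⇒≤ d<k))) (cong (λ z → + 0 ℤ.+ z) (ℤP.*-zeroʳ (+ q)))))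
    pq∣qp : p ℕ.* q ℕD.∣ q ℕ.* p
    pq∣qp = ℕD.∣-reflexive (ℕP.*-comm p q)
    QP≈0 : Q *ₚ P ≈[ p ℕ.^ suc (suc M) ] constP (+ 0)
    QP≈0 = constP-*-≈0 (+ q) (+ p) (∣-resp (ℤP.pos-* q p) pq∣qp)
    -- Because 2 (M + 1) ≥ M + 2.
    QQ≈0 : Q *ₚ Q ≈[ p ℕ.^ suc (suc M) ] constP (+ 0)
    QQ≈0 = constP-*-≈0 (+ q) (+ q) (∣-resp (ℤP.pos-* q q) (ℕD.∣-trans pq∣qp (ℕD.*-monoʳ-∣ q (ℕD.m∣m*n (p ℕ.^ M)))))
    A≈φ̂ĝ : A ≈[ p ℕ.^ suc (suc M) ] φ̂ *ₚ ĝ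
    A≈φ̂ĝ = hensel-step (p ℕ.^ suc (suc M)) φ g Q P u h α β s w A
      (≈₀⇒≈ (proj₁ (proj₂ (proj₂ (divMod md (h *ₚ β)))))) (≈₀⇒≈ (proj₂ (≈⇒+q* bez))) (≈₀⇒≈ (proj₂ (≈⇒+q* A≈φg))) QP≈0 QQ≈0

  hensel : ∀ {d φ A g} → MonicDeg d φ → A ≈ φ *ₚ g → Coprimeₚ φ g → ∀ M →
           Σ Poly λ φ̂ → Σ Poly λ ĝ → MonicDeg d φ̂ × φ̂ ≈ φ × ĝ ≈ g × A ≈[ p ℕ.^ suc M ] φ̂ *ₚ ĝ
  hensel {φ = φ} {A} {g} md A≈φg _ zero = φ , g , md , ≈-refl , ≈-refl , subst (λ q → A ≈[ q ] φ *ₚ g) (sym (ℕP.*-identityʳ p)) A≈φg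
  hensel md A≈φg cop@(α , β , bez) (suc M) =
    let φ₁ , g₁ , md₁ , φ₁≈φ , g₁≈g , A≈φ₁g₁ = hensel md A≈φg cop M
        φ₂ , g₂ , md₂ , φ₂≈φ₁ , g₂≈g₁ , A≈φ₂g₂ = lift-factorisation α β md₁ M A≈φ₁g₁
          (≈-trans (+-cong (*-cong (≈-refl {α}) φ₁≈φ) (*-cong (≈-refl {β}) g₁≈g)) bez)
    in φ₂ , g₂ , md₂ , ≈-trans φ₂≈φ₁ φ₁≈φ , ≈-trans g₂≈g₁ g₁≈g , A≈φ₂g₂

-- The substitution X = z + 1/z, cleared of denominators

module _ where

  open ModRing 0

  -- The local function inside `chebHom` cannot be named directly; once its arguments are
  -- abstracted to distinct variables, unification recovers it as `chebGo`.

  mutual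
    chebHomTail : ℤ → Poly → Poly
    chebHomTail c cs = _

    chebHom-∷ : ∀ c cs → chebHom (c ∷ cs) ≡ scaleₚ c (constP (+ 1) *ₚ (X ^ₚ suc (length cs))) +ₚ chebHomTail c cs
    chebHom-∷ c cs = refl

  mutual
    chebGo : Poly → Poly → ℕ → Poly
    chebGo = _

    chebHomTail≡chebGo : ∀ c cs → chebHomTail c cs ≡ chebGo (c ∷ cs) cs 1
    chebHomTail≡chebGo c cs with c ∷ cs | 1
    ... | T | k = refl

  private
    S : Poly
    S = constP (+ 1) +ₚ X *ₚ X

  -- Reading X as z, this is z^M f(z + 1/z) in Horner form. Since `pred` is truncated at 0, the
  -- reading is right once M is large enough for `f`, which the bounds on `length f` below ensure.
  hom : ℕ → Poly → Poly
  hom M []      = []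
  hom M (c ∷ f) = constP c *ₚ X ^ₚ M +ₚ S *ₚ hom (pred M) f

  ≡⇒≈ : ∀ {f g} → f ≡ g → f ≈ g
  ≡⇒≈ refl = ≈-refl

  private
    scale≈ : ∀ c f → scaleₚ c f ≈ constP c *ₚ f
    scale≈ c f = ≈-sym (≈ₚ⇒≈ (constP-* c f))

  chebGo≈hom : ∀ T f k → chebGo T f k ≈ S ^ₚ k *ₚ hom (length T ∸ k) f
  chebGo≈hom T []      k = ≈-sym (*-zeroʳ (S ^ₚ k))
  chebGo≈hom T (c ∷ f) k = begin
    scaleₚ c (S ^ₚ k *ₚ X ^ₚ (length T ∸ k)) +ₚ chebGo T f (suc k)
      ≈⟨ +-cong (scale≈ c (S ^ₚ k *ₚ X ^ₚ (length T ∸ k))) (chebGo≈hom T f (suc k)) ⟩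
    constP c *ₚ (S ^ₚ k *ₚ X ^ₚ (length T ∸ k)) +ₚ S *ₚ S ^ₚ k *ₚ hom (length T ∸ suc k) f
      ≈⟨ solve 5 (λ c s x S h → c :* (s :* x) :+ S :* s :* h := s :* (c :* x :+ S :* h)) ≈-refl (constP c) (S ^ₚ k) (X ^ₚ (length T ∸ k)) S (hom (length T ∸ suc k) f) ⟩
    S ^ₚ k *ₚ (constP c *ₚ X ^ₚ (length T ∸ k) +ₚ S *ₚ hom (length T ∸ suc k) f)
      ≡⟨ cong (λ z → S ^ₚ k *ₚ (constP c *ₚ X ^ₚ (length T ∸ k) +ₚ S *ₚ hom z f)) (sym (ℕP.pred[m∸n]≡m∸[1+n] (length T) k)) ⟩
    S ^ₚ k *ₚ hom (length T ∸ k) (c ∷ f) ∎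
    where open SetoidReasoning setoid
          open Solver

  chebHom≈hom : ∀ T → chebHom T ≈ hom (length T) T
  chebHom≈hom []       = ≈-refl
  chebHom≈hom (c ∷ cs) = begin
    chebHom (c ∷ cs)
      ≡⟨ cong (scaleₚ c (constP (+ 1) *ₚ (X ^ₚ suc (length cs))) +ₚ_) (chebHomTail≡chebGo c cs) ⟩
    scaleₚ c (constP (+ 1) *ₚ (X ^ₚ suc (length cs))) +ₚ chebGo (c ∷ cs) cs 1
      ≈⟨ +-cong (scale≈ c (constP (+ 1) *ₚ (X ^ₚ suc (length cs)))) (chebGo≈hom (c ∷ cs) cs 1) ⟩
    constP c *ₚ (constP (+ 1) *ₚ (X ^ₚ suc (length cs))) +ₚ S *ₚ constP (+ 1) *ₚ hom (length cs) cs
      ≈⟨ solve 4 (λ c x S h → c :* (con (+ 1) :* x) :+ S :* con (+ 1) :* h := c :* x :+ S :* h) ≈-refl (constP c) (X ^ₚ suc (length cs)) S (hom (length cs) cs) ⟩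
    hom (suc (length cs)) (c ∷ cs) ∎
    where open SetoidReasoning setoid
          open Solver

  hom-+ : ∀ M f g → hom M (f +ₚ g) ≈ hom M f +ₚ hom M g
  hom-+ M []      g       = ≈-refl
  hom-+ M (a ∷ f) []      = ≈-sym (≈ₚ⇒≈ λ k → trans (coeff-+ (hom M (a ∷ f)) [] k) (ℤP.+-identityʳ _))
  hom-+ M (a ∷ f) (b ∷ g) = ≈-trans (+-cong (≈-refl {constP (a ℤ.+ b) *ₚ X ^ₚ M}) (*-cong (≈-refl {S}) (hom-+ (pred M) f g)))
    (solve 6 (λ a b x S h h' → (a :+ b) :* x :+ S :* (h :+ h') := (a :* x :+ S :* h) :+ (b :* x :+ S :* h')) ≈-refl (constP a) (constP b) (X ^ₚ M) S (hom (pred M) f) (hom (pred M) g))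
    where open Solver

  hom-neg : ∀ M f → hom M (-ₚ f) ≈ -ₚ hom M f
  hom-neg M []      = ≈-refl
  hom-neg M (a ∷ f) = ≈-trans (+-cong (≈-refl {constP (- a) *ₚ X ^ₚ M}) (*-cong (≈-refl {S}) (hom-neg (pred M) f)))
    (solve 4 (λ a x S h → (:- a) :* x :+ S :* (:- h) := :- (a :* x :+ S :* h)) ≈-refl (constP a) (X ^ₚ M) S (hom (pred M) f))
    where open Solver

  hom-suc : ∀ M f → length f ≤ M → hom (suc M) f ≈ X *ₚ hom M f
  hom-suc M []            _       = ≈-sym (*-zeroʳ X)
  hom-suc (suc M) (c ∷ f) (s≤s l) = ≈-trans (+-cong (≈-refl {constP c *ₚ X ^ₚ suc (suc M)}) (*-cong (≈-refl {S}) (hom-suc M f l)))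
    (solve 5 (λ c x y S h → c :* (x :* y) :+ S :* (x :* h) := x :* (c :* y :+ S :* h)) ≈-refl (constP c) X (X ^ₚ suc M) S (hom M f))
    where open Solver

  hom-raise : ∀ M j f → length f ≤ M → hom (j ℕ.+ M) f ≈ X ^ₚ j *ₚ hom M f
  hom-raise M zero    f l = solve 1 (λ h → h := con (+ 1) :* h) ≈-refl (hom M f)
    where open Solver
  hom-raise M (suc j) f l = ≈-trans (hom-suc (j ℕ.+ M) f (ℕP.≤-trans l (ℕP.m≤n+m M j))) (≈-trans (*-cong (≈-refl {X}) (hom-raise M j f l))
    (solve 3 (λ x y h → x :* (y :* h) := x :* y :* h) ≈-refl X (X ^ₚ j) (hom M f)))
    where open Solver

  hom-zero : ∀ M f → f ≈ₚ [] → hom M f ≈ []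
  hom-zero M []      e = ≈-refl
  hom-zero M (c ∷ f) e = begin
    constP c *ₚ X ^ₚ M +ₚ S *ₚ hom (pred M) f
      ≈⟨ +-cong (*-cong (≡⇒≈ (cong constP (e 0))) (≈-refl {X ^ₚ M})) (*-cong (≈-refl {S}) (≈-trans (hom-zero (pred M) f (λ k → e (suc k))) (≈-sym constP-0))) ⟩
    constP (+ 0) *ₚ X ^ₚ M +ₚ S *ₚ constP (+ 0)
      ≈⟨ solve 2 (λ x S → con (+ 0) :* x :+ S :* con (+ 0) := con (+ 0)) ≈-refl (X ^ₚ M) S ⟩
    constP (+ 0) ≈⟨ constP-0 ⟩
    [] ∎
    where open SetoidReasoning setoid
          open Solver

  X^≈mono : ∀ M → X ^ₚ M ≈ mono M
  X^≈mono zero    = ≈-refl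
  X^≈mono (suc M) = ≈-trans (*-cong (≈-refl {X}) (X^≈mono M)) (X*≈∷ (mono M))

  mono-below : ∀ M k → k < M → coeff (mono M) k ≡ + 0
  mono-below (suc M) zero    _       = refl
  mono-below (suc M) (suc k) (s≤s l) = mono-below M k l

  coeff-constX^ : ∀ c M k → coeff (constP c *ₚ X ^ₚ M) k ≡ c ℤ.* coeff (mono M) k
  coeff-constX^ c M k = trans (constP-* c (X ^ₚ M) k) (trans (coeff-scale c (X ^ₚ M) k) (cong (c ℤ.*_) (≈⇒≈ₚ (X^≈mono M) k)))

  -- The constant term of 1 + X² is 1, so the coefficients of `h` can be solved for in ascending
  -- order, each from the one two places below.
  S*-low-zero : ∀ h M → (∀ k → k < M → coeff (S *ₚ h) k ≡ + 0) → ∀ k → k < M → coeff h k ≡ + 0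
  S*-low-zero h M z = go
    where
    S*≈ : S *ₚ h ≈ h +ₚ (+ 0 ∷ + 0 ∷ h)
    S*≈ = ≈-trans (solve 2 (λ x h → (con (+ 1) :+ x :* x) :* h := h :+ x :* (x :* h)) ≈-refl X h)
            (+-cong (≈-refl {h}) (≈-trans (*-cong (≈-refl {X}) (X*≈∷ h)) (X*≈∷ (+ 0 ∷ h))))
      where open Solver
    eq : ∀ k → coeff (S *ₚ h) k ≡ coeff h k ℤ.+ coeff (+ 0 ∷ + 0 ∷ h) k
    eq k = trans (≈⇒≈ₚ S*≈ k) (coeff-+ h (+ 0 ∷ + 0 ∷ h) k)
    go : ∀ k → k < M → coeff h k ≡ + 0
    go zero          l = trans (sym (trans (eq 0) (ℤP.+-identityʳ _))) (z 0 l)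
    go (suc zero)    l = trans (sym (trans (eq 1) (ℤP.+-identityʳ _))) (z 1 l)
    go (suc (suc k)) l = trans (sym (trans (eq (suc (suc k))) (trans (cong (λ y → coeff h (suc (suc k)) ℤ.+ y) (go k (ℕP.<-trans (ℕP.n<1+n k) (ℕP.<-trans (ℕP.n<1+n (suc k)) l)))) (ℤP.+-identityʳ _)))) (z (suc (suc k)) l)

  -- The coefficient of X^(M-k) in (1+X²)^k X^(M-k) is the lowest one, so the
  -- coefficients of f can be peeled off from below.
  hom-injective : ∀ M f → length f ≤ M → (∀ k → k ≤ M → coeff (hom M f) k ≡ + 0) → f ≈ₚ []
  hom-injective M []            _       z k = refl
  hom-injective (suc M) (c ∷ f) (s≤s l) z = λ where
      zero    → c≡0
      (suc k) → f≈0 k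
    where
    eq : ∀ k → coeff (hom (suc M) (c ∷ f)) k ≡ c ℤ.* coeff (mono (suc M)) k ℤ.+ coeff (S *ₚ hom M f) k
    eq k = trans (coeff-+ (constP c *ₚ X ^ₚ suc M) (S *ₚ hom M f) k) (cong (ℤ._+ coeff (S *ₚ hom M f) k) (coeff-constX^ c (suc M) k))
    low : ∀ k → k < suc M → coeff (S *ₚ hom M f) k ≡ + 0
    low k k<M = trans (sym (trans (eq k) (trans (cong (λ y → c ℤ.* y ℤ.+ coeff (S *ₚ hom M f) k) (mono-below (suc M) k k<M)) (trans (cong (ℤ._+ coeff (S *ₚ hom M f) k) (ℤP.*-zeroʳ c)) (ℤP.+-identityˡ _))))) (z k (ℕP.<⇒≤ k<M))
    f≈0 : f ≈ₚ []
    f≈0 = hom-injective M f l λ k k≤M → S*-low-zero (hom M f) (suc M) low k (s≤s k≤M)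
    Sh≈0 : S *ₚ hom M f ≈ []
    Sh≈0 = ≈-trans (*-cong (≈-refl {S}) (hom-zero M f f≈0)) (*-zeroʳ S)
    c≡0 : c ≡ + 0
    c≡0 = begin
      c                                      ≡⟨ ℤP.*-identityʳ c ⟨
      c ℤ.* + 1                              ≡⟨ cong (c ℤ.*_) (top (mono-monicDeg (suc M))) ⟨
      c ℤ.* coeff (mono (suc M)) (suc M)     ≡⟨ ℤP.+-identityʳ _ ⟨
      c ℤ.* coeff (mono (suc M)) (suc M) ℤ.+ + 0 ≡⟨ cong (λ z → c ℤ.* coeff (mono (suc M)) (suc M) ℤ.+ z) (≈⇒≈ₚ Sh≈0 (suc M)) ⟨
      c ℤ.* coeff (mono (suc M)) (suc M) ℤ.+ coeff (S *ₚ hom M f) (suc M) ≡⟨ eq (suc M) ⟨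
      coeff (hom (suc M) (c ∷ f)) (suc M)    ≡⟨ z (suc M) ℕP.≤-refl ⟩
      + 0                                    ∎
      where open ≡-Reasoning

  ^ₚ-+ : ∀ f a b → f ^ₚ (a ℕ.+ b) ≈ f ^ₚ a *ₚ f ^ₚ b
  ^ₚ-+ f zero    b = solve 1 (λ h → h := con (+ 1) :* h) ≈-refl (f ^ₚ b)
    where open Solver
  ^ₚ-+ f (suc a) b = ≈-trans (*-cong (≈-refl {f}) (^ₚ-+ f a b)) (solve 3 (λ f u v → f :* (u :* v) := f :* u :* v) ≈-refl f (f ^ₚ a) (f ^ₚ b))
    where open Solver

  X^-cancel : ∀ d {f} → X ^ₚ d *ₚ f ≈ [] → f ≈ []
  X^-cancel zero    {f} e = ≈-trans (solve 1 (λ f → f := con (+ 1) :* f) ≈-refl f) e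
    where open Solver
  X^-cancel (suc d) {f} e = X^-cancel d (≈ₚ⇒≈ λ k → ≈⇒≈ₚ shifted (suc k))
    where
    shifted : (+ 0 ∷ X ^ₚ d *ₚ f) ≈ []
    shifted = ≈-trans (≈-sym (X*≈∷ (X ^ₚ d *ₚ f))) (≈-trans (solve 3 (λ x y f → x :* (y :* f) := x :* y :* f) ≈-refl X (X ^ₚ d) f) e)
      where open Solver

  -- Chebyshev polynomials by their recursion

  C : ℕ → Poly
  C zero          = constP (+ 2)
  C (suc zero)    = X
  C (suc (suc d)) = (+ 0 ∷ C (suc d)) -ₚ C d

  C-rec : ∀ d → C (suc (suc d)) ≈ X *ₚ C (suc d) -ₚ C d
  C-rec d = +-cong (≈-sym (X*≈∷ (C (suc d)))) (≈-refl { -ₚ C d})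

  length-+ₚ : ∀ f g {M} → length f ≤ M → length g ≤ M → length (f +ₚ g) ≤ M
  length-+ₚ []      g       k       l       = l
  length-+ₚ (a ∷ f) []      k       l       = k
  length-+ₚ (a ∷ f) (b ∷ g) (s≤s k) (s≤s l) = s≤s (length-+ₚ f g k l)

  length-neg : ∀ f {M} → length f ≤ M → length (-ₚ f) ≤ M
  length-neg f = subst (_≤ _) (sym (ListP.length-map -_ f))

  length-C : ∀ d → length (C d) ≤ suc d
  length-C zero          = ℕP.≤-refl
  length-C (suc zero)    = ℕP.≤-refl
  length-C (suc (suc d)) = length-+ₚ (+ 0 ∷ C (suc d)) (-ₚ C d) (s≤s (length-C (suc d)))
    (length-neg (C d) (ℕP.≤-trans (length-C d) (ℕP.m≤n+m (suc d) 2)))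

  -- For X read as z this is C_d(z + 1/z) = z^d + z^(-d), multiplied by z^(M+d). The bound d < M
  -- keeps `pred` in `hom` from truncating, as `C d` has degree d.
  hom-C : ∀ d M → d < M → X ^ₚ d *ₚ hom M (C d) ≈ X ^ₚ M *ₚ (X ^ₚ d *ₚ X ^ₚ d) +ₚ X ^ₚ M
  hom-C zero M _ = ≈-trans (*-cong (≈-refl {constP (+ 1)}) (+-cong (≈-refl {constP (+ 2) *ₚ X ^ₚ M}) (*-zeroʳ S)))
    (≈-trans (*-cong (≈-refl {constP (+ 1)}) (+-cong (≈-refl {constP (+ 2) *ₚ X ^ₚ M}) (≈-sym constP-0)))
    (solve 1 (λ x → con (+ 1) :* (con (+ 2) :* x :+ con (+ 0)) := x :* (con (+ 1) :* con (+ 1)) :+ x) ≈-refl (X ^ₚ M)))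
    where open Solver
  hom-C (suc zero) (suc (suc M)) _ = ≈-trans
    (*-cong (≈-refl {X ^ₚ 1}) (+-cong (≈-refl {constP (+ 0) *ₚ X ^ₚ suc (suc M)}) (*-cong (≈-refl {S}) (+-cong (≈-refl {constP (+ 1) *ₚ X ^ₚ suc M}) (≈-trans (*-zeroʳ S) (≈-sym constP-0))))))
    (solve 2 (λ x y → (x :* con (+ 1)) :* (con (+ 0) :* (x :* (x :* y)) :+ (con (+ 1) :+ x :* x) :* (con (+ 1) :* (x :* y) :+ con (+ 0)))
                      := (x :* (x :* y)) :* ((x :* con (+ 1)) :* (x :* con (+ 1))) :+ x :* (x :* y)) ≈-refl X (X ^ₚ M))
    where open Solver
  hom-C (suc zero) (suc zero) (s≤s ())
  hom-C (suc (suc d)) (suc M) (s≤s d<M) = begin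
    X ^ₚ (2 ℕ.+ d) *ₚ hom (suc M) ((+ 0 ∷ C (suc d)) -ₚ C d)
      ≈⟨ *-cong (≈-refl {X ^ₚ (2 ℕ.+ d)}) (≈-trans (hom-+ (suc M) (+ 0 ∷ C (suc d)) (-ₚ C d)) (+-cong (≈-refl {hom (suc M) (+ 0 ∷ C (suc d))}) (hom-neg (suc M) (C d)))) ⟩
    X *ₚ (X *ₚ X ^ₚ d) *ₚ (constP (+ 0) *ₚ X ^ₚ suc M +ₚ S *ₚ hom M (C (suc d)) -ₚ hom (suc M) (C d))
      ≈⟨ solve 5 (λ x w y h h' → x :* (x :* w) :* (con (+ 0) :* y :+ (con (+ 1) :+ x :* x) :* h :- h') := x :* (con (+ 1) :+ x :* x) :* ((x :* w) :* h) :- x :* x :* (w :* h')) ≈-refl X (X ^ₚ d) (X ^ₚ suc M) (hom M (C (suc d))) (hom (suc M) (C d)) ⟩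
    X *ₚ S *ₚ (X ^ₚ suc d *ₚ hom M (C (suc d))) -ₚ X *ₚ X *ₚ (X ^ₚ d *ₚ hom (suc M) (C d))
      ≈⟨ +-cong (*-cong (≈-refl {X *ₚ S}) (hom-C (suc d) M d<M)) (neg-cong (*-cong (≈-refl {X *ₚ X}) (hom-C d (suc M) (ℕP.<-trans (ℕP.n<1+n d) (ℕP.m≤n⇒m≤1+n d<M))))) ⟩
    X *ₚ S *ₚ (X ^ₚ M *ₚ (X ^ₚ suc d *ₚ X ^ₚ suc d) +ₚ X ^ₚ M) -ₚ X *ₚ X *ₚ (X ^ₚ suc M *ₚ (X ^ₚ d *ₚ X ^ₚ d) +ₚ X ^ₚ suc M)
      ≈⟨ solve 3 (λ x y w → x :* (con (+ 1) :+ x :* x) :* (y :* ((x :* w) :* (x :* w)) :+ y) :- x :* x :* ((x :* y) :* (w :* w) :+ x :* y)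
                   := (x :* y) :* ((x :* (x :* w)) :* (x :* (x :* w))) :+ x :* y) ≈-refl X (X ^ₚ M) (X ^ₚ d) ⟩
    X ^ₚ suc M *ₚ (X ^ₚ (2 ℕ.+ d) *ₚ X ^ₚ (2 ℕ.+ d)) +ₚ X ^ₚ suc M ∎
    where open SetoidReasoning setoid
          open Solver

  chebyshev-unique : ∀ d T → IsChebyshev d T → T ≈ C d
  chebyshev-unique d T (_ , e) = ≈-trans (solve 2 (λ t c → t := t :- c :+ c) ≈-refl T (C d))
                                   (≈-trans (+-cong (≈-trans diff≈0 (≈-sym constP-0)) (≈-refl {C d})) (solve 1 (λ c → con (+ 0) :+ c := c) ≈-refl (C d)))
    where
    open Solver
    open SetoidReasoning setoid
    m = length T
    -- Both homogenisations need a common exponent, one that exceeds d and is at least the length of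
    -- `T`.
    j = suc d
    M = j ℕ.+ m
    hom-T : X ^ₚ d *ₚ hom M T ≈ X ^ₚ M *ₚ (X ^ₚ d *ₚ X ^ₚ d) +ₚ X ^ₚ M
    hom-T = begin
      X ^ₚ d *ₚ hom M T
        ≈⟨ *-cong (≈-refl {X ^ₚ d}) (≈-trans (hom-raise m j T ℕP.≤-refl) (*-cong (≈-refl {X ^ₚ j}) (≈-sym (chebHom≈hom T)))) ⟩
      X ^ₚ d *ₚ (X ^ₚ j *ₚ chebHom T)
        ≈⟨ solve 3 (λ a b c → a :* (b :* c) := b :* (a :* c)) ≈-refl (X ^ₚ d) (X ^ₚ j) (chebHom T) ⟩
      X ^ₚ j *ₚ (X ^ₚ d *ₚ chebHom T)
        ≈⟨ *-cong (≈-refl {X ^ₚ j}) (≈ₚ⇒≈ e) ⟩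
      X ^ₚ j *ₚ (X ^ₚ (m ℕ.+ 2 ℕ.* d) +ₚ X ^ₚ m)
        ≈⟨ *-cong (≈-refl {X ^ₚ j}) (+-cong (≈-trans (^ₚ-+ X m (2 ℕ.* d)) (*-cong (≈-refl {X ^ₚ m}) (≈-trans (≡⇒≈ (cong (λ z → X ^ₚ (d ℕ.+ z)) (ℕP.+-identityʳ d))) (^ₚ-+ X d d)))) (≈-refl {X ^ₚ m})) ⟩
      X ^ₚ j *ₚ (X ^ₚ m *ₚ (X ^ₚ d *ₚ X ^ₚ d) +ₚ X ^ₚ m)
        ≈⟨ solve 3 (λ a b w → a :* (b :* w :+ b) := (a :* b) :* w :+ a :* b) ≈-refl (X ^ₚ j) (X ^ₚ m) (X ^ₚ d *ₚ X ^ₚ d) ⟩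
      X ^ₚ j *ₚ X ^ₚ m *ₚ (X ^ₚ d *ₚ X ^ₚ d) +ₚ X ^ₚ j *ₚ X ^ₚ m
        ≈⟨ +-cong (*-cong (≈-sym (^ₚ-+ X j m)) (≈-refl {X ^ₚ d *ₚ X ^ₚ d})) (≈-sym (^ₚ-+ X j m)) ⟩
      X ^ₚ M *ₚ (X ^ₚ d *ₚ X ^ₚ d) +ₚ X ^ₚ M ∎
    hom-diff : X ^ₚ d *ₚ hom M (T -ₚ C d) ≈ []
    hom-diff = begin
      X ^ₚ d *ₚ hom M (T -ₚ C d)
        ≈⟨ *-cong (≈-refl {X ^ₚ d}) (≈-trans (hom-+ M T (-ₚ C d)) (+-cong (≈-refl {hom M T}) (hom-neg M (C d)))) ⟩
      X ^ₚ d *ₚ (hom M T -ₚ hom M (C d))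
        ≈⟨ solve 3 (λ x a b → x :* (a :- b) := x :* a :- x :* b) ≈-refl (X ^ₚ d) (hom M T) (hom M (C d)) ⟩
      X ^ₚ d *ₚ hom M T -ₚ X ^ₚ d *ₚ hom M (C d)
        ≈⟨ +-cong hom-T (neg-cong (hom-C d M (ℕP.m≤m+n (suc d) m))) ⟩
      (X ^ₚ M *ₚ (X ^ₚ d *ₚ X ^ₚ d) +ₚ X ^ₚ M) -ₚ (X ^ₚ M *ₚ (X ^ₚ d *ₚ X ^ₚ d) +ₚ X ^ₚ M)
        ≈⟨ solve 1 (λ a → a :- a := con (+ 0)) ≈-refl (X ^ₚ M *ₚ (X ^ₚ d *ₚ X ^ₚ d) +ₚ X ^ₚ M) ⟩
      constP (+ 0)  ≈⟨ constP-0 ⟩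
      [] ∎
    diff≈0 : T -ₚ C d ≈ []
    diff≈0 = ≈ₚ⇒≈ (hom-injective M (T -ₚ C d)
      (length-+ₚ T (-ₚ C d) (ℕP.m≤n+m m j) (length-neg (C d) (ℕP.≤-trans (length-C d) (ℕP.m≤m+n j m))))
      (λ k _ → ≈⇒≈ₚ (X^-cancel d hom-diff) k))

  -- Products and composition of Chebyshev polynomials

  private
    C-product-step : ∀ d e → C (suc d) *ₚ C (2 ℕ.+ (d ℕ.+ e)) ≈ C (suc (d ℕ.+ (2 ℕ.+ (d ℕ.+ e)))) +ₚ C (suc e) →
      C d *ₚ C (2 ℕ.+ (d ℕ.+ e)) ≈ C (d ℕ.+ (2 ℕ.+ (d ℕ.+ e))) +ₚ C (2 ℕ.+ e) →
      C (2 ℕ.+ d) *ₚ C (2 ℕ.+ (d ℕ.+ e)) ≈ C (2 ℕ.+ (d ℕ.+ (2 ℕ.+ (d ℕ.+ e)))) +ₚ C e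
    C-product-step d e IH₁ IH₂ = begin
      C (2 ℕ.+ d) *ₚ C (2 ℕ.+ (d ℕ.+ e))
        ≈⟨ *-cong (C-rec d) (≈-refl {C (2 ℕ.+ (d ℕ.+ e))}) ⟩
      (X *ₚ C (suc d) -ₚ C d) *ₚ C (2 ℕ.+ (d ℕ.+ e))
        ≈⟨ solve 4 (λ x a b c → (x :* a :- b) :* c := x :* (a :* c) :- b :* c) ≈-refl X (C (suc d)) (C d) (C (2 ℕ.+ (d ℕ.+ e))) ⟩
      X *ₚ (C (suc d) *ₚ C (2 ℕ.+ (d ℕ.+ e))) -ₚ C d *ₚ C (2 ℕ.+ (d ℕ.+ e))
        ≈⟨ +-cong (*-cong (≈-refl {X}) IH₁) (neg-cong IH₂) ⟩
      X *ₚ (C (suc k) +ₚ C (suc e)) -ₚ (C k +ₚ C (2 ℕ.+ e))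
        ≈⟨ +-cong (≈-refl {X *ₚ (C (suc k) +ₚ C (suc e))}) (neg-cong (+-cong (≈-refl {C k}) (C-rec e))) ⟩
      X *ₚ (C (suc k) +ₚ C (suc e)) -ₚ (C k +ₚ (X *ₚ C (suc e) -ₚ C e))
        ≈⟨ solve 5 (λ x a b c d → x :* (a :+ b) :- (c :+ (x :* b :- d)) := x :* a :- c :+ d) ≈-refl X (C (suc k)) (C (suc e)) (C k) (C e) ⟩
      X *ₚ C (suc k) -ₚ C k +ₚ C e
        ≈⟨ +-cong (≈-sym (C-rec k)) (≈-refl {C e}) ⟩
      C (2 ℕ.+ k) +ₚ C e ∎
      where
      open SetoidReasoning setoid
      open Solver
      k = d ℕ.+ (2 ℕ.+ (d ℕ.+ e))

  -- At X = z + 1/z this expands (z^d + z^(-d)) (z^b + z^(-b)), with b written as d + e to avoid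
  -- subtraction. The induction keeps b fixed, so `e` grows by as much as `d` shrinks.
  C-product : ∀ d e → C d *ₚ C (d ℕ.+ e) ≈ C (d ℕ.+ (d ℕ.+ e)) +ₚ C e
  C-product zero e = solve 1 (λ c → con (+ 2) :* c := c :+ c) ≈-refl (C e)
    where open Solver
  C-product (suc zero) e = ≈-trans (solve 3 (λ x c b → x :* c := x :* c :- b :+ b) ≈-refl X (C (suc e)) (C e)) (+-cong (≈-sym (C-rec e)) (≈-refl {C e}))
    where open Solver
  C-product (suc (suc d)) e = C-product-step d e
    (subst (λ z → C (suc d) *ₚ C (suc z) ≈ C (suc (d ℕ.+ suc z)) +ₚ C (suc e)) (ℕP.+-suc d e) (C-product (suc d) (suc e)))
    (subst (λ z → C d *ₚ C z ≈ C (d ℕ.+ z) +ₚ C (2 ℕ.+ e)) (trans (ℕP.+-suc d (suc e)) (cong suc (ℕP.+-suc d e))) (C-product d (2 ℕ.+ e)))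

  ∘-zero : ∀ f g → f ≈ₚ [] → f ∘ₚ g ≈ []
  ∘-zero []      g e = ≈-refl
  ∘-zero (a ∷ f) g e = ≈-trans (+-cong (≡⇒≈ (cong constP (e 0))) (*-cong (≈-refl {g}) (≈-trans (∘-zero f g (λ k → e (suc k))) (≈-sym constP-0))))
    (≈-trans (solve 1 (λ g → con (+ 0) :+ g :* con (+ 0) := con (+ 0)) ≈-refl g) constP-0)
    where open Solver

  ∘-congˡ : ∀ f f' g → f ≈ₚ f' → f ∘ₚ g ≈ f' ∘ₚ g
  ∘-congˡ []      f'       g e = ≈-sym (∘-zero f' g (λ k → sym (e k)))
  ∘-congˡ (a ∷ f) []       g e = ∘-zero (a ∷ f) g e
  ∘-congˡ (a ∷ f) (b ∷ f') g e = +-cong (≡⇒≈ (cong constP (e 0))) (*-cong (≈-refl {g}) (∘-congˡ f f' g (λ k → e (suc k))))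

  ∘-congʳ : ∀ f {g g'} → g ≈ g' → f ∘ₚ g ≈ f ∘ₚ g'
  ∘-congʳ []      e = ≈-refl
  ∘-congʳ (a ∷ f) e = +-cong (≈-refl {constP a}) (*-cong e (∘-congʳ f e))

  ∘-+ : ∀ f f' g → (f +ₚ f') ∘ₚ g ≈ f ∘ₚ g +ₚ f' ∘ₚ g
  ∘-+ []      f'       g = ≈-refl
  ∘-+ (a ∷ f) []       g = ≈-sym (≈ₚ⇒≈ λ k → trans (coeff-+ ((a ∷ f) ∘ₚ g) [] k) (ℤP.+-identityʳ _))
  ∘-+ (a ∷ f) (b ∷ f') g = ≈-trans (+-cong (≈-refl {constP (a ℤ.+ b)}) (*-cong (≈-refl {g}) (∘-+ f f' g)))
    (solve 5 (λ a b g u v → (a :+ b) :+ g :* (u :+ v) := (a :+ g :* u) :+ (b :+ g :* v)) ≈-refl (constP a) (constP b) g (f ∘ₚ g) (f' ∘ₚ g))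
    where open Solver

  ∘-neg : ∀ f g → (-ₚ f) ∘ₚ g ≈ -ₚ (f ∘ₚ g)
  ∘-neg []      g = ≈-refl
  ∘-neg (a ∷ f) g = ≈-trans (+-cong (≈-refl {constP (- a)}) (*-cong (≈-refl {g}) (∘-neg f g)))
    (solve 3 (λ a g u → (:- a) :+ g :* (:- u) := :- (a :+ g :* u)) ≈-refl (constP a) g (f ∘ₚ g))
    where open Solver

  -- Composition with `C d` turns the recursion in m into the product formula, taken at e = m d.
  C-∘ : ∀ m d → C m ∘ₚ C d ≈ C (m ℕ.* d)
  C-∘ zero d = ≈-trans (+-cong (≈-refl {constP (+ 2)}) (*-zeroʳ (C d))) ≈-refl
  C-∘ (suc zero) d = begin
    constP (+ 0) +ₚ C d *ₚ (constP (+ 1) +ₚ C d *ₚ [])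
      ≈⟨ +-cong (≈-refl {constP (+ 0)}) (*-cong (≈-refl {C d}) (+-cong (≈-refl {constP (+ 1)}) (*-cong (≈-refl {C d}) (≈-sym constP-0)))) ⟩
    constP (+ 0) +ₚ C d *ₚ (constP (+ 1) +ₚ C d *ₚ constP (+ 0))
      ≈⟨ solve 1 (λ c → con (+ 0) :+ c :* (con (+ 1) :+ c :* con (+ 0)) := c) ≈-refl (C d) ⟩
    C d
      ≡⟨ cong C (sym (ℕP.+-identityʳ d)) ⟩
    C (d ℕ.+ 0) ∎
    where open SetoidReasoning setoid
          open Solver
  C-∘ (suc (suc m)) d = begin
    ((+ 0 ∷ C (suc m)) -ₚ C m) ∘ₚ C d
      ≈⟨ ≈-trans (∘-+ (+ 0 ∷ C (suc m)) (-ₚ C m) (C d)) (+-cong (≈-refl {(+ 0 ∷ C (suc m)) ∘ₚ C d}) (∘-neg (C m) (C d))) ⟩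
    constP (+ 0) +ₚ C d *ₚ (C (suc m) ∘ₚ C d) -ₚ C m ∘ₚ C d
      ≈⟨ +-cong (+-cong (≈-refl {constP (+ 0)}) (*-cong (≈-refl {C d}) (C-∘ (suc m) d))) (neg-cong (C-∘ m d)) ⟩
    constP (+ 0) +ₚ C d *ₚ C (d ℕ.+ m ℕ.* d) -ₚ C (m ℕ.* d)
      ≈⟨ +-cong (+-cong (≈-refl {constP (+ 0)}) (C-product d (m ℕ.* d))) (≈-refl { -ₚ C (m ℕ.* d)}) ⟩
    constP (+ 0) +ₚ (C (d ℕ.+ (d ℕ.+ m ℕ.* d)) +ₚ C (m ℕ.* d)) -ₚ C (m ℕ.* d)
      ≈⟨ solve 2 (λ a b → con (+ 0) :+ (a :+ b) :- b := a) ≈-refl (C (d ℕ.+ (d ℕ.+ m ℕ.* d))) (C (m ℕ.* d)) ⟩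
    C (d ℕ.+ (d ℕ.+ m ℕ.* d)) ∎
    where open SetoidReasoning setoid
          open Solver

  iter≈C : ∀ ℓ T → IsChebyshev ℓ T → ∀ n → iterₚ n T ≈ C (ℓ ℕ.^ n)
  iter≈C ℓ T cheb zero    = ≈-refl
  iter≈C ℓ T cheb (suc n) = ≈-trans (∘-congʳ T (iter≈C ℓ T cheb n))
    (≈-trans (∘-congˡ T (C ℓ) (C (ℓ ℕ.^ n)) (≈⇒≈ₚ (chebyshev-unique ℓ T cheb))) (C-∘ ℓ (ℓ ℕ.^ n)))

  -- W η m stands for (z^(m+1/2) - η z^(-m-1/2)) / (z^(1/2) - η z^(-1/2)) at X = z + 1/z:
  -- the square root of (C (2m+1) - 2η) / (X - 2η).

  W : ℤ → ℕ → Poly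
  W η zero          = constP (+ 1)
  W η (suc zero)    = X +ₚ constP η
  W η (suc (suc m)) = X *ₚ W η (suc m) -ₚ W η m

  constP-*-const : ∀ a b → constP a *ₚ constP b ≈ constP (a ℤ.* b)
  constP-*-const a b = ≈ₚ⇒≈ (constP-* a (constP b))

  constP-cong : ∀ {a b} → a ≡ b → constP a ≈ constP b
  constP-cong refl = ≈-refl

  deriv-linear : ∀ a → deriv (a ∷ + 1 ∷ []) ≈ constP (+ 1)
  deriv-linear a = ≈ₚ⇒≈ λ where
    zero          → refl
    (suc zero)    → refl
    (suc (suc k)) → refl

  module _ (η : ℤ) (η²≡1 : η ℤ.* η ≡ + 1) where

    private
      H = constP η
      two = constP (+ 2)
      V = W (- η)

      H² : H *ₚ H ≈ constP (+ 1)
      H² = ≈-trans (constP-*-const η η) (constP-cong η²≡1)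

    -- The quadratic form u² + v² - X u v is invariant under the recursion step from (u, v) to (v, X
    -- v - u), so its value at m = 0 persists.
    W-invariant : ∀ m → W η (suc m) *ₚ W η (suc m) +ₚ W η m *ₚ W η m -ₚ X *ₚ W η m *ₚ W η (suc m) ≈ two +ₚ H *ₚ X
    W-invariant zero = begin
      (X +ₚ H) *ₚ (X +ₚ H) +ₚ constP (+ 1) *ₚ constP (+ 1) -ₚ X *ₚ constP (+ 1) *ₚ (X +ₚ H)
        ≈⟨ solve 2 (λ x h → (x :+ h) :* (x :+ h) :+ con (+ 1) :* con (+ 1) :- x :* con (+ 1) :* (x :+ h) := h :* h :+ con (+ 1) :+ h :* x) ≈-refl X H ⟩
      H *ₚ H +ₚ constP (+ 1) +ₚ H *ₚ X
        ≈⟨ +-cong (+-cong H² (≈-refl {constP (+ 1)})) (≈-refl {H *ₚ X}) ⟩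
      two +ₚ H *ₚ X ∎
      where open SetoidReasoning setoid
            open Solver
    W-invariant (suc m) = ≈-trans
      (solve 3 (λ x u v → (x :* v :- u) :* (x :* v :- u) :+ v :* v :- x :* v :* (x :* v :- u) := v :* v :+ u :* u :- x :* u :* v) ≈-refl X (W η m) (W η (suc m)))
      (W-invariant m)
      where open Solver

    private
      -- The even index is the companion that closes the induction: the recursion of `C` passes
      -- through every index, while one step of `W` accounts for two. `W-invariant` then turns
      -- products of neighbours into the next square.
      C-odd-even : ∀ m → C (suc (m ℕ.* 2)) ≈ (X -ₚ two *ₚ H) *ₚ (W η m *ₚ W η m) +ₚ two *ₚ H
                       × C (suc (suc (m ℕ.* 2))) ≈ (X -ₚ two *ₚ H) *ₚ (W η m *ₚ W η (suc m)) +ₚ H *ₚ X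
      C-odd-even zero = solve 2 (λ x h → x := (x :- con (+ 2) :* h) :* (con (+ 1) :* con (+ 1)) :+ con (+ 2) :* h) ≈-refl X H , (begin
        C 2                               ≈⟨ C-rec 0 ⟩
        X *ₚ X -ₚ two                     ≈⟨ solve 1 (λ x → x :* x :- con (+ 2) := x :* x :- con (+ 2) :* con (+ 1)) ≈-refl X ⟩
        X *ₚ X -ₚ two *ₚ constP (+ 1)     ≈⟨ +-cong (≈-refl {X *ₚ X}) (neg-cong (*-cong (≈-refl {two}) (≈-sym H²))) ⟩
        X *ₚ X -ₚ two *ₚ (H *ₚ H)         ≈⟨ solve 2 (λ x h → x :* x :- con (+ 2) :* (h :* h) := (x :- con (+ 2) :* h) :* (con (+ 1) :* (x :+ h)) :+ h :* x) ≈-refl X H ⟩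
        (X -ₚ two *ₚ H) *ₚ (constP (+ 1) *ₚ (X +ₚ H)) +ₚ H *ₚ X ∎)
        where open SetoidReasoning setoid
              open Solver
      C-odd-even (suc m) with C-odd-even m
      ... | odd , even = odd' , even'
        where
        open SetoidReasoning setoid
        open Solver
        N = suc (m ℕ.* 2)
        u = W η m
        v = W η (suc m)
        K = X -ₚ two *ₚ H
        odd' : C (2 ℕ.+ N) ≈ K *ₚ (v *ₚ v) +ₚ two *ₚ H
        odd' = begin
          C (2 ℕ.+ N)                    ≈⟨ C-rec N ⟩
          X *ₚ C (suc N) -ₚ C N          ≈⟨ +-cong (*-cong (≈-refl {X}) even) (neg-cong odd) ⟩
          X *ₚ (K *ₚ (u *ₚ v) +ₚ H *ₚ X) -ₚ (K *ₚ (u *ₚ u) +ₚ two *ₚ H)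
            ≈⟨ solve 4 (λ x h u v → x :* ((x :- con (+ 2) :* h) :* (u :* v) :+ h :* x) :- ((x :- con (+ 2) :* h) :* (u :* u) :+ con (+ 2) :* h)
                  := (x :- con (+ 2) :* h) :* (v :* v) :- (x :- con (+ 2) :* h) :* (v :* v :+ u :* u :- x :* u :* v) :+ h :* x :* x :- con (+ 2) :* h) ≈-refl X H u v ⟩
          K *ₚ (v *ₚ v) -ₚ K *ₚ (v *ₚ v +ₚ u *ₚ u -ₚ X *ₚ u *ₚ v) +ₚ H *ₚ X *ₚ X -ₚ two *ₚ H
            ≈⟨ +-cong (+-cong (+-cong (≈-refl {K *ₚ (v *ₚ v)}) (neg-cong (*-cong (≈-refl {K}) (W-invariant m)))) (≈-refl {H *ₚ X *ₚ X})) (≈-refl { -ₚ (two *ₚ H)}) ⟩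
          K *ₚ (v *ₚ v) -ₚ K *ₚ (two +ₚ H *ₚ X) +ₚ H *ₚ X *ₚ X -ₚ two *ₚ H
            ≈⟨ solve 3 (λ x h w → (x :- con (+ 2) :* h) :* w :- (x :- con (+ 2) :* h) :* (con (+ 2) :+ h :* x) :+ h :* x :* x :- con (+ 2) :* h
                  := (x :- con (+ 2) :* h) :* w :+ (h :* h) :* (con (+ 2) :* x) :- con (+ 2) :* x :+ con (+ 2) :* h) ≈-refl X H (v *ₚ v) ⟩
          K *ₚ (v *ₚ v) +ₚ (H *ₚ H) *ₚ (two *ₚ X) -ₚ two *ₚ X +ₚ two *ₚ H
            ≈⟨ +-cong (+-cong (+-cong (≈-refl {K *ₚ (v *ₚ v)}) (*-cong H² (≈-refl {two *ₚ X}))) (≈-refl { -ₚ (two *ₚ X)})) (≈-refl {two *ₚ H}) ⟩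
          K *ₚ (v *ₚ v) +ₚ constP (+ 1) *ₚ (two *ₚ X) -ₚ two *ₚ X +ₚ two *ₚ H
            ≈⟨ solve 3 (λ w x h → w :+ con (+ 1) :* (con (+ 2) :* x) :- con (+ 2) :* x :+ con (+ 2) :* h := w :+ con (+ 2) :* h) ≈-refl (K *ₚ (v *ₚ v)) X H ⟩
          K *ₚ (v *ₚ v) +ₚ two *ₚ H ∎
        even' : C (3 ℕ.+ N) ≈ K *ₚ (v *ₚ (X *ₚ v -ₚ u)) +ₚ H *ₚ X
        even' = begin
          C (3 ℕ.+ N)                           ≈⟨ C-rec (suc N) ⟩
          X *ₚ C (2 ℕ.+ N) -ₚ C (suc N)         ≈⟨ +-cong (*-cong (≈-refl {X}) odd') (neg-cong even) ⟩
          X *ₚ (K *ₚ (v *ₚ v) +ₚ two *ₚ H) -ₚ (K *ₚ (u *ₚ v) +ₚ H *ₚ X)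
            ≈⟨ solve 5 (λ x h u v k → x :* (k :* (v :* v) :+ con (+ 2) :* h) :- (k :* (u :* v) :+ h :* x) := k :* (v :* (x :* v :- u)) :+ h :* x) ≈-refl X H u v K ⟩
          K *ₚ (v *ₚ (X *ₚ v -ₚ u)) +ₚ H *ₚ X ∎

    C-odd : ∀ m → C (suc (m ℕ.* 2)) ≈ (X -ₚ two *ₚ H) *ₚ (W η m *ₚ W η m) +ₚ two *ₚ H
    C-odd m = proj₁ (C-odd-even m)

    -- Both sides obey u₂ = X u₁ - u₀, so two base cases suffice. It ties `W η` to the conjugate
    -- family `W (- η)`, as the induction for `W-deriv` requires.
    W-conjugate : ∀ m → two *ₚ V (suc m) -ₚ X *ₚ V m ≈ (X -ₚ two *ₚ H) *ₚ W η m
    W-conjugate zero = solve 2 (λ x h → con (+ 2) :* (x :+ (:- h)) :- x :* con (+ 1) := (x :- con (+ 2) :* h) :* con (+ 1)) ≈-refl X H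
      where open Solver
    W-conjugate (suc zero) = begin
      two *ₚ (X *ₚ (X -ₚ H) -ₚ constP (+ 1)) -ₚ X *ₚ (X -ₚ H)
        ≈⟨ +-cong (*-cong (≈-refl {two}) (+-cong (≈-refl {X *ₚ (X -ₚ H)}) (neg-cong (≈-sym H²)))) (≈-refl { -ₚ (X *ₚ (X -ₚ H))}) ⟩
      two *ₚ (X *ₚ (X -ₚ H) -ₚ H *ₚ H) -ₚ X *ₚ (X -ₚ H)
        ≈⟨ solve 2 (λ x h → con (+ 2) :* (x :* (x :- h) :- h :* h) :- x :* (x :- h) := (x :- con (+ 2) :* h) :* (x :+ h)) ≈-refl X H ⟩
      (X -ₚ two *ₚ H) *ₚ (X +ₚ H) ∎
      where open SetoidReasoning setoid
            open Solver
    W-conjugate (suc (suc m)) = begin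
      two *ₚ (X *ₚ v₂ -ₚ v₁) -ₚ X *ₚ v₂
        ≡⟨⟩
      two *ₚ (X *ₚ (X *ₚ v₁ -ₚ v₀) -ₚ v₁) -ₚ X *ₚ (X *ₚ v₁ -ₚ v₀)
        ≈⟨ solve 3 (λ x v₁ v₀ → con (+ 2) :* (x :* (x :* v₁ :- v₀) :- v₁) :- x :* (x :* v₁ :- v₀)
              := x :* (con (+ 2) :* (x :* v₁ :- v₀) :- x :* v₁) :- (con (+ 2) :* v₁ :- x :* v₀)) ≈-refl X v₁ v₀ ⟩
      X *ₚ (two *ₚ v₂ -ₚ X *ₚ v₁) -ₚ (two *ₚ v₁ -ₚ X *ₚ v₀)
        ≈⟨ +-cong (*-cong (≈-refl {X}) (W-conjugate (suc m))) (neg-cong (W-conjugate m)) ⟩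
      X *ₚ (K *ₚ W η (suc m)) -ₚ K *ₚ W η m
        ≈⟨ solve 4 (λ x k a b → x :* (k :* a) :- k :* b := k :* (x :* a :- b)) ≈-refl X K (W η (suc m)) (W η m) ⟩
      K *ₚ (X *ₚ W η (suc m) -ₚ W η m) ∎
      where open SetoidReasoning setoid
            open Solver
            K = X -ₚ two *ₚ H
            v₀ = V m
            v₁ = V (suc m)
            v₂ = V (suc (suc m))

    -- Differentiating C_N = (X - 2 η) W² + 2 η for N = 2 m + 1 gives W (W + 2 (X - 2 η) W') = N W
    -- V, because the derivative of C_N is N (z^N - z^(-N)) / (z - z^(-1)) = N W V. The form with W
    -- cancelled is proved directly by the recursion, which avoids a division.
    W-deriv : ∀ m → W η m +ₚ two *ₚ (X -ₚ two *ₚ H) *ₚ deriv (W η m) ≈ constP (+ suc (m ℕ.* 2)) *ₚ V m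
    W-deriv zero = ≈-trans (+-cong (≈-refl {constP (+ 1)}) (*-cong (≈-refl {two *ₚ (X -ₚ two *ₚ H)}) constP-0))
      (≈-trans (+-cong (≈-refl {constP (+ 1)}) (≈-trans (*-zeroʳ (two *ₚ (X -ₚ two *ₚ H))) (≈-sym constP-0))) (≈ₚ⇒≈ λ { zero → refl ; (suc k) → refl }))
    W-deriv (suc zero) = ≈-trans (+-cong (≈-refl {X +ₚ H}) (*-cong (≈-refl {two *ₚ (X -ₚ two *ₚ H)}) (deriv-linear (+ 0 ℤ.+ η))))
      (solve 2 (λ x h → (x :+ h) :+ con (+ 2) :* (x :- con (+ 2) :* h) :* con (+ 1) := con (+ 3) :* (x :+ (:- h))) ≈-refl X H)
      where open Solver
    W-deriv (suc (suc m)) = begin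
      W η (2 ℕ.+ m) +ₚ two *ₚ K *ₚ deriv (W η (2 ℕ.+ m))
        ≈⟨ +-cong (≈-refl {W η (2 ℕ.+ m)}) (*-cong (≈-refl {two *ₚ K}) d) ⟩
      (X *ₚ w₁ -ₚ w₀) +ₚ two *ₚ K *ₚ (w₁ +ₚ X *ₚ deriv w₁ -ₚ deriv w₀)
        ≈⟨ solve 6 (λ x k w₁ w₀ d₁ d₀ → (x :* w₁ :- w₀) :+ con (+ 2) :* k :* (w₁ :+ x :* d₁ :- d₀)
              := x :* (w₁ :+ con (+ 2) :* k :* d₁) :- (w₀ :+ con (+ 2) :* k :* d₀) :+ con (+ 2) :* (k :* w₁)) ≈-refl X K w₁ w₀ (deriv w₁) (deriv w₀) ⟩
      X *ₚ (w₁ +ₚ two *ₚ K *ₚ deriv w₁) -ₚ (w₀ +ₚ two *ₚ K *ₚ deriv w₀) +ₚ two *ₚ (K *ₚ w₁)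
        -- Differentiating the recursion has left the extra term 2 K w₁, which `W-conjugate`
        -- expresses through `V`.
        ≈⟨ +-cong (+-cong (*-cong (≈-refl {X}) (W-deriv (suc m))) (neg-cong (W-deriv m))) (*-cong (≈-refl {two}) (≈-sym (W-conjugate (suc m)))) ⟩
      X *ₚ ((two +ₚ n) *ₚ V (suc m)) -ₚ n *ₚ V m +ₚ two *ₚ (two *ₚ (X *ₚ V (suc m) -ₚ V m) -ₚ X *ₚ V (suc m))
        ≈⟨ solve 4 (λ x n v₁ v₀ → x :* ((con (+ 2) :+ n) :* v₁) :- n :* v₀ :+ con (+ 2) :* (con (+ 2) :* (x :* v₁ :- v₀) :- x :* v₁)
              := (con (+ 2) :+ (con (+ 2) :+ n)) :* (x :* v₁ :- v₀)) ≈-refl X n (V (suc m)) (V m) ⟩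
      (two +ₚ (two +ₚ n)) *ₚ (X *ₚ V (suc m) -ₚ V m) ∎
      where
      open SetoidReasoning setoid
      open Solver
      K = X -ₚ two *ₚ H
      w₀ = W η m
      w₁ = W η (suc m)
      n = constP (+ suc (m ℕ.* 2))
      d : deriv (X *ₚ w₁ -ₚ w₀) ≈ w₁ +ₚ X *ₚ deriv w₁ -ₚ deriv w₀
      d = begin
        deriv (X *ₚ w₁ -ₚ w₀)              ≈⟨ deriv-+ (X *ₚ w₁) (-ₚ w₀) ⟩
        deriv (X *ₚ w₁) +ₚ deriv (-ₚ w₀)   ≈⟨ +-cong (deriv-* X w₁) (deriv-neg w₀) ⟩
        deriv X *ₚ w₁ +ₚ X *ₚ deriv w₁ -ₚ deriv w₀
          ≈⟨ +-cong (+-cong (*-cong (deriv-linear (+ 0)) (≈-refl {w₁})) (≈-refl {X *ₚ deriv w₁})) (≈-refl { -ₚ deriv w₀}) ⟩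
        constP (+ 1) *ₚ w₁ +ₚ X *ₚ deriv w₁ -ₚ deriv w₀
          ≈⟨ solve 3 (λ a b c → con (+ 1) :* a :+ b :- c := a :+ b :- c) ≈-refl w₁ (X *ₚ deriv w₁) (deriv w₀) ⟩
        w₁ +ₚ X *ₚ deriv w₁ -ₚ deriv w₀ ∎

  -- `L` can stay abstract: what matters later is that a nonzero constant is a combination of (A + 2
  -- K A')² and K A². It arises as N² times the difference of C_N + ε and C_N - ε.
  factorisation : ∀ ε η M → ε ≡ + 2 ℤ.* η → η ℤ.* η ≡ + 1 →
    let A = W η M
        K = - ε ∷ + 1 ∷ []
        N = + suc (M ℕ.* 2)
    in C (suc (M ℕ.* 2)) -ₚ constP ε ≈ K *ₚ (A *ₚ A)
     × (Σ Poly λ L → constP (+ 2 ℤ.* ε ℤ.* (N ℤ.* N)) ≈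
          L *ₚ ((A +ₚ constP (+ 2) *ₚ K *ₚ deriv A) *ₚ (A +ₚ constP (+ 2) *ₚ K *ₚ deriv A)) -ₚ constP (N ℤ.* N) *ₚ (K *ₚ (A *ₚ A)))
  factorisation _ η M refl η²≡1 = first , L , second
    where
    open SetoidReasoning setoid
    open Solver
    H = constP η
    two = constP (+ 2)
    ε = + 2 ℤ.* η
    K K' L : Poly
    K = - ε ∷ + 1 ∷ []
    K' = X -ₚ two *ₚ H
    L = X +ₚ two *ₚ H
    A = W η M
    B = W (- η) M
    N = + suc (M ℕ.* 2)
    n = constP N
    2H≈ : two *ₚ H ≈ constP ε
    2H≈ = constP-*-const (+ 2) η
    K'≈K : K' ≈ K
    K'≈K = ≈-trans (+-cong (≈-refl {X}) (neg-cong 2H≈)) (≈ₚ⇒≈ λ { zero → ℤP.+-identityˡ (- ε) ; (suc k) → refl })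
    odd : C (suc (M ℕ.* 2)) ≈ K *ₚ (A *ₚ A) +ₚ two *ₚ H
    odd = ≈-trans (C-odd η η²≡1 M) (+-cong (*-cong K'≈K (≈-refl {A *ₚ A})) (≈-refl {two *ₚ H}))
    first : C (suc (M ℕ.* 2)) -ₚ constP ε ≈ K *ₚ (A *ₚ A)
    first = begin
      C (suc (M ℕ.* 2)) -ₚ constP ε              ≈⟨ +-cong odd (neg-cong (≈-sym 2H≈)) ⟩
      K *ₚ (A *ₚ A) +ₚ two *ₚ H -ₚ two *ₚ H      ≈⟨ solve 2 (λ a b → a :+ b :- b := a) ≈-refl (K *ₚ (A *ₚ A)) (two *ₚ H) ⟩
      K *ₚ (A *ₚ A)                              ∎
    deriv-A : A +ₚ two *ₚ K *ₚ deriv A ≈ n *ₚ B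
    deriv-A = ≈-trans (+-cong (≈-refl {A}) (*-cong (*-cong (≈-refl {two}) (≈-sym K'≈K)) (≈-refl {deriv A}))) (W-deriv η η²≡1 M)
    odd' : C (suc (M ℕ.* 2)) ≈ L *ₚ (B *ₚ B) -ₚ two *ₚ H
    odd' = ≈-trans (C-odd (- η) (trans (ℤ-Solver.solve 1 (λ x → (ℤ-Solver.:- x) ℤ-Solver.:* (ℤ-Solver.:- x) ℤ-Solver.:= x ℤ-Solver.:* x) refl η) η²≡1) M)
      (solve 3 (λ x h b → (x :- con (+ 2) :* (:- h)) :* b :+ con (+ 2) :* (:- h) := (x :+ con (+ 2) :* h) :* b :- con (+ 2) :* h) ≈-refl X H (B *ₚ B))
    second : constP (+ 2 ℤ.* ε ℤ.* (N ℤ.* N)) ≈ L *ₚ ((A +ₚ two *ₚ K *ₚ deriv A) *ₚ (A +ₚ two *ₚ K *ₚ deriv A)) -ₚ constP (N ℤ.* N) *ₚ (K *ₚ (A *ₚ A))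
    second = begin
      constP (+ 2 ℤ.* ε ℤ.* (N ℤ.* N))
        ≈⟨ constP-*-const (+ 2 ℤ.* ε) (N ℤ.* N) ⟨
      constP (+ 2 ℤ.* ε) *ₚ constP (N ℤ.* N)
        ≈⟨ *-cong (≈-trans (≈-sym (constP-*-const (+ 2) ε)) (*-cong (≈-refl {two}) (≈-sym 2H≈))) (≈-sym (constP-*-const N N)) ⟩
      two *ₚ (two *ₚ H) *ₚ (n *ₚ n)
        ≈⟨ solve 5 (λ h n l b c → con (+ 2) :* (con (+ 2) :* h) :* (n :* n) := n :* n :* ((c :+ con (+ 2) :* h) :- (c :- con (+ 2) :* h))) ≈-refl H n L B (C (suc (M ℕ.* 2))) ⟩
      n *ₚ n *ₚ ((C (suc (M ℕ.* 2)) +ₚ two *ₚ H) -ₚ (C (suc (M ℕ.* 2)) -ₚ two *ₚ H))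
        ≈⟨ *-cong (≈-refl {n *ₚ n}) (+-cong (+-cong odd' (≈-refl {two *ₚ H})) (neg-cong (+-cong odd (≈-refl { -ₚ (two *ₚ H)})))) ⟩
      n *ₚ n *ₚ ((L *ₚ (B *ₚ B) -ₚ two *ₚ H +ₚ two *ₚ H) -ₚ (K *ₚ (A *ₚ A) +ₚ two *ₚ H -ₚ two *ₚ H))
        ≈⟨ solve 5 (λ h n l b a → n :* n :* ((l :* (b :* b) :- con (+ 2) :* h :+ con (+ 2) :* h) :- (a :+ con (+ 2) :* h :- con (+ 2) :* h))
              := l :* ((n :* b) :* (n :* b)) :- n :* n :* a) ≈-refl H n L B (K *ₚ (A *ₚ A)) ⟩
      L *ₚ ((n *ₚ B) *ₚ (n *ₚ B)) -ₚ n *ₚ n *ₚ (K *ₚ (A *ₚ A))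
        ≈⟨ +-cong (*-cong (≈-refl {L}) (*-cong (≈-sym deriv-A) (≈-sym deriv-A))) (neg-cong (*-cong (constP-*-const N N) (≈-refl {K *ₚ (A *ₚ A)}))) ⟩
      L *ₚ ((A +ₚ two *ₚ K *ₚ deriv A) *ₚ (A +ₚ two *ₚ K *ₚ deriv A)) -ₚ constP (N ℤ.* N) *ₚ (K *ₚ (A *ₚ A)) ∎

-- Divisors modulo q

module Divisibility (q : ℕ) where
  open ModRing q

  ∣-respʳ : ∀ {φ f g} → f ≈ g → φ ∣[ q ] f → φ ∣[ q ] g
  ∣-respʳ e (divides h e') = divides h (≈-trans (≈-sym e) e')

  ∣-add : ∀ {φ f g} → φ ∣[ q ] f → φ ∣[ q ] g → φ ∣[ q ] f +ₚ g
  ∣-add {φ} (divides h e) (divides h' e') = divides (h +ₚ h') (≈-trans (+-cong e e') (solve 3 (λ φ h h' → φ :* h :+ φ :* h' := φ :* (h :+ h')) ≈-refl φ h h'))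
    where open Solver

  ∣-minus : ∀ {φ f g} → φ ∣[ q ] f → φ ∣[ q ] g → φ ∣[ q ] f -ₚ g
  ∣-minus {φ} (divides h e) (divides h' e') = divides (h -ₚ h') (≈-trans (+-cong e (neg-cong e')) (solve 3 (λ φ h h' → φ :* h :- φ :* h' := φ :* (h :- h')) ≈-refl φ h h'))
    where open Solver

  ∣-mulʳ : ∀ {φ f} g → φ ∣[ q ] f → φ ∣[ q ] f *ₚ g
  ∣-mulʳ {φ} g (divides h e) = divides (h *ₚ g) (≈-trans (*-cong e (≈-refl {g})) (solve 3 (λ φ h g → (φ :* h) :* g := φ :* (h :* g)) ≈-refl φ h g))
    where open Solver

  ∣-mulˡ : ∀ {φ f} g → φ ∣[ q ] f → φ ∣[ q ] g *ₚ f
  ∣-mulˡ {φ} {f} g d = ∣-respʳ (*-comm f g) (∣-mulʳ g d)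

  prodFin-∣ : ∀ r ψ i → ψ i ∣[ q ] prodFin r ψ
  prodFin-∣ (suc r) ψ zero    = divides (prodFin r (λ i → ψ (suc i))) ≈-refl
  prodFin-∣ (suc r) ψ (suc i) = ∣-mulˡ (ψ zero) (prodFin-∣ r (λ i → ψ (suc i)) i)

-- Developments

nth-degLt : ∀ {d as} → All (λ a → length (strip a) ≤ d) as → ∀ j → DegLt d (nth as j)
nth-degLt []                 j       = λ k _ → refl
nth-degLt (_∷_ {x = a} l ls) zero    = strip-degLt a _ l
nth-degLt (l ∷ ls)           (suc j) = nth-degLt ls j

-- Phrased with `nth` and `drop`, so that a list too short to have a digit counts as having the
-- digit zero; later arguments need no case split on its length.
devSum-step : ∀ q φ as → devSum φ as ≈[ q ] nth as 0 +ₚ φ *ₚ devSum φ (drop 1 as)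
devSum-step q φ []       = ModRing.≈-sym q (ModRing.*-zeroʳ q φ)
devSum-step q φ (a ∷ as) = ModRing.≈-refl q

nth-drop : ∀ as j → nth (drop 1 as) j ≡ nth as (suc j)
nth-drop []       j = refl
nth-drop (a ∷ as) j = refl

devSum-two : ∀ q φ as → devSum φ as ≈[ q ] nth as 0 +ₚ φ *ₚ (nth as 1 +ₚ φ *ₚ devSum φ (drop 1 (drop 1 as)))
devSum-two q φ as = ≈-trans (devSum-step q φ as) (+-cong (≈-refl {nth as 0}) (*-cong (≈-refl {φ})
    (subst (λ b → devSum φ (drop 1 as) ≈ b +ₚ φ *ₚ devSum φ (drop 1 (drop 1 as))) (nth-drop as 0) (devSum-step q φ (drop 1 as)))))
  where open ModRing q

devSum-three : ∀ q φ as → devSum φ as ≈[ q ] nth as 0 +ₚ φ *ₚ (nth as 1 +ₚ φ *ₚ (nth as 2 +ₚ φ *ₚ devSum φ (drop 1 (drop 1 (drop 1 as)))))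
devSum-three q φ as = ≈-trans (devSum-step q φ as) (+-cong (≈-refl {nth as 0}) (*-cong (≈-refl {φ})
    (subst (λ b → devSum φ (drop 1 as) ≈ b) eq (devSum-two q φ (drop 1 as)))))
  where
  open ModRing q
  eq = cong₂ (λ b c → b +ₚ φ *ₚ (c +ₚ φ *ₚ devSum φ (drop 1 (drop 1 (drop 1 as))))) (nth-drop as 0) (nth-drop as 1)

degLt-minus-const : ∀ {d f} c → DegLt (suc d) f → DegLt (suc d) (f -ₚ constP c)
degLt-minus-const {d} {f} c l (suc k) d<k = trans (coeff-+ f (constP (- c)) (suc k)) (cong (ℤ._+ + 0) (l (suc k) d<k))

-- Modulo q, f is c + φ² K G², so uniqueness of the remainder, applied twice, gives a₀ ≡ c and a₁ ≡
-- 0. As K G² is not reduced modulo φ, the digit a₂ is determined here only up to a multiple of φ.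
module _ {q d : ℕ} {φ : Poly} {as : List Poly} {K G : Poly} {c : ℤ} {f : Poly} (md : MonicDeg (suc d) φ) (small : ∀ j → DegLt (suc d) (nth as j))
         (dev : f ≈[ q ] devSum φ as) (f≈ : f ≈[ q ] K *ₚ ((φ *ₚ G) *ₚ (φ *ₚ G)) +ₚ constP c) where
  open ModRing q

  private
    a₀ = nth as 0
    a₁ = nth as 1
    a₂ = nth as 2
    R = devSum φ (drop 1 (drop 1 (drop 1 as)))
    t₂ = a₂ +ₚ φ *ₚ R -ₚ K *ₚ (G *ₚ G)

    vanish : (a₀ -ₚ constP c) +ₚ φ *ₚ (a₁ +ₚ φ *ₚ t₂) ≈ []
    vanish = begin
      (a₀ -ₚ constP c) +ₚ φ *ₚ (a₁ +ₚ φ *ₚ (a₂ +ₚ φ *ₚ R -ₚ K *ₚ (G *ₚ G)))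
        ≈⟨ solve 6 (λ a₀ c φ a₁ u w → (a₀ :- c) :+ φ :* (a₁ :+ φ :* (u :- w)) := (a₀ :+ φ :* (a₁ :+ φ :* u)) :- (φ :* φ :* w :+ c))
             ≈-refl a₀ (constP c) φ a₁ (a₂ +ₚ φ *ₚ R) (K *ₚ (G *ₚ G)) ⟩
      (a₀ +ₚ φ *ₚ (a₁ +ₚ φ *ₚ (a₂ +ₚ φ *ₚ R))) -ₚ (φ *ₚ φ *ₚ (K *ₚ (G *ₚ G)) +ₚ constP c)
        ≈⟨ +-cong (≈-refl {a₀ +ₚ φ *ₚ (a₁ +ₚ φ *ₚ (a₂ +ₚ φ *ₚ R))}) (neg-cong (+-cong (solve 3 (λ φ K G → φ :* φ :* (K :* (G :* G)) := K :* ((φ :* G) :* (φ :* G))) ≈-refl φ K G) (≈-refl {constP c}))) ⟩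
      (a₀ +ₚ φ *ₚ (a₁ +ₚ φ *ₚ (a₂ +ₚ φ *ₚ R))) -ₚ (K *ₚ ((φ *ₚ G) *ₚ (φ *ₚ G)) +ₚ constP c)
        ≈⟨ +-cong (≈-trans (≈-sym (devSum-three q φ as)) (≈-sym dev)) (neg-cong (≈-sym f≈)) ⟩
      f -ₚ f  ≈⟨ solve 1 (λ f → f :- f := con (+ 0)) ≈-refl f ⟩
      constP (+ 0)  ≈⟨ constP-0 ⟩
      [] ∎
      where open SetoidReasoning setoid
            open Solver
    first = remainder-unique md (a₁ +ₚ φ *ₚ t₂) (degLt-minus-const {f = a₀} c (small 0)) vanish
    second = remainder-unique md t₂ (small 1) (proj₂ first)

  digit₀ : nth as 0 ≈ constP c
  digit₀ = ≈-trans (solve 2 (λ a c → a := (a :- c) :+ c) ≈-refl a₀ (constP c))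
             (≈-trans (+-cong (≈-trans (proj₁ first) (≈-sym constP-0)) (≈-refl {constP c})) (solve 1 (λ c → con (+ 0) :+ c := c) ≈-refl (constP c)))
    where open Solver

  digit₁ : nth as 1 ≈ []
  digit₁ = proj₁ second

  digit₂ : Σ Poly λ h → nth as 2 ≈ K *ₚ (G *ₚ G) -ₚ φ *ₚ h
  digit₂ = R , ≈-trans (solve 3 (λ a u k → a := (a :+ u :- k) :+ (k :- u)) ≈-refl a₂ (φ *ₚ R) (K *ₚ (G *ₚ G)))
             (≈-trans (+-cong (≈-trans (proj₂ second) (≈-sym constP-0)) (≈-refl {K *ₚ (G *ₚ G) -ₚ φ *ₚ R})) (solve 1 (λ c → con (+ 0) :+ c := c) ≈-refl (K *ₚ (G *ₚ G) -ₚ φ *ₚ R)))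
    where open Solver

-- Simple factors of A modulo p

module Separable {p : ℕ} (pp : Prime p) (A K L : Poly) (c e : ℤ)
  (a : ℤ) (K-linear : K ≡ a ∷ + 1 ∷ [])
  (discriminant : constP c ≈[ 0 ] L *ₚ ((A +ₚ constP (+ 2) *ₚ K *ₚ deriv A) *ₚ (A +ₚ constP (+ 2) *ₚ K *ₚ deriv A)) -ₚ constP e *ₚ (K *ₚ (A *ₚ A)))
  (p∤c : ¬ ((+ p) ℤD.∣ c)) where

  open ModRing p
  open ModPrime pp
  open Divisibility p

  G : Poly
  G = A +ₚ constP (+ 2) *ₚ K *ₚ deriv A

  deriv-K : deriv K ≈ constP (+ 1)
  deriv-K = subst (λ k → deriv k ≈ constP (+ 1)) (sym K-linear) (≈₀⇒≈ (deriv-linear a))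

  module _ {d : ℕ} {φ : Poly} (md : MonicDeg (suc d) φ) where

    -- The discriminant identity enters here: a common divisor of G² and K A² would divide the unit
    -- c. The exclusions below all come down to exhibiting such a common divisor.
    ∤-both : φ ∣[ p ] G *ₚ G → φ ∣[ p ] K *ₚ (A *ₚ A) → ⊥
    ∤-both φ∣GG φ∣KAA = p∤c (nonconstant∤unit md (∣-respʳ (≈-sym (≈₀⇒≈ discriminant)) (∣-minus (∣-mulˡ L φ∣GG) (∣-mulˡ (constP e) φ∣KAA))))

    ∤K-and-A² : φ ∣[ p ] K → φ ∣[ p ] A *ₚ A → ⊥
    ∤K-and-A² φ∣K φ∣AA = ∤-both
      (∣-respʳ (solve 3 (λ a k a' → a :* a :+ k :* (con (+ 4) :* a :* a' :+ con (+ 4) :* k :* a' :* a') := (a :+ con (+ 2) :* k :* a') :* (a :+ con (+ 2) :* k :* a')) ≈-refl A K (deriv A))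
        (∣-add φ∣AA (∣-mulʳ (constP (+ 4) *ₚ A *ₚ deriv A +ₚ constP (+ 4) *ₚ K *ₚ deriv A *ₚ deriv A) φ∣K)))
      (∣-mulʳ (A *ₚ A) φ∣K)
      where open Solver

    -- A repeated factor of A divides A' as well, hence also G = A + 2 K A'.
    square∤A : ∀ {g} → A ≈ φ *ₚ g → φ ∣[ p ] g → ⊥
    square∤A {g} A≈φg (divides h g≈φh) = ∤-both (∣-mulʳ G φ∣G) (∣-mulˡ K (∣-mulʳ A φ∣A))
      where
      φ∣A : φ ∣[ p ] A
      φ∣A = divides g A≈φg
      A≈ : A ≈ φ *ₚ (φ *ₚ h)
      A≈ = ≈-trans A≈φg (*-cong (≈-refl {φ}) g≈φh)
      φ∣A' : φ ∣[ p ] deriv A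
      φ∣A' = ∣-respʳ (≈-sym (≈-trans (deriv-cong A≈) (deriv-* φ (φ *ₚ h))))
        (∣-add (∣-mulˡ (deriv φ) (divides h (≈-refl {φ *ₚ h}))) (divides (deriv (φ *ₚ h)) ≈-refl))
      φ∣G : φ ∣[ p ] G
      φ∣G = ∣-add φ∣A (∣-mulˡ (constP (+ 2) *ₚ K) φ∣A')

    -- (K A²)' = A G
    square∣KA²⇒∣A : IrredModP p φ → φ *ₚ φ ∣[ p ] K *ₚ (A *ₚ A) → φ ∣[ p ] A
    -- As φ² divides K A², φ divides the derivative A G. If φ did not divide A, it would be coprime
    -- to A and so divide G.
    square∣KA²⇒∣A irr (divides h eq) = [ (λ d → d) , (λ cop → ⊥-elim (∤-both (∣-mulʳ G (coprime-divisor G cop φ∣AG)) φ∣KAA)) ]′ (divides-or-coprime md irr A)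
      where
      open Solver
      φφh≈ : (φ *ₚ φ) *ₚ h ≈ φ *ₚ (φ *ₚ h)
      φφh≈ = solve 2 (λ φ h → (φ :* φ) :* h := φ :* (φ :* h)) ≈-refl φ h
      φ∣KAA : φ ∣[ p ] K *ₚ (A *ₚ A)
      φ∣KAA = divides (φ *ₚ h) (≈-trans eq φφh≈)
      derivKAA : deriv (K *ₚ (A *ₚ A)) ≈ A *ₚ G
      derivKAA = begin
        deriv (K *ₚ (A *ₚ A))  ≈⟨ deriv-* K (A *ₚ A) ⟩
        deriv K *ₚ (A *ₚ A) +ₚ K *ₚ deriv (A *ₚ A)
          ≈⟨ +-cong (*-cong deriv-K (≈-refl {A *ₚ A})) (*-cong (≈-refl {K}) (deriv-* A A)) ⟩
        constP (+ 1) *ₚ (A *ₚ A) +ₚ K *ₚ (deriv A *ₚ A +ₚ A *ₚ deriv A)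
          ≈⟨ solve 3 (λ a k a' → con (+ 1) :* (a :* a) :+ k :* (a' :* a :+ a :* a') := a :* (a :+ con (+ 2) :* k :* a')) ≈-refl A K (deriv A) ⟩
        A *ₚ G ∎
        where open SetoidReasoning setoid
      φ∣AG : φ ∣[ p ] A *ₚ G
      φ∣AG = ∣-respʳ (≈-trans (≈-sym (≈-trans (deriv-cong (≈-trans eq φφh≈)) (deriv-* φ (φ *ₚ h)))) derivKAA)
        (∣-add (∣-mulˡ (deriv φ) (divides h (≈-refl {φ *ₚ h}))) (divides (deriv (φ *ₚ h)) ≈-refl))

    simple-factor : IrredModP p φ → φ *ₚ φ ∣[ p ] K *ₚ (A *ₚ A) → Σ Poly λ g → A ≈ φ *ₚ g × Coprimeₚ φ g
    simple-factor irr φφ∣ =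
      let divides g A≈φg = square∣KA²⇒∣A irr φφ∣ in g , A≈φg , [ (λ φ∣g → ⊥-elim (square∤A A≈φg φ∣g)) , (λ cop → cop) ]′ (divides-or-coprime md irr g)

    -- Being coprime to g, φ would have to divide K, which is excluded because φ also divides A.
    -- Modulo p and φ the digit a₂ is K g², so this is the source of ν(a₂) = 0.
    ∤K*g² : ∀ {g} → A ≈ φ *ₚ g → Coprimeₚ φ g → φ ∣[ p ] K *ₚ (g *ₚ g) → ⊥
    ∤K*g² {g} A≈φg cop d = ∤K-and-A² φ∣K (∣-mulʳ A (divides g A≈φg))
      where
      open Solver
      φ∣K : φ ∣[ p ] K
      φ∣K = coprime-divisor K cop (coprime-divisor (g *ₚ K) cop (∣-respʳ (solve 2 (λ k g → k :* (g :* g) := g :* (g :* k)) ≈-refl K g) d))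

  K-monic : MonicDeg 1 K
  K-monic = subst (MonicDeg 1) (sym K-linear) (monicDeg refl λ { (suc zero) (s≤s ()) ; (suc (suc k)) _ → refl })

  K∤A² : ¬ (K ∣[ p ] A *ₚ A)
  K∤A² = ∤K-and-A² K-monic (divides (constP (+ 1)) (solve 1 (λ k → k := k :* con (+ 1)) ≈-refl K))
    where open Solver

  -- Modulo p, f = K A² forces a₁ ≡ A² up to a multiple of K, so a vanishing a₁ would make K divide
  -- A².
  linear-digit₁≉0 : ∀ {f as} → (∀ j → DegLt 1 (nth as j)) → f ≈ devSum K as → f ≈ K *ₚ (A *ₚ A) → ¬ (nth as 1 ≈ [])
  linear-digit₁≉0 {f} {as} small dev f≈ a₁≈0 = K∤A² (divides R (begin
      A *ₚ A                                   ≈⟨ solve 2 (λ A u → A := u :- (u :- A)) ≈-refl (A *ₚ A) (a₁ +ₚ K *ₚ R) ⟩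
      (a₁ +ₚ K *ₚ R) -ₚ (a₁ +ₚ K *ₚ R -ₚ A *ₚ A) ≈⟨ +-cong (+-cong (≈-trans a₁≈0 (≈-sym constP-0)) (≈-refl {K *ₚ R})) (neg-cong (≈-trans (proj₂ (remainder-unique K-monic (a₁ +ₚ K *ₚ R -ₚ A *ₚ A) (small 0) vanish)) (≈-sym constP-0))) ⟩
      (constP (+ 0) +ₚ K *ₚ R) -ₚ constP (+ 0) ≈⟨ solve 1 (λ u → con (+ 0) :+ u :- con (+ 0) := u) ≈-refl (K *ₚ R) ⟩
      K *ₚ R ∎))
    where
    open SetoidReasoning setoid
    open Solver
    a₀ = nth as 0
    a₁ = nth as 1
    R = devSum K (drop 1 (drop 1 as))
    vanish : a₀ +ₚ K *ₚ (a₁ +ₚ K *ₚ R -ₚ A *ₚ A) ≈ []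
    vanish = begin
      a₀ +ₚ K *ₚ (a₁ +ₚ K *ₚ R -ₚ A *ₚ A)                ≈⟨ solve 4 (λ a k u v → a :+ k :* (u :- v) := (a :+ k :* u) :- k :* v) ≈-refl a₀ K (a₁ +ₚ K *ₚ R) (A *ₚ A) ⟩
      (a₀ +ₚ K *ₚ (a₁ +ₚ K *ₚ R)) -ₚ K *ₚ (A *ₚ A)       ≈⟨ +-cong (≈-trans (≈-sym (devSum-two p K as)) (≈-sym dev)) (neg-cong (≈-sym f≈)) ⟩
      f -ₚ f  ≈⟨ solve 1 (λ f → f :- f := con (+ 0)) ≈-refl f ⟩
      constP (+ 0)  ≈⟨ constP-0 ⟩
      [] ∎

-- Order on ℚ through differences

p≤q⇒0≤q-p : ∀ {p q} → p ℚ.≤ q → 0ℚ ℚ.≤ q ℚ.- p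
p≤q⇒0≤q-p {p} {q} l = subst (ℚ._≤ q ℚ.- p) (ℚP.+-inverseʳ p) (ℚP.+-monoˡ-≤ (ℚ.- p) l)

0≤q-p⇒p≤q : ∀ {p q} → 0ℚ ℚ.≤ q ℚ.- p → p ℚ.≤ q
0≤q-p⇒p≤q {p} {q} l = subst₂ ℚ._≤_ (ℚP.+-identityˡ p) (solve 2 (λ p q → q :- p :+ p := q) refl p q) (ℚP.+-monoˡ-≤ p l)
  where open ℚ-Solver

p<q⇒0<q-p : ∀ {p q} → p ℚ.< q → 0ℚ ℚ.< q ℚ.- p
p<q⇒0<q-p {p} {q} l = subst (ℚ._< q ℚ.- p) (ℚP.+-inverseʳ p) (ℚP.+-monoˡ-< (ℚ.- p) l)

0≤p*q : ∀ {p q} → 0ℚ ℚ.≤ p → 0ℚ ℚ.≤ q → 0ℚ ℚ.≤ p ℚ.* q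
0≤p*q {p} {q} 0≤p 0≤q = ℚP.nonNegative⁻¹ _ {{ℚP.nonNeg*nonNeg⇒nonNeg p {{ℚ.nonNegative 0≤p}} q {{ℚ.nonNegative 0≤q}}}}

0≤p+q : ∀ {p q} → 0ℚ ℚ.≤ p → 0ℚ ℚ.≤ q → 0ℚ ℚ.≤ p ℚ.+ q
0≤p+q 0≤p 0≤q = ℚP.+-mono-≤ 0≤p 0≤q

2q≤2p⇒q≤p : ∀ {p q} → ℕ→ℚ 2 ℚ.* q ℚ.≤ ℕ→ℚ 2 ℚ.* p → q ℚ.≤ p
2q≤2p⇒q≤p = ℚP.*-cancelˡ-≤-pos (ℕ→ℚ 2)

-- `ℚ._/_` divides by a gcd and does not reduce for a variable `n`; the explicit fraction exposes
-- numerator and denominator to the order lemmas.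
ℕ→ℚ-mk : ∀ n → ℕ→ℚ n ≡ ℚ.mkℚ (+ n) 0 (Coprimality.sym (1-coprimeTo n))
ℕ→ℚ-mk n = ℚP.normalize-coprime _

ℕ→ℚ-mono : ∀ {m n} → m ≤ n → ℕ→ℚ m ℚ.≤ ℕ→ℚ n
ℕ→ℚ-mono {m} {n} l = subst₂ ℚ._≤_ (sym (ℕ→ℚ-mk m)) (sym (ℕ→ℚ-mk n)) (ℚ.*≤* (ℤP.*-monoʳ-≤-nonNeg (+ 1) (ℤ.+≤+ l)))

ℕ→ℚ-cancel : ∀ {m n} → ℕ→ℚ m ℚ.≤ ℕ→ℚ n → m ≤ n
ℕ→ℚ-cancel {m} {n} l = ℤP.drop‿+≤+ (ℤP.*-cancelʳ-≤-pos (+ m) (+ n) (+ 1) (ℚP.drop-*≤* (subst₂ ℚ._≤_ (ℕ→ℚ-mk m) (ℕ→ℚ-mk n) l)))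

ℕ→ℚ-+ : ∀ m n → ℕ→ℚ (m ℕ.+ n) ≡ ℕ→ℚ m ℚ.+ ℕ→ℚ n
ℕ→ℚ-+ m n = sym (trans (cong₂ ℚ._+_ (ℕ→ℚ-mk m) (ℕ→ℚ-mk n)) (cong (λ z → z ℚ./ 1) (cong₂ ℤ._+_ (ℤP.*-identityʳ (+ m)) (ℤP.*-identityʳ (+ n)))))

ℕ→ℚ-* : ∀ m n → ℕ→ℚ (m ℕ.* n) ≡ ℕ→ℚ m ℚ.* ℕ→ℚ n
ℕ→ℚ-* zero    n = sym (ℚP.*-zeroˡ (ℕ→ℚ n))
ℕ→ℚ-* (suc m) n = trans (ℕ→ℚ-+ n (m ℕ.* n)) (trans (cong (ℕ→ℚ n ℚ.+_) (ℕ→ℚ-* m n))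
  (trans (solve 2 (λ m n → n :+ m :* n := (con 1ℚ :+ m) :* n) refl (ℕ→ℚ m) (ℕ→ℚ n)) (cong (ℚ._* ℕ→ℚ n) (sym (ℕ→ℚ-+ 1 m)))))
  where open ℚ-Solver

0≤ℕ→ℚ : ∀ n → 0ℚ ℚ.≤ ℕ→ℚ n
0≤ℕ→ℚ n = ℕ→ℚ-mono {0} {n} z≤n

-- Convex hulls of clouds

Weighted : Set
Weighted = ℕ × ℕ × ℚ

weights abscissae ordinates : List Weighted → ℚ
weights   L = sumℚ (map (λ { (j , u , w) → w }) L)
abscissae L = sumℚ (map (λ { (j , u , w) → w ℚ.* ℕ→ℚ j }) L)
ordinates L = sumℚ (map (λ { (j , u , w) → w ℚ.* ℕ→ℚ u }) L)

module _ {P : Cloud} where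

  -- A half-plane is convex. The induction runs through tails of the list, whose weights need not
  -- sum to 1, so γ is carried with the total weight as a factor and `S₀` is applied at the end.
  hull-halfplane : ∀ α β γ → (∀ j u → P j u → γ ℚ.≤ α ℚ.* ℕ→ℚ j ℚ.+ β ℚ.* ℕ→ℚ u) →
                   ∀ {x y} → InHull P x y → γ ℚ.≤ α ℚ.* x ℚ.+ β ℚ.* y
  hull-halfplane α β γ bound {x} {y} (L , adm , S₀ , S₁ , S₂) =
    subst₂ (λ x y → γ ℚ.≤ α ℚ.* x ℚ.+ β ℚ.* y) S₁ S₂
      (0≤q-p⇒p≤q (subst (λ z → 0ℚ ℚ.≤ α ℚ.* abscissae L ℚ.+ β ℚ.* ordinates L ℚ.- z)
        (trans (cong (γ ℚ.*_) S₀) (ℚP.*-identityʳ γ)) (go L adm)))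
    where
    go : ∀ L → All _ L → 0ℚ ℚ.≤ α ℚ.* abscissae L ℚ.+ β ℚ.* ordinates L ℚ.- γ ℚ.* weights L
    go [] [] = ℚP.≤-reflexive (solve 3 (λ α β γ → con 0ℚ := α :* con 0ℚ :+ β :* con 0ℚ :- γ :* con 0ℚ) refl α β γ)
      where open ℚ-Solver
    go ((j , u , w) ∷ L) ((pju , 0≤w) ∷ adm) = subst (0ℚ ℚ.≤_)
      (begin
        w ℚ.* (α ℚ.* ℕ→ℚ j ℚ.+ β ℚ.* ℕ→ℚ u ℚ.- γ) ℚ.+ (α ℚ.* s₁ ℚ.+ β ℚ.* s₂ ℚ.- γ ℚ.* s₀)
          ≡⟨ cong (ℚ._+ (α ℚ.* s₁ ℚ.+ β ℚ.* s₂ ℚ.- γ ℚ.* s₀)) (solve 6 (λ α β γ w j u → w :* (α :* j :+ β :* u :- γ) := α :* (w :* j) :+ β :* (w :* u) :- γ :* w) refl α β γ w (ℕ→ℚ j) (ℕ→ℚ u)) ⟩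
        (α ℚ.* (w ℚ.* ℕ→ℚ j) ℚ.+ β ℚ.* (w ℚ.* ℕ→ℚ u) ℚ.- γ ℚ.* w) ℚ.+ (α ℚ.* s₁ ℚ.+ β ℚ.* s₂ ℚ.- γ ℚ.* s₀)
          ≡⟨ solve 6 (λ a b c d e f → (a :+ b :- c) :+ (d :+ e :- f) := (a :+ d) :+ (b :+ e) :- (c :+ f)) refl (α ℚ.* (w ℚ.* ℕ→ℚ j)) (β ℚ.* (w ℚ.* ℕ→ℚ u)) (γ ℚ.* w) (α ℚ.* s₁) (β ℚ.* s₂) (γ ℚ.* s₀) ⟩
        (α ℚ.* (w ℚ.* ℕ→ℚ j) ℚ.+ α ℚ.* s₁) ℚ.+ (β ℚ.* (w ℚ.* ℕ→ℚ u) ℚ.+ β ℚ.* s₂) ℚ.- (γ ℚ.* w ℚ.+ γ ℚ.* s₀)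
          ≡⟨ cong₂ ℚ._-_ (cong₂ ℚ._+_ (ℚP.*-distribˡ-+ α _ s₁) (ℚP.*-distribˡ-+ β _ s₂)) (ℚP.*-distribˡ-+ γ w s₀) ⟨
        α ℚ.* (w ℚ.* ℕ→ℚ j ℚ.+ s₁) ℚ.+ β ℚ.* (w ℚ.* ℕ→ℚ u ℚ.+ s₂) ℚ.- γ ℚ.* (w ℚ.+ s₀) ∎)
      (0≤p+q (0≤p*q 0≤w (p≤q⇒0≤q-p (bound j u pju))) (go L adm))
      where
      open ≡-Reasoning
      open ℚ-Solver
      s₀ = weights L
      s₁ = abscissae L
      s₂ = ordinates L

  hull-vertex : ∀ {j u} → P j u → InHull P (ℕ→ℚ j) (ℕ→ℚ u)
  hull-vertex {j} {u} pju = (j , u , 1ℚ) ∷ [] , (pju , ℚP.nonNegative⁻¹ 1ℚ) ∷ [] , refl , single (ℕ→ℚ j) , single (ℕ→ℚ u)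
    where
    single : ∀ z → 1ℚ ℚ.* z ℚ.+ 0ℚ ≡ z
    single z = trans (ℚP.+-identityʳ _) (ℚP.*-identityˡ z)

  hull-convex : ∀ {x y x' y'} a b → 0ℚ ℚ.≤ a → 0ℚ ℚ.≤ b → a ℚ.+ b ≡ 1ℚ → InHull P x y → InHull P x' y' →
                InHull P (a ℚ.* x ℚ.+ b ℚ.* x') (a ℚ.* y ℚ.+ b ℚ.* y')
  hull-convex a b 0≤a 0≤b a+b≡1 (L , adm , S₀ , S₁ , S₂) (L' , adm' , S₀' , S₁' , S₂') =
      map (scale a) L ++ map (scale b) L'
    , AllP.++⁺ (scaled a 0≤a L adm) (scaled b 0≤b L' adm')
    , trans (sum-++ _ (map (scale a) L) _) (trans (cong₂ ℚ._+_ (trans (sum₀ a L) (cong (a ℚ.*_) S₀)) (trans (sum₀ b L') (cong (b ℚ.*_) S₀'))) (trans (cong₂ ℚ._+_ (ℚP.*-identityʳ a) (ℚP.*-identityʳ b)) a+b≡1))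
    , trans (sum-++ _ (map (scale a) L) _) (cong₂ ℚ._+_ (trans (sum₁ a L) (cong (a ℚ.*_) S₁)) (trans (sum₁ b L') (cong (b ℚ.*_) S₁')))
    , trans (sum-++ _ (map (scale a) L) _) (cong₂ ℚ._+_ (trans (sum₂ a L) (cong (a ℚ.*_) S₂)) (trans (sum₂ b L') (cong (b ℚ.*_) S₂')))
    where
    scale : ℚ → Weighted → Weighted
    scale c (j , u , w) = j , u , c ℚ.* w
    scaled : ∀ c → 0ℚ ℚ.≤ c → ∀ L → All _ L → All _ (map (scale c) L)
    scaled c 0≤c []                []                = []
    scaled c 0≤c ((j , u , w) ∷ L) ((pju , 0≤w) ∷ l) = (pju , 0≤p*q 0≤c 0≤w) ∷ scaled c 0≤c L l
    sum-++ : ∀ (f : Weighted → ℚ) L L' → sumℚ (map f (L ++ L')) ≡ sumℚ (map f L) ℚ.+ sumℚ (map f L')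
    sum-++ f []      L' = sym (ℚP.+-identityˡ _)
    sum-++ f (z ∷ L) L' = trans (cong (f z ℚ.+_) (sum-++ f L L')) (sym (ℚP.+-assoc (f z) _ _))
    sum₀ : ∀ c L → weights (map (scale c) L) ≡ c ℚ.* weights L
    sum₀ c []                = sym (ℚP.*-zeroʳ c)
    sum₀ c ((j , u , w) ∷ L) = trans (cong (c ℚ.* w ℚ.+_) (sum₀ c L)) (sym (ℚP.*-distribˡ-+ c w _))
    sum₁ : ∀ c L → abscissae (map (scale c) L) ≡ c ℚ.* abscissae L
    sum₁ c []                = sym (ℚP.*-zeroʳ c)
    sum₁ c ((j , u , w) ∷ L) = trans (cong₂ ℚ._+_ (ℚP.*-assoc c w (ℕ→ℚ j)) (sum₁ c L)) (sym (ℚP.*-distribˡ-+ c _ _))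
    sum₂ : ∀ c L → ordinates (map (scale c) L) ≡ c ℚ.* ordinates L
    sum₂ c []                = sym (ℚP.*-zeroʳ c)
    sum₂ c ((j , u , w) ∷ L) = trans (cong₂ ℚ._+_ (ℚP.*-assoc c w (ℕ→ℚ u)) (sum₂ c L)) (sym (ℚP.*-distribˡ-+ c _ _))

  hull-0≤y : ∀ {x y} → InHull P x y → 0ℚ ℚ.≤ y
  hull-0≤y {x} {y} h = subst (0ℚ ℚ.≤_) (solve 2 (λ x y → con 0ℚ :* x :+ con 1ℚ :* y := y) refl x y)
    (hull-halfplane 0ℚ 1ℚ 0ℚ (λ j u _ → subst (0ℚ ℚ.≤_) (solve 2 (λ x y → y := con 0ℚ :* x :+ con 1ℚ :* y) refl (ℕ→ℚ j) (ℕ→ℚ u)) (0≤ℕ→ℚ u)) h)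
    where open ℚ-Solver

  hull-0≤x : ∀ {x y} → InHull P x y → 0ℚ ℚ.≤ x
  hull-0≤x {x} {y} h = subst (0ℚ ℚ.≤_) (solve 2 (λ x y → con 1ℚ :* x :+ con 0ℚ :* y := x) refl x y)
    (hull-halfplane 1ℚ 0ℚ 0ℚ (λ j u _ → subst (0ℚ ℚ.≤_) (solve 2 (λ x y → x := con 1ℚ :* x :+ con 0ℚ :* y) refl (ℕ→ℚ j) (ℕ→ℚ u)) (0≤ℕ→ℚ j)) h)
    where open ℚ-Solver

  private
    descent : ∀ y x {s a b} → s ℚ.< 0ℚ → a ℚ.< b → ¬ (y ℚ.+ s ℚ.* (a ℚ.- x) ℚ.≤ y ℚ.+ s ℚ.* (b ℚ.- x))
    descent y x {s} {a} {b} s<0 a<b l = ℚP.<-irrefl refl (ℚP.≤-<-trans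
      (subst (0ℚ ℚ.≤_) (solve 5 (λ s a b y x → (y :+ s :* (b :- x)) :- (y :+ s :* (a :- x)) := s :* (b :- a)) refl s a b y x) (p≤q⇒0≤q-p l))
      (subst (s ℚ.* (b ℚ.- a) ℚ.<_) (ℚP.*-zeroˡ (b ℚ.- a)) (ℚP.*-monoˡ-<-pos (b ℚ.- a) {{ℚ.positive (p<q⇒0<q-p a<b)}} s<0)))
      where open ℚ-Solver

  -- Beyond a point of the cloud on the horizontal axis the lower hull cannot descend.
  principal-x≤ : ∀ {m} → P m 0 → ∀ {x y} → OnPrincipal P x y → x ℚ.≤ ℕ→ℚ m
  principal-x≤ {m} pm0 {x} {y} (_ , x₁ , x₂ , s , x₁<x₂ , _ , x≤x₂ , s<0 , side) with x₂ ℚ.≤? ℕ→ℚ m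
  ... | yes x₂≤m = ℚP.≤-trans x≤x₂ x₂≤m
  ... | no  x₂≰m = ⊥-elim (beyond (ℚP.≤-total x₁ M))
    where
    M = ℕ→ℚ m
    M<x₂ : M ℚ.< x₂
    M<x₂ = ℚP.≰⇒> x₂≰m
    val : ℚ → ℚ
    val z = y ℚ.+ s ℚ.* (z ℚ.- x)
    end : InHull P x₂ (val x₂)
    end = proj₁ (side x₂ (ℚP.<⇒≤ x₁<x₂) ℚP.≤-refl)
    beyond : x₁ ℚ.≤ M ⊎ M ℚ.≤ x₁ → ⊥
    -- At M the lower hull has height at most 0, and at x₂ > M at least 0, so it does not descend in
    -- between.
    beyond (inj₁ x₁≤M) = descent y x s<0 M<x₂ (ℚP.≤-trans (proj₂ (side M x₁≤M (ℚP.<⇒≤ M<x₂)) 0ℚ (hull-vertex pm0)) (hull-0≤y end))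
    beyond (inj₂ M≤x₁) = descent y x s<0 x₁<x₂ (ℚP.≤-trans (proj₂ (side x₁ ℚP.≤-refl (ℚP.<⇒≤ x₁<x₂)) _ mid) mid≤)
      where
      open ℚ-Solver
      0<D = p<q⇒0<q-p M<x₂
      instance
        D-positive : ℚ.Positive (x₂ ℚ.- M)
        D-positive = ℚ.positive 0<D
        D-nonZero : ℚ.NonZero (x₂ ℚ.- M)
        D-nonZero = ℚP.pos⇒nonZero (x₂ ℚ.- M)
      i = ℚ.1/ (x₂ ℚ.- M)
      0≤i : 0ℚ ℚ.≤ i
      0≤i = ℚP.nonNegative⁻¹ i {{ℚP.pos⇒nonNeg i {{ℚP.1/pos⇒pos (x₂ ℚ.- M)}}}}
      iD≡1 : i ℚ.* (x₂ ℚ.- M) ≡ 1ℚ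
      iD≡1 = ℚP.*-inverseˡ (x₂ ℚ.- M)
      -- Weights with a x₂ + b M = x₁: the chord from (M, 0) to the right end of the side has height
      -- at most `val x₂` above x₁, whereas a descending side is strictly higher there.
      a = i ℚ.* (x₁ ℚ.- M)
      b = i ℚ.* (x₂ ℚ.- x₁)
      0≤b = 0≤p*q 0≤i (p≤q⇒0≤q-p (ℚP.<⇒≤ x₁<x₂))
      a+b≡1 : a ℚ.+ b ≡ 1ℚ
      a+b≡1 = trans (solve 4 (λ i x₁ x₂ M → i :* (x₁ :- M) :+ i :* (x₂ :- x₁) := i :* (x₂ :- M)) refl i x₁ x₂ M) iD≡1
      x₁≡ : a ℚ.* x₂ ℚ.+ b ℚ.* M ≡ x₁
      x₁≡ = trans (solve 4 (λ i x₁ x₂ M → i :* (x₁ :- M) :* x₂ :+ i :* (x₂ :- x₁) :* M := i :* (x₂ :- M) :* x₁) refl i x₁ x₂ M) (trans (cong (ℚ._* x₁) iD≡1) (ℚP.*-identityˡ x₁))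
      mid : InHull P x₁ (a ℚ.* val x₂ ℚ.+ b ℚ.* 0ℚ)
      mid = subst (λ z → InHull P z (a ℚ.* val x₂ ℚ.+ b ℚ.* 0ℚ)) x₁≡ (hull-convex a b (0≤p*q 0≤i (p≤q⇒0≤q-p M≤x₁)) 0≤b a+b≡1 end (hull-vertex pm0))
      mid≤ : a ℚ.* val x₂ ℚ.+ b ℚ.* 0ℚ ℚ.≤ val x₂
      mid≤ = 0≤q-p⇒p≤q (subst (0ℚ ℚ.≤_)
        (trans (solve 3 (λ a b v → b :* v := (a :+ b) :* v :- (a :* v :+ b :* con 0ℚ)) refl a b (val x₂)) (cong (ℚ._- (a ℚ.* val x₂ ℚ.+ b ℚ.* 0ℚ)) (trans (cong (ℚ._* val x₂) a+b≡1) (ℚP.*-identityˡ (val x₂)))))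
        (0≤p*q 0≤b (hull-0≤y end)))

  -- The principal polygon does not reach beyond abscissa 1, where the lower hull has height at most
  -- 0; no point with two positive coordinates fits below it.
  principal-empty : P 1 0 → ∀ q → ¬ BelowPrincipal P q
  principal-empty p10 (i , k) (1≤i , 1≤k , y , onP , k≤y) =
    ℕP.<⇒≱ 1≤k (ℕ→ℚ-cancel (ℚP.≤-trans k≤y (proj₂ (proj₁ onP) 0ℚ (subst (λ i → InHull P (ℕ→ℚ i) 0ℚ) (sym i≡1) (hull-vertex p10)))))
    where
    i≡1 : i ≡ 1
    i≡1 = ℕP.≤-antisym (ℕ→ℚ-cancel (principal-x≤ p10 onP)) 1≤i

  -- V x + 2 y = 2 V is the line through (0, V) and (2, 0) with denominators cleared; `onOrAbove`
  -- makes it a supporting line of the cloud.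
  module SingleSide (V : ℕ) (1≤V : 1 ≤ V) (left : P 0 V) (right : P 2 0) (onOrAbove : ∀ j u → P j u → 2 ℕ.* V ≤ V ℕ.* j ℕ.+ 2 ℕ.* u) where

    private
      v two : ℚ
      v = ℕ→ℚ V
      two = ℕ→ℚ 2

    OnSide : ℚ → ℚ → Set
    OnSide x y = 0ℚ ℚ.≤ x × x ℚ.≤ two × two ℚ.* y ≡ v ℚ.* (two ℚ.- x)

    above-side : ∀ {x y} → InHull P x y → v ℚ.* (two ℚ.- x) ℚ.≤ two ℚ.* y
    above-side {x} {y} h = 0≤q-p⇒p≤q (subst (0ℚ ℚ.≤_) (solve 4 (λ v x y t → (v :* x :+ t :* y) :- t :* v := t :* y :- v :* (t :- x)) refl v x y two)
      (p≤q⇒0≤q-p (hull-halfplane v two (two ℚ.* v) bound h)))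
      where
      open ℚ-Solver
      bound : ∀ j u → P j u → two ℚ.* v ℚ.≤ v ℚ.* ℕ→ℚ j ℚ.+ two ℚ.* ℕ→ℚ u
      bound j u pju = subst₂ ℚ._≤_ (ℕ→ℚ-* 2 V) (trans (ℕ→ℚ-+ (V ℕ.* j) (2 ℕ.* u)) (cong₂ ℚ._+_ (ℕ→ℚ-* V j) (ℕ→ℚ-* 2 u))) (ℕ→ℚ-mono (onOrAbove j u pju))

    side⊆lowerHull : ∀ {x y} → OnSide x y → OnLowerHull P x y
    side⊆lowerHull {x} {y} (0≤x , x≤2 , eq) =
        subst₂ (InHull P) (solve 1 (λ x → con ½ :* (con two :- x) :* con 0ℚ :+ con ½ :* x :* con two := x) refl x)
          (trans (solve 2 (λ v x → con ½ :* (con two :- x) :* v :+ con ½ :* x :* con 0ℚ := con ½ :* (v :* (con two :- x))) refl v x)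
            (trans (cong (½ ℚ.*_) (sym eq)) (solve 1 (λ y → con ½ :* (con two :* y) := y) refl y)))
          (hull-convex (½ ℚ.* (two ℚ.- x)) (½ ℚ.* x) (0≤p*q (ℚP.nonNegative⁻¹ ½) (p≤q⇒0≤q-p x≤2)) (0≤p*q (ℚP.nonNegative⁻¹ ½) 0≤x)
            (solve 1 (λ x → con ½ :* (con two :- x) :+ con ½ :* x := con 1ℚ) refl x) (hull-vertex left) (hull-vertex right))
      , λ y' h → 2q≤2p⇒q≤p (subst (ℚ._≤ two ℚ.* y') (sym eq) (above-side h))
      where open ℚ-Solver

    side⊆principal : ∀ {x y} → OnSide x y → OnPrincipal P x y
    side⊆principal {x} {y} onS@(0≤x , x≤2 , eq) = side⊆lowerHull onS , 0ℚ , two , s , ℚP.positive⁻¹ two , 0≤x , x≤2 , s<0 , λ z 0≤z z≤2 →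
      side⊆lowerHull (0≤z , z≤2 , (begin
        two ℚ.* (y ℚ.+ s ℚ.* (z ℚ.- x))              ≡⟨ solve 4 (λ v x y z → con two :* (y :+ (:- (con ½ :* v)) :* (z :- x)) := con two :* y :- v :* (z :- x)) refl v x y z ⟩
        two ℚ.* y ℚ.- v ℚ.* (z ℚ.- x)                ≡⟨ cong (ℚ._- v ℚ.* (z ℚ.- x)) eq ⟩
        v ℚ.* (two ℚ.- x) ℚ.- v ℚ.* (z ℚ.- x)        ≡⟨ solve 3 (λ v x z → v :* (con two :- x) :- v :* (z :- x) := v :* (con two :- z)) refl v x z ⟩
        v ℚ.* (two ℚ.- z)                            ∎))
      where
      open ≡-Reasoning
      open ℚ-Solver
      s = ℚ.- (½ ℚ.* v)
      s<0 : s ℚ.< 0ℚ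
      s<0 = ℚP.neg-antimono-< (subst (ℚ._< ½ ℚ.* v) (ℚP.*-zeroʳ ½) (ℚP.*-monoʳ-<-pos ½ (ℚP.<-≤-trans (ℚP.positive⁻¹ 1ℚ) (ℕ→ℚ-mono 1≤V))))

    -- The convex combination of the two vertices bounds a point of the lower hull from above, and
    -- the supporting line bounds it from below; `principal-x≤` at (2, 0) confines the abscissa.
    principal⊆side : ∀ {x y} → OnPrincipal P x y → OnSide x y
    principal⊆side {x} {y} onP@((h , lower) , _) = 0≤x , x≤2 , ℚP.≤-antisym 2y≤ (above-side h)
      where
      open ℚ-Solver
      0≤x = hull-0≤x h
      x≤2 = principal-x≤ right onP
      y₀ = ½ ℚ.* (v ℚ.* (two ℚ.- x))
      2y₀≡ : two ℚ.* y₀ ≡ v ℚ.* (two ℚ.- x)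
      2y₀≡ = solve 1 (λ w → con two :* (con ½ :* w) := w) refl (v ℚ.* (two ℚ.- x))
      2y≤ : two ℚ.* y ℚ.≤ v ℚ.* (two ℚ.- x)
      2y≤ = subst (two ℚ.* y ℚ.≤_) 2y₀≡ (ℚP.*-monoˡ-≤-nonNeg two (lower y₀ (proj₁ (side⊆lowerHull (0≤x , x≤2 , 2y₀≡)))))

    -- The side has height V/2 at abscissa 1 and 0 at abscissa 2, so the points counted are (1, k)
    -- with k from 1 to the integer part of V/2. The shift in `pt` is there because `upTo` starts at
    -- 0.
    below-count : HasCard (BelowPrincipal P) (V ℕ./ 2)
    below-count = map pt (upTo (V ℕ./ 2)) , UniqueP.map⁺ pt-injective (UniqueP.upTo⁺ (V ℕ./ 2))
                , trans (ListP.length-map pt (upTo (V ℕ./ 2))) (ListP.length-upTo (V ℕ./ 2)) , to , from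
      where
      open ℚ-Solver
      pt : ℕ → ℕ × ℕ
      pt k = 1 , suc k
      pt-injective : ∀ {k l} → pt k ≡ pt l → k ≡ l
      pt-injective refl = refl
      below : ∀ k → k ∈ upTo (V ℕ./ 2) → BelowPrincipal P (pt k)
      below k k∈ = s≤s z≤n , s≤s z≤n , ½ ℚ.* v
          , side⊆principal (ℚP.nonNegative⁻¹ 1ℚ , ℕ→ℚ-mono {1} {2} (s≤s z≤n) , solve 1 (λ v → con two :* (con ½ :* v) := v :* (con two :- con 1ℚ)) refl v)
          , 2q≤2p⇒q≤p (subst₂ ℚ._≤_ (ℕ→ℚ-* 2 (suc k)) (solve 1 (λ v → v := con two :* (con ½ :* v)) refl v) (ℕ→ℚ-mono 2k≤V))
        where
        2k≤V : 2 ℕ.* suc k ≤ V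
        2k≤V = subst (_≤ V) (ℕP.*-comm (suc k) 2) (ℕP.≤-trans (ℕP.*-monoˡ-≤ 2 (MemP.∈-upTo⁻ k∈)) (DivMod.m/n*n≤m V 2))
      to : ∀ q → q ∈ map pt (upTo (V ℕ./ 2)) → BelowPrincipal P q
      to q q∈ = let k , k∈ , q≡ = MemP.∈-map⁻ pt q∈ in subst (BelowPrincipal P) (sym q≡) (below k k∈)
      from : ∀ q → BelowPrincipal P q → q ∈ map pt (upTo (V ℕ./ 2))
      from (i , k) (1≤i , 1≤k , y , onP , k≤y) = let _ , i≤2 , eq = principal⊆side onP in cases i 1≤i (ℕ→ℚ-cancel i≤2) eq k 1≤k k≤y
        where
        cases : ∀ i → 1 ≤ i → i ≤ 2 → two ℚ.* y ≡ v ℚ.* (two ℚ.- ℕ→ℚ i) → ∀ k → 1 ≤ k → ℕ→ℚ k ℚ.≤ y → (i , k) ∈ map pt (upTo (V ℕ./ 2))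
        cases (suc zero) _ _ eq (suc k) _ k≤y = MemP.∈-map⁺ pt (MemP.∈-upTo⁺ (subst (_≤ V ℕ./ 2) (DivMod.m*n/n≡m (suc k) 2) (DivMod./-monoˡ-≤ 2 k2≤V)))
          where
          k2≤V : suc k ℕ.* 2 ≤ V
          k2≤V = ℕ→ℚ-cancel (subst₂ ℚ._≤_ (trans (sym (ℕ→ℚ-* 2 (suc k))) (cong ℕ→ℚ (ℕP.*-comm 2 (suc k)))) (trans eq (solve 1 (λ v → v :* (con two :- con 1ℚ) := v) refl v)) (ℚP.*-monoˡ-≤-nonNeg two k≤y))
        cases (suc (suc zero)) _ _ eq k 1≤k k≤y = ⊥-elim (ℕP.<⇒≱ 1≤k (ℕ→ℚ-cancel (ℚP.≤-trans k≤y (2q≤2p⇒q≤p (ℚP.≤-reflexive (trans eq (solve 1 (λ v → v :* (con two :- con two) := con two :* con 0ℚ) refl v)))))))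
        cases (suc (suc (suc i))) _ (s≤s (s≤s ())) _ _ _ _

-- Valuations

^-∣ : ∀ {m n} p → m ≤ n → p ℕ.^ m ℕD.∣ p ℕ.^ n
^-∣ {m} {n} p m≤n = subst (p ℕ.^ m ℕD.∣_) (trans (sym (ℕP.^-distribˡ-+-* p m (n ℕ.∸ m))) (cong (p ℕ.^_) (ℕP.m+[n∸m]≡n m≤n))) (ℕD.m∣m*n (p ℕ.^ (n ℕ.∸ m)))

polyVal-lower : ∀ {p a u} v → (∀ k → (+ (p ℕ.^ v)) ℤD.∣ coeff a k) → PolyVal p a u → v ≤ u
polyVal-lower {p} {a} {u} v d (_ , ¬d) with v ℕ.≤? u
... | yes v≤u = v≤u
... | no  v≰u = ⊥-elim (¬d λ k → ℕD.∣-trans (^-∣ p (ℕP.≰⇒> v≰u)) (d k))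

-- Newton polygons of K A² + k at the quadratic factors and at K

module Core {p : ℕ} (pp : Prime p) (A K L : Poly) (c e a : ℤ) (K-linear : K ≡ a ∷ + 1 ∷ [])
  (discriminant : constP c ≈[ 0 ] L *ₚ ((A +ₚ constP (+ 2) *ₚ K *ₚ deriv A) *ₚ (A +ₚ constP (+ 2) *ₚ K *ₚ deriv A)) -ₚ constP e *ₚ (K *ₚ (A *ₚ A)))
  (p∤c : ¬ ((+ p) ℤD.∣ c))
  (f : Poly) (k : ℤ) (f≈ : f ≈[ 0 ] K *ₚ (A *ₚ A) +ₚ constP k)
  (V : ℕ) (1≤V : 1 ≤ V) (k-val : IntVal p k V) where

  open Separable pp A K L c e a K-linear discriminant p∤c
  open ModPrime pp
  open Divisibility p

  p∣k : (+ p) ℤD.∣ k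
  p∣k = ℕD.∣-trans (subst (λ v → p ℕD.∣ p ℕ.^ v) (ℕP.suc-pred V {{ℕ.>-nonZero 1≤V}}) (ℕD.m∣m*n (p ℕ.^ ℕ.pred V))) (proj₁ k-val)

  f≈KA² : f ≈[ p ] K *ₚ (A *ₚ A)
  f≈KA² = ≈-trans (≈₀⇒≈ f≈) (≈-trans (+-cong (≈-refl {K *ₚ (A *ₚ A)}) (≈-trans (constP-≈0 k p∣k) (≈-sym constP-0))) (solve 1 (λ z → z :+ con (+ 0) := z) ≈-refl (K *ₚ (A *ₚ A))))
    where open ModRing p
          open Solver

  -- One power more than V: a₀ ≡ k modulo p^(V+1) carries the exact valuation V from k to a₀, not
  -- just a lower bound.
  q : ℕ
  q = p ℕ.^ suc V

  p∣q : p ℕD.∣ q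
  p∣q = ℕD.m∣m*n (p ℕ.^ V)

  p^V∣q : p ℕ.^ V ℕD.∣ q
  p^V∣q = ℕD.n∣m*n p

  PolygonIsSide : Cloud → Set
  PolygonIsSide P = ∀ x y →
      (OnPrincipal P x y → 0ℚ ℚ.≤ x × x ℚ.≤ ℕ→ℚ 2 × ℕ→ℚ 2 ℚ.* y ≡ ℕ→ℚ V ℚ.* (ℕ→ℚ 2 ℚ.- x))
    × (0ℚ ℚ.≤ x × x ℚ.≤ ℕ→ℚ 2 × ℕ→ℚ 2 ℚ.* y ≡ ℕ→ℚ V ℚ.* (ℕ→ℚ 2 ℚ.- x) → OnPrincipal P x y)

  module Lifted {d : ℕ} {φ g φ̂ ĝ : Poly} (md : MonicDeg (suc d) φ) (A≈φg : A ≈[ p ] φ *ₚ g) (cop : Coprimeₚ φ g)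
    (md̂ : MonicDeg (suc d) φ̂) (φ̂≈φ : φ̂ ≈[ p ] φ) (ĝ≈g : ĝ ≈[ p ] g) (A≈φ̂ĝ : A ≈[ q ] φ̂ *ₚ ĝ)
    (as : List Poly) (small : ∀ j → DegLt (suc d) (nth as j)) (dev : f ≈[ 0 ] devSum φ̂ as) where

    f≈φ̂ĝ : f ≈[ q ] K *ₚ ((φ̂ *ₚ ĝ) *ₚ (φ̂ *ₚ ĝ)) +ₚ constP k
    f≈φ̂ĝ = ≈-trans (≈₀⇒≈ f≈) (+-cong (*-cong (≈-refl {K}) (*-cong A≈φ̂ĝ A≈φ̂ĝ)) (≈-refl {constP k}))
      where open ModRing q

    a₀≈k : nth as 0 ≈[ q ] constP k
    a₀≈k = digit₀ {as = as} {K} {ĝ} {k} md̂ small (≈₀⇒≈ dev) f≈φ̂ĝ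

    a₁≈0 : nth as 1 ≈[ q ] []
    a₁≈0 = digit₁ {as = as} {K} {ĝ} {k} md̂ small (≈₀⇒≈ dev) f≈φ̂ĝ

    a₀-divisible : ∀ i → (+ (p ℕ.^ V)) ℤD.∣ coeff (nth as 0) i
    a₀-divisible = ≈[]⇒∣ (≈-trans (weaken p^V∣q a₀≈k) (constP-≈0 k (proj₁ k-val)))
      where open ModRing (p ℕ.^ V)

    a₁-divisible : ∀ i → (+ (p ℕ.^ V)) ℤD.∣ coeff (nth as 1) i
    a₁-divisible = ≈[]⇒∣ (weaken p^V∣q a₁≈0)

    a₀-val : PolyVal p (nth as 0) V
    a₀-val = a₀-divisible , λ d → proj₂ k-val (≈[]⇒∣ (≈-trans (≈-sym a₀≈k) (∣⇒≈[] d)) 0)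
      where open ModRing q

    a₂≉0 : ¬ (nth as 2 ≈[ p ] [])
    a₂≉0 a₂≈0 = ∤K*g² md A≈φg cop (divides h (begin
        K *ₚ (g *ₚ g)                        ≈⟨ *-cong (≈-refl {K}) (*-cong (≈-sym ĝ≈g) (≈-sym ĝ≈g)) ⟩
        K *ₚ (ĝ *ₚ ĝ)                        ≈⟨ solve 2 (λ u v → u := (u :- v) :+ v) ≈-refl (K *ₚ (ĝ *ₚ ĝ)) (φ̂ *ₚ h) ⟩
        K *ₚ (ĝ *ₚ ĝ) -ₚ φ̂ *ₚ h +ₚ φ̂ *ₚ h    ≈⟨ +-cong (≈-trans (≈-sym (weaken p∣q (proj₂ digits))) (≈-trans a₂≈0 (≈-sym constP-0))) (*-cong φ̂≈φ (≈-refl {h})) ⟩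
        constP (+ 0) +ₚ φ *ₚ h               ≈⟨ solve 1 (λ u → con (+ 0) :+ u := u) ≈-refl (φ *ₚ h) ⟩
        φ *ₚ h                               ∎))
      where
      open ModRing p
      open SetoidReasoning setoid
      open Solver
      digits = digit₂ {as = as} {K} {ĝ} {k} md̂ small (≈₀⇒≈ dev) f≈φ̂ĝ
      h = proj₁ digits

    a₂-val : PolyVal p (nth as 2) 0
    a₂-val = (λ i → ℕD.1∣ _) , λ d → a₂≉0 (∣⇒≈[] λ i → subst (λ z → (+ z) ℤD.∣ coeff (nth as 2) i) (ℕP.*-identityʳ p) (d i))

    -- The digits a₀ and a₁ are divisible by p^V, so u ≥ V there; from j = 2 on, the term V j alone
    -- reaches 2 V.
    onOrAbove : ∀ j u → Pts p as j u → 2 ℕ.* V ≤ V ℕ.* j ℕ.+ 2 ℕ.* u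
    onOrAbove zero          u val = ℕP.≤-trans (ℕP.*-monoʳ-≤ 2 (polyVal-lower {p} {nth as 0} {u} V a₀-divisible val)) (ℕP.m≤n+m (2 ℕ.* u) (V ℕ.* 0))
    onOrAbove (suc zero)    u val = ℕP.≤-trans (ℕP.*-monoʳ-≤ 2 (polyVal-lower {p} {nth as 1} {u} V a₁-divisible val)) (ℕP.m≤n+m (2 ℕ.* u) (V ℕ.* 1))
    onOrAbove (suc (suc j)) u val = ℕP.≤-trans (subst (_≤ V ℕ.* (2 ℕ.+ j)) (ℕP.*-comm V 2) (ℕP.*-monoʳ-≤ V (s≤s (s≤s z≤n)))) (ℕP.m≤m+n (V ℕ.* (2 ℕ.+ j)) (2 ℕ.* u))

    module Side = SingleSide {Pts p as} V 1≤V a₀-val a₂-val onOrAbove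

    polygon : PolygonIsSide (Pts p as)
    polygon x y = Side.principal⊆side , Side.side⊆principal

    index : IsIndex φ̂ (Pts p as) ((V / 2) ℕ.* deg φ̂)
    index = (V / 2) , Side.below-count , ℕP.*-comm (V / 2) (deg φ̂)

  LiftOf : Poly → Poly → Set
  LiftOf φ φ̂ = Monic φ̂ × φ̂ ≡ₚ φ [mod p ]
    × (∀ as → IsDevelopment φ̂ f as → PolygonIsSide (Pts p as) × IsIndex φ̂ (Pts p as) ((V / 2) ℕ.* deg φ̂))

  quadratic-factor : ∀ φ → Monic φ → IrredModP p φ → φ *ₚ φ ∣[ p ] f → Σ Poly (LiftOf φ)
  quadratic-factor φ φ-monic irr φφ∣f = fromDegree (deg φ) (monic⇒monicDeg φ φ-monic)
    where
    fromDegree : ∀ d → MonicDeg d φ → Σ Poly (LiftOf φ)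
    fromDegree zero    md = ⊥-elim (proj₁ irr λ i → subst (λ z → (+ p) ℤD.∣ z) (sym (above md (suc i) (s≤s z≤n))) (p ℕD.∣0))
    fromDegree (suc d) md = fromLift (simple-factor md irr (∣-respʳ f≈KA² φφ∣f))
      where
      fromLift : (Σ Poly λ g → A ≈[ p ] φ *ₚ g × Coprimeₚ φ g) → Σ Poly (LiftOf φ)
      fromLift (g , A≈φg , cop) = conclude (hensel md A≈φg cop V)
        where
        conclude : (Σ Poly λ φ̂ → Σ Poly λ ĝ → MonicDeg (suc d) φ̂ × φ̂ ≈[ p ] φ × ĝ ≈[ p ] g × A ≈[ q ] φ̂ *ₚ ĝ) → Σ Poly (LiftOf φ)
        conclude (φ̂ , ĝ , md̂ , φ̂≈φ , ĝ≈g , A≈φ̂ĝ) = φ̂ , proj₁ (monicDeg⇒monic φ̂ md̂) , coeffs φ̂≈φ , development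
          where
          development : ∀ as → IsDevelopment φ̂ f as → PolygonIsSide (Pts p as) × IsIndex φ̂ (Pts p as) ((V / 2) ℕ.* deg φ̂)
          development as (digits , dev) = polygon , index
            where open Lifted md A≈φg cop md̂ φ̂≈φ ĝ≈g A≈φ̂ĝ as (nth-degLt (subst (λ D → All (λ a → length (strip a) ≤ D) as) (proj₂ (monicDeg⇒monic φ̂ md̂)) digits)) (≈ₚ⇒≈ dev)

  linear-factor : ∀ as → IsDevelopment K f as → IsIndex K (Pts p as) 0
  linear-factor as (digits , dev) = 0 , ([] , [] , refl , (λ q ()) , λ q below → ⊥-elim (principal-empty a₁-val q below)) , sym (ℕP.*-zeroʳ (deg K))
    where
    a₁-val : PolyVal p (nth as 1) 0
    a₁-val = (λ i → ℕD.1∣ _) , λ d → linear-digit₁≉0 {f = f} {as}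
      (nth-degLt (subst (λ D → All (λ a → length (strip a) ≤ D) as) (cong deg K-linear) digits))
      (≈ₚ⇒≈ dev) f≈KA² (∣⇒≈[] λ i → subst (λ z → (+ z) ℤD.∣ coeff (nth as 1) i) (ℕP.*-identityʳ p) (d i))

-- Arithmetic of the parameters

prime∣^⇒∣ : ∀ {p} → Prime p → ∀ m n → p ℕD.∣ m ℕ.^ n → p ℕD.∣ m
prime∣^⇒∣ pp m zero    d = ⊥-elim (prime∤1 pp d)
prime∣^⇒∣ pp m (suc n) d = [ (λ d → d) , prime∣^⇒∣ pp m n ]′ (euclidsLemma m (m ℕ.^ n) pp d)

prime∣prime⇒≡ : ∀ {p q} → Prime p → Prime q → p ℕD.∣ q → p ≡ q
prime∣prime⇒≡ pp pq d = [ (λ { refl → ⊥-elim (prime∤1 pp ℕD.∣-refl) }) , (λ e → e) ]′ (prime⇒irreducible pq d)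

odd⇒1+2m : ∀ n → ¬ (2 ℕD.∣ n) → Σ ℕ λ m → n ≡ suc (m ℕ.* 2)
odd⇒1+2m n odd = byRemainder (n ℕ.% 2) (DivMod.m%n<n n 2) (DivMod.m≡m%n+[m/n]*n n 2)
  where
  byRemainder : ∀ r → r < 2 → n ≡ r ℕ.+ n / 2 ℕ.* 2 → Σ ℕ λ m → n ≡ suc (m ℕ.* 2)
  byRemainder zero          _             e = ⊥-elim (odd (ℕD.divides (n / 2) e))
  byRemainder (suc zero)    _             e = n / 2 , e
  byRemainder (suc (suc r)) (s≤s (s≤s ())) e

∤⇒^∣-cancelʳ : ∀ {p} → Prime p → ∀ v a b → ¬ (p ℕD.∣ b) → p ℕ.^ v ℕD.∣ a ℕ.* b → p ℕ.^ v ℕD.∣ a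
∤⇒^∣-cancelʳ pp zero a b p∤b d = ℕD.1∣ a
∤⇒^∣-cancelʳ {p} pp (suc v) a b p∤b d = [ step , (λ p∣b → ⊥-elim (p∤b p∣b)) ]′ (euclidsLemma a b pp (ℕD.∣-trans (ℕD.m∣m*n (p ℕ.^ v)) d))
  where
  instance _ = prime⇒nonZero pp
  step : p ℕD.∣ a → p ℕ.^ suc v ℕD.∣ a
  step (ℕD.divides a' refl) = subst (p ℕ.^ suc v ℕD.∣_) (ℕP.*-comm p a') (ℕD.*-monoʳ-∣ p (∤⇒^∣-cancelʳ pp v a' b p∤b
    (ℕD.*-cancelˡ-∣ p (subst (p ℕ.^ suc v ℕD.∣_) (trans (cong (ℕ._* b) (ℕP.*-comm a' p)) (ℕP.*-assoc p a' b)) d))))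

module _ {p : ℕ} (pp : Prime p) (odd : ¬ (2 ℕD.∣ p)) where

  odd-prime∤4 : ¬ (p ℕD.∣ 4)
  odd-prime∤4 d = [ two , two ]′ (euclidsLemma 2 2 pp d)
    where
    two : p ℕD.∣ 2 → ⊥
    two d = odd (ℕD.∣-reflexive (sym (prime∣prime⇒≡ pp prime[2] d)))

  module _ (t ε : ℤ) (∣2ε∣≡4 : ℤ.∣ + 2 ℤ.* ε ∣ ≡ 4) (ε²≡4 : ε ℤ.* ε ≡ + 4) (p²∣t-ε : (+ (p ℕ.^ 2)) ℤD.∣ (t ℤ.- ε)) (V : ℕ) (val : IntVal p (t ℤ.* t ℤ.- + 4) V) where

    private
      p∣t-ε : (+ p) ℤD.∣ (t ℤ.- ε)
      p∣t-ε = ℕD.∣-trans (ℕD.m∣m*n (p ℕ.^ 1)) p²∣t-ε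

      p∤t+ε : ¬ ((+ p) ℤD.∣ (t ℤ.+ ε))
      p∤t+ε d = odd-prime∤4 (subst (p ℕD.∣_) ∣2ε∣≡4 (∣-resp (solve 2 (λ t e → (t :+ e) :+ (:- (t :- e)) := con (+ 2) :* e) refl t ε)
          (∣-+ {p} {t ℤ.+ ε} { - (t ℤ.- ε)} d (∣-neg {p} {t ℤ.- ε} p∣t-ε))))
        where open ℤ-Solver

      factor : t ℤ.* t ℤ.- + 4 ≡ (t ℤ.- ε) ℤ.* (t ℤ.+ ε)
      factor = trans (cong (λ z → t ℤ.* t ℤ.- z) (sym ε²≡4)) (solve 2 (λ t e → t :* t :- e :* e := (t :- e) :* (t :+ e)) refl t ε)
        where open ℤ-Solver

      abs-factor : ℤ.∣ t ℤ.* t ℤ.- + 4 ∣ ≡ ℤ.∣ t ℤ.- ε ∣ ℕ.* ℤ.∣ t ℤ.+ ε ∣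
      abs-factor = trans (cong ℤ.∣_∣ factor) (ℤP.abs-* (t ℤ.- ε) (t ℤ.+ ε))

      abs-swap : ℤ.∣ t ℤ.- ε ∣ ≡ ℤ.∣ ε ℤ.- t ∣
      abs-swap = ℤP.∣i-j∣≡∣j-i∣ t ε

    -- In t² - 4 = (t - ε)(t + ε) the second factor is a unit modulo p: otherwise p would divide 2 ε
    -- = ±4. The whole valuation therefore sits in t - ε.
    valuation : IntVal p (ε ℤ.- t) V
    valuation = subst (p ℕ.^ V ℕD.∣_) abs-swap (∤⇒^∣-cancelʳ pp V ℤ.∣ t ℤ.- ε ∣ ℤ.∣ t ℤ.+ ε ∣ p∤t+ε (subst (p ℕ.^ V ℕD.∣_) abs-factor (proj₁ val)))
              , λ d → proj₂ val (subst (p ℕ.^ suc V ℕD.∣_) (sym abs-factor) (ℕD.∣m⇒∣m*n ℤ.∣ t ℤ.+ ε ∣ (subst (p ℕ.^ suc V ℕD.∣_) (sym abs-swap) d)))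

    valuation-positive : 1 ≤ V
    valuation-positive = positive V (proj₂ val)
      where
      positive : ∀ V → ¬ ((+ (p ℕ.^ suc V)) ℤD.∣ (t ℤ.* t ℤ.- + 4)) → 1 ≤ V
      positive zero    ¬d = ⊥-elim (¬d (subst (p ℕ.^ 1 ℕD.∣_) (sym abs-factor) (ℕD.∣m⇒∣m*n ℤ.∣ t ℤ.+ ε ∣ (subst (ℕD._∣ ℤ.∣ t ℤ.- ε ∣) (sym (ℕP.*-identityʳ p)) p∣t-ε))))
      positive (suc V) _  = s≤s z≤n

halve : ∀ ε → ε ≡ + 2 ⊎ ε ≡ - (+ 2) → Σ ℤ λ η → ε ≡ + 2 ℤ.* η × η ℤ.* η ≡ + 1 × ℤ.∣ + 2 ℤ.* ε ∣ ≡ 4 × ε ℤ.* ε ≡ + 4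
halve _ (inj₁ refl) = + 1 , refl , refl , refl , refl
halve _ (inj₂ refl) = - (+ 1) , refl , refl , refl , refl

-- Application to the iterates of the Chebyshev polynomial

theorem6p1 :
  (T : Poly) (ℓ n : ℕ) (t : ℤ) (p : ℕ) (ε : ℤ) (r : ℕ) (φ : Fin r → Poly) →
  Prime ℓ → ¬ (2 ℕD.∣ ℓ) → IsChebyshev ℓ T → 1 ≤ n →
  Prime p → ¬ (2 ℕD.∣ p) → p ≢ ℓ →
  (ε ≡ + 2 ⊎ ε ≡ - (+ 2)) → (+ (p ℕ.^ 2)) ℤD.∣ (t ℤ.- ε) →
  (∀ i → Monic (φ i) × IrredModP p (φ i)) →
  (iterₚ n T -ₚ constP t)
    ≡ₚ ((- ε ∷ + 1 ∷ []) *ₚ prodFin r (λ i → φ i *ₚ φ i)) [mod p ] →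
  (V : ℕ) → IntVal p (t ℤ.* t ℤ.- + 4) V →
    (∀ i → Σ Poly λ φ̂ → Monic φ̂ × φ̂ ≡ₚ φ i [mod p ]
       × (∀ as → IsDevelopment φ̂ (iterₚ n T -ₚ constP t) as →
            (∀ x y → (OnPrincipal (Pts p as) x y →
                        0ℚ ℚ.≤ x × x ℚ.≤ ℕ→ℚ 2
                        × ℕ→ℚ 2 ℚ.* y ≡ ℕ→ℚ V ℚ.* (ℕ→ℚ 2 ℚ.- x))
                   × (0ℚ ℚ.≤ x × x ℚ.≤ ℕ→ℚ 2
                        × ℕ→ℚ 2 ℚ.* y ≡ ℕ→ℚ V ℚ.* (ℕ→ℚ 2 ℚ.- x)
                      → OnPrincipal (Pts p as) x y))
            × IsIndex φ̂ (Pts p as) ((V / 2) ℕ.* deg φ̂)))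
    × (∀ as → IsDevelopment (- ε ∷ + 1 ∷ []) (iterₚ n T -ₚ constP t) as →
         IsIndex (- ε ∷ + 1 ∷ []) (Pts p as) 0)
theorem6p1 T ℓ n t p ε r φ pℓ ℓ-odd cheb _ pp p-odd p≢ℓ ε≡±2 p²∣t-ε φ-irr Φ≡ V val =
  (λ i → quadratic-factor (φ i) (proj₁ (φ-irr i)) (proj₂ (φ-irr i)) (φ²∣Φ i)) , linear-factor
  where
  η : ℤ
  η = proj₁ (halve ε ε≡±2)
  ε≡2η = proj₁ (proj₂ (halve ε ε≡±2))
  η²≡1 = proj₁ (proj₂ (proj₂ (halve ε ε≡±2)))
  ∣2ε∣≡4 = proj₁ (proj₂ (proj₂ (proj₂ (halve ε ε≡±2))))
  ε²≡4 = proj₂ (proj₂ (proj₂ (proj₂ (halve ε ε≡±2))))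
  N-odd = odd⇒1+2m (ℓ ℕ.^ n) (λ d → ℓ-odd (prime∣^⇒∣ prime[2] ℓ n d))
  M : ℕ
  M = proj₁ N-odd
  N : ℤ
  N = + suc (M ℕ.* 2)
  A K Φ : Poly
  A = W η M
  K = - ε ∷ + 1 ∷ []
  Φ = iterₚ n T -ₚ constP t
  squares = factorisation ε η M ε≡2η η²≡1
  -- Up to sign this constant is 4 ℓ^(2n), prime to p because p is odd and different from ℓ.
  p∤c : ¬ ((+ p) ℤD.∣ (+ 2 ℤ.* ε ℤ.* (N ℤ.* N)))
  p∤c d = [ (λ d4 → odd-prime∤4 pp p-odd (subst (p ℕD.∣_) ∣2ε∣≡4 d4))
          , (λ dNN → [ p∤N , p∤N ]′ (euclidsLemma (suc (M ℕ.* 2)) (suc (M ℕ.* 2)) pp (subst (p ℕD.∣_) (ℤP.abs-* N N) dNN))) ]′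
          (euclidsLemma ℤ.∣ + 2 ℤ.* ε ∣ ℤ.∣ N ℤ.* N ∣ pp (subst (p ℕD.∣_) (ℤP.abs-* (+ 2 ℤ.* ε) (N ℤ.* N)) d))
    where
    p∤N : ¬ (p ℕD.∣ suc (M ℕ.* 2))
    p∤N d = p≢ℓ (prime∣prime⇒≡ pp pℓ (prime∣^⇒∣ pp ℓ n (subst (p ℕD.∣_) (sym (proj₂ N-odd)) d)))
  Φ≈ : Φ ≈[ 0 ] K *ₚ (A *ₚ A) +ₚ constP (ε ℤ.- t)
  Φ≈ = begin
    iterₚ n T -ₚ constP t
      ≈⟨ +-cong (≈-trans (iter≈C ℓ T cheb n) (≡⇒≈ (cong C (proj₂ N-odd)))) (≈-refl { -ₚ constP t}) ⟩
    C (suc (M ℕ.* 2)) -ₚ constP t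
      ≈⟨ solve 3 (λ c t e → c :- t := (c :- e) :+ (e :- t)) ≈-refl (C (suc (M ℕ.* 2))) (constP t) (constP ε) ⟩
    (C (suc (M ℕ.* 2)) -ₚ constP ε) +ₚ constP (ε ℤ.- t)
      ≈⟨ +-cong (proj₁ squares) (≈-refl {constP (ε ℤ.- t)}) ⟩
    K *ₚ (A *ₚ A) +ₚ constP (ε ℤ.- t) ∎
    where open ModRing 0
          open SetoidReasoning setoid
          open Solver
  open Core pp A K (proj₁ (proj₂ squares)) (+ 2 ℤ.* ε ℤ.* (N ℤ.* N)) (N ℤ.* N) (- ε) refl (proj₂ (proj₂ squares)) p∤c
    Φ (ε ℤ.- t) Φ≈ V (valuation-positive pp p-odd t ε ∣2ε∣≡4 ε²≡4 p²∣t-ε V val) (valuation pp p-odd t ε ∣2ε∣≡4 ε²≡4 p²∣t-ε V val)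
  open Divisibility p
  φ²∣Φ : ∀ i → φ i *ₚ φ i ∣[ p ] Φ
  φ²∣Φ i = ∣-respʳ (ModRing.≈-sym p (mod Φ≡)) (∣-mulˡ K (prodFin-∣ r (λ i → φ i *ₚ φ i) i))
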